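{- Let $l$ be a prime number, let $\mathcal{T}_l\cong\prod_{k\in\mathbb{N}}\mathbb{Z}/l^k\mathbb{Z}$ (a pro-$l$ abelian group), and let $A$ be a finite abelian $l$-group. Then there exists a unique (up to isomorphism of topological groups) pro-$l$ abelian group $\mathcal{D}$ such that: (1) there is an exact sequence of pro-$l$ abelian groups (with continuous homomorphisms) $0\to\mathcal{T}_l\to\mathcal{D}\to A\to 0$; and (2) the topological closure of the torsion subgroup of $\mathcal{D}$ equals (the image of) $\mathcal{T}_l$. -}

module Defs where

open import Algebra.Bundles using (AbelianGroup)
open import Algebra.Morphism.Structures using (module GroupMorphisms)
import Algebra.Definitions.RawMonoid as Multiples
open import Data.Bool.Base using (Bool; true; false; if_then_else_)
open import Data.Fin.Base using (Fin)
open import Data.Integer.Base as ℤ using (ℤ; +_)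
import Data.Integer.Properties as ℤ
open import Data.Integer.Divisibility.Signed using (_∣_; divides; ∣m∣n⇒∣m+n; ∣m⇒∣-m)
open import Data.Integer.Tactic.RingSolver using (solve-∀)
open import Data.Nat.Base using (ℕ; NonZero; _^_)
open import Data.Product using (_×_; _,_; proj₁; proj₂; Σ-syntax; ∃-syntax)
open import Data.Product.Function.NonDependent.Setoid using (proj₁ₛ; proj₂ₛ)
open import Data.Product.Relation.Binary.Pointwise.NonDependent using (_×ₛ_)
open import Function.Base using (_∘_)
open import Function.Bundles using (Func; Inverse)
open import Function.Definitions using (Injective; Surjective; StrictlyInverseˡ; StrictlyInverseʳ)
open import Level using (0ℓ; Lift; lift; lower) renaming (suc to lsuc)
open import Relation.Binary.Bundles using (Setoid; Poset)
open import Relation.Binary.Definitions using (_Respects_)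
open import Relation.Binary.PropositionalEquality as ≡ using (_≡_; subst)
open import Relation.Unary using (Pred; _∈_; _≐_; _∩_; _≬_; _⊢_; ⋃; U)

open Func using (to; cong)

record Topology (S : Setoid 0ℓ 0ℓ) : Set₂ where
  open Setoid S using (Carrier; _≈_)
  field
    Open        : Pred (Pred Carrier 0ℓ) (lsuc 0ℓ)
    -- Open sets are subsets of the set that the setoid presents, so they
    -- respect _≈_, and openness is invariant under extensional equality.
    Open-resp-≈ : ∀ {V} → Open V → V Respects _≈_
    Open-resp-≐ : ∀ {V W} → V ≐ W → Open V → Open W
    Open-U      : Open U
    Open-∩      : ∀ {V W} → Open V → Open W → Open (V ∩ W)
    Open-⋃      : ∀ {I : Set} (V : I → Pred Carrier 0ℓ) → (∀ i → Open (V i)) → Open (⋃ I V)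

open Topology

module _ {S T : Setoid 0ℓ 0ℓ} where

  Continuous : Topology S → Topology T → Pred (Func S T) (lsuc 0ℓ)
  Continuous σ τ f = ∀ {V} → Open τ V → Open σ (to f ⊢ V)

discreteTopology : (S : Setoid 0ℓ 0ℓ) → Topology S
discreteTopology S = record
  { Open        = λ V → Lift (lsuc 0ℓ) (V Respects _≈_)
  ; Open-resp-≈ = lower
  ; Open-resp-≐ = λ (V⊆W , W⊆V) (lift r) → lift λ x≈y x∈W → V⊆W (r x≈y (W⊆V x∈W))
  ; Open-U      = lift _
  ; Open-∩      = λ (lift r) (lift s) → lift λ x≈y (x∈V , x∈W) → r x≈y x∈V , s x≈y x∈W
  ; Open-⋃      = λ _ r → lift λ x≈y (i , x∈V) → i , lower (r i) x≈y x∈V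
  } where open Setoid S using (_≈_)

-- The coarsest topology making every f i continuous.
module _ {S : Setoid 0ℓ 0ℓ} {I : Set} {T : I → Setoid 0ℓ 0ℓ}
         (τ : ∀ i → Topology (T i)) (f : ∀ i → Func S (T i)) where

  open Setoid S using (Carrier; _≈_)

  data InitialOpen : Pred (Pred Carrier 0ℓ) (lsuc 0ℓ) where
    preimage : ∀ i {V} → Open (τ i) V → InitialOpen (to (f i) ⊢ V)
    resp-≐   : ∀ {V W} → V ≐ W → InitialOpen V → InitialOpen W
    whole    : InitialOpen U
    _∩ₒ_     : ∀ {V W} → InitialOpen V → InitialOpen W → InitialOpen (V ∩ W)
    ⋃ₒ       : ∀ {J : Set} (V : J → Pred Carrier 0ℓ) →
               (∀ j → InitialOpen (V j)) → InitialOpen (⋃ J V)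

  InitialOpen-resp-≈ : ∀ {V} → InitialOpen V → V Respects _≈_
  InitialOpen-resp-≈ (preimage i o)         x≈y = Open-resp-≈ (τ i) o (cong (f i) x≈y)
  InitialOpen-resp-≈ (resp-≐ (V⊆W , W⊆V) o) x≈y = V⊆W ∘ InitialOpen-resp-≈ o x≈y ∘ W⊆V
  InitialOpen-resp-≈ whole                  x≈y = _
  InitialOpen-resp-≈ (o ∩ₒ p)               x≈y (x∈V , x∈W) =
    InitialOpen-resp-≈ o x≈y x∈V , InitialOpen-resp-≈ p x≈y x∈W
  InitialOpen-resp-≈ (⋃ₒ V o)               x≈y (j , x∈V) = j , InitialOpen-resp-≈ (o j) x≈y x∈V

  initialTopology : Topology S
  initialTopology = record
    { Open        = InitialOpen
    ; Open-resp-≈ = InitialOpen-resp-≈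
    ; Open-resp-≐ = resp-≐
    ; Open-U      = whole
    ; Open-∩      = _∩ₒ_
    ; Open-⋃      = ⋃ₒ
    }

  continuous-into-initial : ∀ {R} (ρ : Topology R) (g : Func R S) →
    (∀ i {V} → Open (τ i) V → Open ρ (to g ⊢ (to (f i) ⊢ V))) →
    Continuous ρ initialTopology g
  continuous-into-initial ρ g h (preimage i o)         = h i o
  continuous-into-initial ρ g h (resp-≐ (V⊆W , W⊆V) o) =
    Open-resp-≐ ρ (V⊆W , W⊆V) (continuous-into-initial ρ g h o)
  continuous-into-initial ρ g h whole                  = Open-U ρ
  continuous-into-initial ρ g h (o ∩ₒ p)               =
    Open-∩ ρ (continuous-into-initial ρ g h o) (continuous-into-initial ρ g h p)
  continuous-into-initial ρ g h (⋃ₒ V o)               =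
    Open-⋃ ρ _ (λ j → continuous-into-initial ρ g h (o j))

squareTopology : {S : Setoid 0ℓ 0ℓ} → Topology S → Topology (S ×ₛ S)
squareTopology {S} τ = initialTopology {I = Bool} (λ _ → τ)
  (λ b → if b then proj₁ₛ {B = S} else proj₂ₛ {A = S})

module _ {S : Setoid 0ℓ 0ℓ} (τ : Topology S) where

  open Setoid S using (Carrier)

  closure : Pred Carrier 0ℓ → Pred Carrier (lsuc 0ℓ)
  closure P x = ∀ {V} → Open τ V → x ∈ V → V ≬ P

module _ (G : AbelianGroup 0ℓ 0ℓ) where

  open AbelianGroup G

  ∙-func : Func (setoid ×ₛ setoid) setoid
  ∙-func = record { to = λ (x , y) → x ∙ y ; cong = λ (p , q) → ∙-cong p q }

  ⁻¹-func : Func setoid setoid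
  ⁻¹-func = record { to = _⁻¹ ; cong = ⁻¹-cong }

record TopologicalAbelianGroup : Set₂ where
  field
    abelianGroup : AbelianGroup 0ℓ 0ℓ

  open AbelianGroup abelianGroup public

  field
    topology      : Topology setoid
    ∙-continuous  : Continuous (squareTopology topology) topology (∙-func abelianGroup)
    ⁻¹-continuous : Continuous topology topology (⁻¹-func abelianGroup)

private
  module TG = TopologicalAbelianGroup

record ContinuousHomomorphism (G H : TopologicalAbelianGroup) : Set₁ where
  private
    module G = TopologicalAbelianGroup G
    module H = TopologicalAbelianGroup H
  open GroupMorphisms G.rawGroup H.rawGroup using (IsGroupHomomorphism)
  field
    func                : Func G.setoid H.setoid
    isGroupHomomorphism : IsGroupHomomorphism (to func)
    continuous          : Continuous G.topology H.topology func

  ⟦_⟧ : G.Carrier → H.Carrier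
  ⟦_⟧ = to func

  image : Pred H.Carrier 0ℓ
  image y = ∃[ x ] ⟦ x ⟧ H.≈ y

  kernel : Pred G.Carrier 0ℓ
  kernel x = ⟦ x ⟧ H.≈ H.ε

infix 4 _≅_

record _≅_ (G H : TopologicalAbelianGroup) : Set₁ where
  private
    module G = TopologicalAbelianGroup G
    module H = TopologicalAbelianGroup H
  field
    forward  : ContinuousHomomorphism G H
    backward : ContinuousHomomorphism H G
  private
    module F = ContinuousHomomorphism forward
    module B = ContinuousHomomorphism backward
  field
    inverseˡ : StrictlyInverseˡ H._≈_ F.⟦_⟧ B.⟦_⟧
    inverseʳ : StrictlyInverseʳ G._≈_ F.⟦_⟧ B.⟦_⟧

record IsShortExact {K G Q : TopologicalAbelianGroup}
  (ι : ContinuousHomomorphism K G) (π : ContinuousHomomorphism G Q) : Set where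
  private
    module K = TopologicalAbelianGroup K
    module G = TopologicalAbelianGroup G
    module Q = TopologicalAbelianGroup Q
    module ι = ContinuousHomomorphism ι
    module π = ContinuousHomomorphism π
  field
    injective  : Injective K._≈_ G._≈_ ι.⟦_⟧
    exact      : ι.image ≐ π.kernel
    surjective : Surjective G._≈_ Q._≈_ π.⟦_⟧

torsion : (G : TopologicalAbelianGroup) → Pred (TG.Carrier G) 0ℓ
torsion G x = Σ[ n ∈ ℕ ] NonZero n × n · x ≈ ε
  where
  open TopologicalAbelianGroup G
  open Multiples rawMonoid using () renaming (_×_ to _·_)

discrete : AbelianGroup 0ℓ 0ℓ → TopologicalAbelianGroup
discrete G = record
  { abelianGroup  = G
  ; topology      = discreteTopology setoid
  ; ∙-continuous  = λ {V} (lift r) → resp-≐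
      ( (λ ((_ , xy∈V) , x′≈x , y′≈y) → r (sym (∙-cong x′≈x y′≈y)) xy∈V)
      , (λ {p} p∈V → (p , p∈V) , refl , refl) )
      (⋃ₒ {J = Σ[ (x , y) ∈ Carrier × Carrier ] V (x ∙ y)} _
        (λ ((x , y) , _) → preimage true (singleton x) ∩ₒ preimage false (singleton y)))
  ; ⁻¹-continuous = λ (lift r) → lift λ x≈y → r (⁻¹-cong x≈y)
  }
  where
  open AbelianGroup G
  singleton : ∀ x → Open (discreteTopology setoid) (_≈ x)
  singleton x = lift λ y≈z y≈x → trans (sym y≈z) y≈x

module _ (H : AbelianGroup 0ℓ 0ℓ) {I : Set} (G : I → TopologicalAbelianGroup)
         (f : ∀ i → Func (AbelianGroup.setoid H) (TG.setoid (G i)))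
         (f-homo : ∀ i → GroupMorphisms.IsGroupHomomorphism
                           (AbelianGroup.rawGroup H) (TG.rawGroup (G i)) (to (f i)))
         where

  private
    module H = AbelianGroup H
    module homo i = GroupMorphisms.IsGroupHomomorphism (f-homo i)

    τ : Topology H.setoid
    τ = initialTopology (λ i → TG.topology (G i)) f

    f×f : ∀ i → Func (H.setoid ×ₛ H.setoid) (TG.setoid (G i) ×ₛ TG.setoid (G i))
    f×f i = record { to   = λ (x , y) → to (f i) x , to (f i) y
                   ; cong = λ (p , q) → cong (f i) p , cong (f i) q }

    f×f-continuous : ∀ i → Continuous (squareTopology τ) (squareTopology (TG.topology (G i))) (f×f i)
    f×f-continuous i = continuous-into-initial _ _ (squareTopology τ) (f×f i) λ where
      true  o → preimage true  (preimage i o)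
      false o → preimage false (preimage i o)

  initialGroup : TopologicalAbelianGroup
  initialGroup = record
    { abelianGroup  = H
    ; topology      = τ
    ; ∙-continuous  = continuous-into-initial _ _ (squareTopology τ) (∙-func H) λ i o →
        let r = Open-resp-≈ (TG.topology (G i)) o in
        resp-≐ ( (λ {(x , y)} → r (TG.sym (G i) (homo.homo i x y)))
               , (λ {(x , y)} → r (homo.homo i x y)) )
               (f×f-continuous i (TG.∙-continuous (G i) o))
    ; ⁻¹-continuous = continuous-into-initial _ _ τ (⁻¹-func H) λ i o →
        let r = Open-resp-≈ (TG.topology (G i)) o in
        resp-≐ ( (λ {x} → r (TG.sym (G i) (homo.⁻¹-homo i x)))
               , (λ {x} → r (homo.⁻¹-homo i x)) )
               (preimage i (TG.⁻¹-continuous (G i) o))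
    }

∏ : {I : Set} → (I → TopologicalAbelianGroup) → TopologicalAbelianGroup
∏ {I} G = initialGroup product G
  (λ i → record { to = λ x → x i ; cong = λ x≈y → x≈y i })
  (λ i → record
    { isMonoidHomomorphism = record
      { isMagmaHomomorphism = record
        { isRelHomomorphism = record { cong = λ x≈y → x≈y i }
        ; homo = λ _ _ → G.refl i }
      ; ε-homo = G.refl i }
    ; ⁻¹-homo = λ _ → G.refl i })
  where
  module G i = TopologicalAbelianGroup (G i)
  product : AbelianGroup 0ℓ 0ℓ
  product = record
    { Carrier = ∀ i → G.Carrier i
    ; _≈_     = λ x y → ∀ i → G._≈_ i (x i) (y i)
    ; _∙_     = λ x y i → G._∙_ i (x i) (y i)
    ; ε       = λ i → G.ε i
    ; _⁻¹     = λ x i → G._⁻¹ i (x i)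
    ; isAbelianGroup = record
      { isGroup = record
        { isMonoid = record
          { isSemigroup = record
            { isMagma = record
              { isEquivalence = record
                { refl  = λ i → G.refl i
                ; sym   = λ p i → G.sym i (p i)
                ; trans = λ p q i → G.trans i (p i) (q i) }
              ; ∙-cong = λ p q i → G.∙-cong i (p i) (q i) }
            ; assoc = λ x y z i → G.assoc i (x i) (y i) (z i) }
          ; identity = (λ x i → G.identityˡ i (x i)) , (λ x i → G.identityʳ i (x i)) }
        ; inverse = (λ x i → G.inverseˡ i (x i)) , (λ x i → G.inverseʳ i (x i))
        ; ⁻¹-cong = λ p i → G.⁻¹-cong i (p i) }
      ; comm = λ x y i → G.comm i (x i) (y i) } }

record InverseSystem : Set₁ where
  field
    index : Poset 0ℓ 0ℓ 0ℓ

  open Poset index public using (_≤_) renaming (Carrier to Index)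

  field
    nonempty : Index
    directed : ∀ i j → ∃[ k ] i ≤ k × j ≤ k
    group    : Index → AbelianGroup 0ℓ 0ℓ

  private
    module G i = AbelianGroup (group i)

  field
    φ      : ∀ {i j} → i ≤ j → Func (G.setoid j) (G.setoid i)
    φ-homo : ∀ {i j} (p : i ≤ j) →
             GroupMorphisms.IsGroupHomomorphism (G.rawGroup j) (G.rawGroup i) (to (φ p))
    -- Quantifying over all proofs of each inequality also makes φ independent
    -- of the proof.
    φ-id   : ∀ {i} (p : i ≤ i) x → G._≈_ i (to (φ p) x) x
    φ-∘    : ∀ {i j k} (p : i ≤ j) (q : j ≤ k) (r : i ≤ k) x →
             G._≈_ i (to (φ r) x) (to (φ p) (to (φ q) x))

-- The topology is the one induced from the product of the discrete groups, i.e. it is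
-- the initial topology for the projections.
inverseLimit : InverseSystem → TopologicalAbelianGroup
inverseLimit system = initialGroup limit (λ i → discrete (group i))
  (λ i → record { to = λ x → proj₁ x i ; cong = λ x≈y → x≈y i })
  (λ i → record
    { isMonoidHomomorphism = record
      { isMagmaHomomorphism = record
        { isRelHomomorphism = record { cong = λ x≈y → x≈y i }
        ; homo = λ _ _ → G.refl i }
      ; ε-homo = G.refl i }
    ; ⁻¹-homo = λ _ → G.refl i })
  where
  open InverseSystem system
  module G i = AbelianGroup (group i)
  module φ {i} {j} (p : i ≤ j) = GroupMorphisms.IsGroupHomomorphism (φ-homo p)
  limit : AbelianGroup 0ℓ 0ℓ
  limit = record
    { Carrier = Σ[ x ∈ (∀ i → G.Carrier i) ] (∀ {i j} (p : i ≤ j) → G._≈_ i (to (φ p) (x j)) (x i))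
    ; _≈_     = λ (x , _) (y , _) → ∀ i → G._≈_ i (x i) (y i)
    ; _∙_     = λ (x , c) (y , d) →
        (λ i → G._∙_ i (x i) (y i)) ,
        (λ {i} {j} p → G.trans i (φ.homo p (x j) (y j)) (G.∙-cong i (c p) (d p)))
    ; ε       = (λ i → G.ε i) , (λ p → φ.ε-homo p)
    ; _⁻¹     = λ (x , c) →
        (λ i → G._⁻¹ i (x i)) ,
        (λ {i} {j} p → G.trans i (φ.⁻¹-homo p (x j)) (G.⁻¹-cong i (c p)))
    ; isAbelianGroup = record
      { isGroup = record
        { isMonoid = record
          { isSemigroup = record
            { isMagma = record
              { isEquivalence = record
                { refl  = λ i → G.refl i
                ; sym   = λ p i → G.sym i (p i)
                ; trans = λ p q i → G.trans i (p i) (q i) }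
              ; ∙-cong = λ p q i → G.∙-cong i (p i) (q i) }
            ; assoc = λ (x , _) (y , _) (z , _) i → G.assoc i (x i) (y i) (z i) }
          ; identity = (λ (x , _) i → G.identityˡ i (x i)) , (λ (x , _) i → G.identityʳ i (x i)) }
        ; inverse = (λ (x , _) i → G.inverseˡ i (x i)) , (λ (x , _) i → G.inverseʳ i (x i))
        ; ⁻¹-cong = λ p i → G.⁻¹-cong i (p i) }
      ; comm = λ (x , _) (y , _) i → G.comm i (x i) (y i) } }

IsFiniteGroupOfPowerOrder : ℕ → AbelianGroup 0ℓ 0ℓ → Set
IsFiniteGroupOfPowerOrder l G =
  ∃[ n ] Inverse (≡.setoid (Fin (l ^ n))) (AbelianGroup.setoid G)

IsPro : ℕ → TopologicalAbelianGroup → Set₁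
IsPro l G = Σ[ system ∈ InverseSystem ]
  (∀ i → IsFiniteGroupOfPowerOrder l (InverseSystem.group system i)) ×
  G ≅ inverseLimit system

ℤ/_ : ℕ → AbelianGroup 0ℓ 0ℓ
ℤ/ n = record
  { Carrier = ℤ
  ; _≈_     = _≡ₙ_
  ; _∙_     = ℤ._+_
  ; ε       = ℤ.0ℤ
  ; _⁻¹     = ℤ.-_
  ; isAbelianGroup = record
    { isGroup = record
      { isMonoid = record
        { isSemigroup = record
          { isMagma = record
            { isEquivalence = record
              { refl  = λ {x} → reflexive {x} ≡.refl
              ; sym   = λ {x} {y} p → subst (+ n ∣_) (sym-lemma x y) (∣m⇒∣-m p)
              ; trans = λ {x} {y} {z} p q → subst (+ n ∣_) (trans-lemma x y z) (∣m∣n⇒∣m+n p q) }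
            ; ∙-cong = λ {x} {y} {u} {v} p q → subst (+ n ∣_) (∙-lemma x y u v) (∣m∣n⇒∣m+n p q) }
          ; assoc = λ x y z → reflexive (ℤ.+-assoc x y z) }
        ; identity = (λ x → reflexive (ℤ.+-identityˡ x)) , (λ x → reflexive (ℤ.+-identityʳ x)) }
      ; inverse = (λ x → reflexive (ℤ.+-inverseˡ x)) , (λ x → reflexive (ℤ.+-inverseʳ x))
      ; ⁻¹-cong = λ {x} {y} p → subst (+ n ∣_) (⁻¹-lemma x y) (∣m⇒∣-m p) }
    ; comm = λ x y → reflexive (ℤ.+-comm x y) } }
  where
  _≡ₙ_ : ℤ → ℤ → Set
  x ≡ₙ y = + n ∣ x ℤ.- y

  reflexive : ∀ {x y} → x ≡ y → x ≡ₙ y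
  reflexive {x} ≡.refl = divides ℤ.0ℤ (ℤ.+-inverseʳ x)

  sym-lemma : ∀ x y → ℤ.- (x ℤ.- y) ≡ y ℤ.- x
  sym-lemma = solve-∀

  trans-lemma : ∀ x y z → (x ℤ.- y) ℤ.+ (y ℤ.- z) ≡ x ℤ.- z
  trans-lemma = solve-∀

  ∙-lemma : ∀ x y u v → (x ℤ.- y) ℤ.+ (u ℤ.- v) ≡ (x ℤ.+ u) ℤ.- (y ℤ.+ v)
  ∙-lemma = solve-∀

  ⁻¹-lemma : ∀ x y → ℤ.- (x ℤ.- y) ≡ (ℤ.- x) ℤ.- (ℤ.- y)
  ⁻¹-lemma = solve-∀

record ExtensionByTorsionClosure (T A D : TopologicalAbelianGroup) : Set₁ where
  field
    ι               : ContinuousHomomorphism T D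
    π               : ContinuousHomomorphism D A
    isShortExact    : IsShortExact ι π
    torsion-closure : closure (TG.topology D) (torsion D) ≐ ContinuousHomomorphism.image ι

module Submission where

-- Write A = ℤᴺ / R.  Hermite reduction gives R a basis M, and an extension D of A by
-- P = ∏ ℤ/lᵏ with lifted generators is determined by the elements tⱼ of P lying over Mⱼ.
-- The torsion condition says that for every n the vectors (tⱼ(k))ⱼ with k ≥ n span ℤᴺ
-- modulo l and the columns of M: a functional killing them all would produce an
-- element outside P that is torsion modulo P, and Nakayama lifts from l to powers of l.
--
-- Uniqueness: given two families t, t′ with this spanning property, cut ℕ into
-- blocks long enough for both; combinations read from the even blocks correct t to
-- t′ on the odd blocks, and then conversely.  Each correction is a continuous shear of P,
-- and the composite maps one extension onto the other.  As P is compact, its topology is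
-- the one induced from any pro-l group D, so the isomorphism is bicontinuous.
--
-- Existence: take the tⱼ for which (tⱼ(k))ⱼ is the unit vector number k mod N.

open import Defs
open import Algebra.Bundles using (AbelianGroup)
import Algebra.Construct.DirectProduct as DirectProduct
import Algebra.Construct.Pointwise as Pointwise
open import Algebra.Morphism.Structures using (module GroupMorphisms)
import Algebra.Properties.AbelianGroup as AbelianGroupProperties
import Algebra.Properties.CommutativeMonoid.Mult as Mult
import Algebra.Properties.CommutativeMonoid.Sum as Sum
import Algebra.Properties.CommutativeSemigroup as CommutativeSemigroupProperties
open import Axiom.ExcludedMiddle using (ExcludedMiddle)
open import Data.Bool.Base using (Bool; true; false; not)
open import Data.Empty using (⊥; ⊥-elim)
open import Data.Fin.Base using (Fin; zero; suc; toℕ; fromℕ<; remQuot; combine)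
open import Data.Fin.Permutation using (permutation)
import Data.Fin.Properties as Fin
open import Data.Integer.Base as ℤ using (ℤ; +_; -[1+_]; ∣_∣; _⊖_)
open import Data.Integer.Divisibility.Signed
open import Data.Integer.DivMod using (_/ℕ_; _%ℕ_; n%ℕd<d; a≡a%ℕn+[a/ℕn]*n)
import Data.Integer.Properties as ℤ
open import Data.Integer.Tactic.RingSolver using (solve-∀)
open import Data.Nat.Base as ℕ using (ℕ; zero; suc; NonZero; _^_; _≤_; _<_; _⊔_)
open import Data.Nat.Coprimality using (coprime-Bézout)
import Data.Nat.Divisibility as ℕ∣
open import Data.Nat.DivMod using (_mod_; m%n<n; [m+kn]%n≡m%n; m<n⇒m%n≡m)
open import Data.Nat.GCD using (module Bézout)
open import Data.Nat.Induction using (<-rec)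
open import Data.Nat.Primality using (Prime; euclidsLemma; prime⇒irreducible; prime⇒nonZero; prime⇒nonTrivial)
import Data.Nat.Properties as ℕ
open import Data.Product using (_×_; _,_; proj₁; proj₂; ∃!; ∃-syntax; Σ-syntax; uncurry)
open import Data.Sum.Base using (_⊎_; inj₁; inj₂)
open import Function.Base using (_∘_)
open import Function.Bundles using (Func; Inverse)
open import Function.Properties.Bijection using (Bijection⇒Inverse)
open import Level using (0ℓ; lift)
open import Relation.Binary.Bundles using (Poset)
open import Relation.Binary.PropositionalEquality as ≡ using (_≡_; subst)
import Relation.Binary.Reasoning.Setoid as SetoidReasoning
open import Relation.Nullary using (¬_; yes; no; contradiction)
open import Relation.Unary using (Pred; _∈_)

-- The generators of A are all of its elements, so N is the order of A and R contains N ℤᴺ.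
--
-- What shapes the uniqueness proof is invertibility. An integral combination of coordinates i of P
-- is well defined modulo lᵏ if every i ≥ k, and continuity allows finitely many i for each k.
-- Taking t to t′ in one go would read and write the same coordinates, and such a map need not be
-- invertible. When the coordinates read and those written are disjoint, subtracting in place of
-- adding gives the inverse; hence the detour over a family equal to t on the even blocks and to t′
-- elsewhere.
--
-- At coordinate k the correction has to hold modulo lᵏ, whereas duality gives spanning modulo l
-- only; Nakayama bridges this without lengthening the windows, so the blocks can be fixed in
-- advance.
--
-- For existence, `k mod N` makes every unit vector recur in every tail. If l d lies in P while d
-- does not, then l d has coordinates prime to l at arbitrarily large k, so d has infinite order.

private
  module TG = TopologicalAbelianGroup

-- Homomorphisms of abelian groups and integral linear combinations

record Hom (G H : AbelianGroup 0ℓ 0ℓ) : Set where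
  private
    module G = AbelianGroup G
    module H = AbelianGroup H
    module H′ = AbelianGroupProperties H
  field
    func : Func G.setoid H.setoid

  open Func func public using (cong) renaming (to to ⟦_⟧)

  field
    homo : ∀ x y → ⟦ x G.∙ y ⟧ H.≈ ⟦ x ⟧ H.∙ ⟦ y ⟧

  ε-homo : ⟦ G.ε ⟧ H.≈ H.ε
  ε-homo = H′.∙-cancelˡ ⟦ G.ε ⟧ _ _
    (H.trans (H.sym (homo _ _)) (H.trans (cong (G.identityˡ _)) (H.sym (H.identityʳ _))))

  ⁻¹-homo : ∀ x → ⟦ x G.⁻¹ ⟧ H.≈ ⟦ x ⟧ H.⁻¹
  ⁻¹-homo x = H′.inverseˡ-unique _ _
    (H.trans (H.sym (homo _ _)) (H.trans (cong (G.inverseˡ x)) ε-homo))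

  -‿homo : ∀ x y → ⟦ x G.- y ⟧ H.≈ ⟦ x ⟧ H.- ⟦ y ⟧
  -‿homo x y = H.trans (homo _ _) (H.∙-congˡ (⁻¹-homo y))

  isGroupHomomorphism : GroupMorphisms.IsGroupHomomorphism G.rawGroup H.rawGroup ⟦_⟧
  isGroupHomomorphism = record
    { isMonoidHomomorphism = record
      { isMagmaHomomorphism = record
        { isRelHomomorphism = record { cong = cong }
        ; homo = homo }
      ; ε-homo = ε-homo }
    ; ⁻¹-homo = ⁻¹-homo }

open Hom using (⟦_⟧; cong; homo; ε-homo)

module _ {G H : AbelianGroup 0ℓ 0ℓ} where
  private
    module G = AbelianGroup G
    module H = AbelianGroup H
    module H′ = AbelianGroupProperties H
    open CommutativeSemigroupProperties H.commutativeSemigroup using (interchange)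

  mkHom : (f : G.Carrier → H.Carrier) → (∀ {x y} → x G.≈ y → f x H.≈ f y) →
          (∀ x y → f (x G.∙ y) H.≈ f x H.∙ f y) → Hom G H
  mkHom f f-cong f-homo = record { func = record { to = f ; cong = f-cong } ; homo = f-homo }

  infixl 6 _+ʰ_

  _+ʰ_ : Hom G H → Hom G H → Hom G H
  f +ʰ g = mkHom (λ x → ⟦ f ⟧ x H.∙ ⟦ g ⟧ x) (λ p → H.∙-cong (cong f p) (cong g p))
    (λ x y → H.trans (H.∙-cong (homo f x y) (homo g x y)) (interchange _ _ _ _))

  -ʰ_ : Hom G H → Hom G H
  -ʰ f = mkHom (λ x → ⟦ f ⟧ x H.⁻¹) (λ p → H.⁻¹-cong (cong f p))
    (λ x y → H.trans (H.⁻¹-cong (homo f x y)) (H.sym (H′.⁻¹-∙-comm _ _)))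

  0ʰ : Hom G H
  0ʰ = mkHom (λ _ → H.ε) (λ _ → H.refl) (λ _ _ → H.sym (H.identityˡ _))

idʰ : ∀ {G} → Hom G G
idʰ {G} = mkHom (λ x → x) (λ p → p) (λ _ _ → AbelianGroup.refl G)

infixr 9 _∘ʰ_

_∘ʰ_ : ∀ {G H K} → Hom H K → Hom G H → Hom G K
_∘ʰ_ {K = K} g f = mkHom (λ x → ⟦ g ⟧ (⟦ f ⟧ x)) (λ p → cong g (cong f p))
  (λ x y → AbelianGroup.trans K (cong g (homo f x y)) (homo g _ _))

ℤ⁺ : AbelianGroup 0ℓ 0ℓ
ℤ⁺ = ℤ.+-0-abelianGroup

ℤ^_ : Set → AbelianGroup 0ℓ 0ℓ
ℤ^ I = Pointwise.abelianGroup I ℤ⁺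

-- Recursive rather than by deciding equality, so that sums against a unit vector reduce along the
-- recursion of `sum`.
δ : ∀ {r} → Fin r → Fin r → ℤ
δ zero    zero    = ℤ.1ℤ
δ zero    (suc j) = ℤ.0ℤ
δ (suc i) zero    = ℤ.0ℤ
δ (suc i) (suc j) = δ i j

module LinearCombination (G : AbelianGroup 0ℓ 0ℓ) where

  open AbelianGroup G
  open AbelianGroupProperties G
  open CommutativeSemigroupProperties commutativeSemigroup using (interchange)
  open Mult commutativeMonoid using () renaming
    (_×_ to _×ⁿ_; ×-congʳ to ×ⁿ-congʳ; ×-homo-+ to ×ⁿ-homo-+; ×-distrib-+ to ×ⁿ-distrib-∙)
  open Sum commutativeMonoid using (sum; sum-cong-≋; ∑-distrib-+)
  open SetoidReasoning (AbelianGroup.setoid G)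

  infixr 8 _·_

  _·_ : ℤ → Carrier → Carrier
  (+ n) · x = n ×ⁿ x
  -[1+ n ] · x = (suc n ×ⁿ x) ⁻¹

  ·-congˡ : ∀ z {x y} → x ≈ y → z · x ≈ z · y
  ·-congˡ (+ n) = ×ⁿ-congʳ n
  ·-congˡ -[1+ n ] p = ⁻¹-cong (×ⁿ-congʳ (suc n) p)

  ·-distribˡ : ∀ z x y → z · (x ∙ y) ≈ z · x ∙ z · y
  ·-distribˡ (+ n) x y = ×ⁿ-distrib-∙ x y n
  ·-distribˡ -[1+ n ] x y =
    trans (⁻¹-cong (×ⁿ-distrib-∙ x y (suc n))) (sym (⁻¹-∙-comm _ _))

  private
    ⊖-· : ∀ m n x → (m ⊖ n) · x ≈ m ×ⁿ x - n ×ⁿ x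
    ⊖-· m zero x = sym (trans (∙-congˡ ε⁻¹≈ε) (identityʳ _))
    ⊖-· zero (suc n) x = sym (identityˡ _)
    ⊖-· (suc m) (suc n) x = begin
      (suc m ⊖ suc n) · x             ≡⟨ ≡.cong (_· x) (ℤ.[1+m]⊖[1+n]≡m⊖n m n) ⟩
      (m ⊖ n) · x                     ≈⟨ ⊖-· m n x ⟩
      m ×ⁿ x - n ×ⁿ x                 ≈⟨ identityˡ _ ⟨
      ε ∙ (m ×ⁿ x - n ×ⁿ x)           ≈⟨ ∙-congʳ (inverseʳ x) ⟨
      (x - x) ∙ (m ×ⁿ x - n ×ⁿ x)     ≈⟨ interchange _ _ _ _ ⟩
      suc m ×ⁿ x ∙ (x ⁻¹ ∙ (n ×ⁿ x) ⁻¹) ≈⟨ ∙-congˡ (⁻¹-∙-comm _ _) ⟩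
      suc m ×ⁿ x - suc n ×ⁿ x         ∎

  ·-distribʳ : ∀ x y z → (y ℤ.+ z) · x ≈ y · x ∙ z · x
  ·-distribʳ x (+ m) (+ n) = ×ⁿ-homo-+ x m n
  ·-distribʳ x (+ m) -[1+ n ] = ⊖-· m (suc n) x
  ·-distribʳ x -[1+ m ] (+ n) = trans (⊖-· n (suc m) x) (comm _ _)
  ·-distribʳ x -[1+ m ] -[1+ n ] = begin
    (suc (suc (m ℕ.+ n)) ×ⁿ x) ⁻¹       ≡⟨ ≡.cong (λ k → (suc k ×ⁿ x) ⁻¹) (ℕ.+-suc m n) ⟨
    ((suc m ℕ.+ suc n) ×ⁿ x) ⁻¹         ≈⟨ ⁻¹-cong (×ⁿ-homo-+ x (suc m) (suc n)) ⟩
    (suc m ×ⁿ x ∙ suc n ×ⁿ x) ⁻¹        ≈⟨ ⁻¹-∙-comm _ _ ⟨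
    -[1+ m ] · x ∙ -[1+ n ] · x         ∎

  lc : ∀ {r} → (Fin r → ℤ) → (Fin r → Carrier) → Carrier
  lc v x = sum (λ i → v i · x i)

  lc-cong : ∀ {r} {v w : Fin r → ℤ} {x y} → (∀ i → v i ≡ w i) → (∀ i → x i ≈ y i) → lc v x ≈ lc w y
  lc-cong {v = v} v≗w x≈y =
    sum-cong-≋ (λ i → trans (·-congˡ (v i) (x≈y i)) (reflexive (≡.cong (_· _) (v≗w i))))

  lc-congʳ : ∀ {r} (v : Fin r → ℤ) {x y} → (∀ i → x i ≈ y i) → lc v x ≈ lc v y
  lc-congʳ v = lc-cong {v = v} (λ _ → ≡.refl)

  lcʰ : ∀ {r} → (Fin r → Carrier) → Hom (ℤ^ Fin r) G
  lcʰ {r} x = mkHom (λ v → lc v x) (λ v≗w → lc-cong v≗w (λ _ → refl))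
    (λ v w → trans (sum-cong-≋ (λ i → ·-distribʳ (x i) (v i) (w i))) (∑-distrib-+ {r} _ _))

  lc-distribˡ : ∀ {r} (v : Fin r → ℤ) x y → lc v (λ i → x i ∙ y i) ≈ lc v x ∙ lc v y
  lc-distribˡ {r} v x y =
    trans (sum-cong-≋ (λ i → ·-distribˡ (v i) (x i) (y i))) (∑-distrib-+ {r} _ _)

  ·-ε : ∀ z → z · ε ≈ ε
  ·-ε z = ∙-cancelˡ (z · ε) _ _
    (trans (sym (·-distribˡ z ε ε)) (trans (·-congˡ z (identityˡ ε)) (sym (identityʳ _))))

  lc-ε : ∀ {r} (v : Fin r → ℤ) {x} → (∀ i → x i ≈ ε) → lc v x ≈ ε
  lc-ε {zero} v x≈ε = refl
  lc-ε {suc r} v x≈ε = trans (∙-cong (trans (·-congˡ (v zero) (x≈ε zero)) (·-ε (v zero)))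
                                    (lc-ε (v ∘ suc) (x≈ε ∘ suc))) (identityˡ _)

  lc-zero : ∀ {r} (x : Fin r → Carrier) → lc (λ _ → ℤ.0ℤ) x ≈ ε
  lc-zero {zero} x = refl
  lc-zero {suc r} x = trans (identityˡ _) (lc-zero (x ∘ suc))

  lc-δ : ∀ {r} i (x : Fin r → Carrier) → lc (δ i) x ≈ x i
  lc-δ zero x = trans (∙-cong (identityʳ _) (lc-zero (x ∘ suc))) (identityʳ _)
  lc-δ (suc i) x = trans (identityˡ _) (lc-δ i (x ∘ suc))

module _ {G H : AbelianGroup 0ℓ 0ℓ} (f : Hom G H) where
  private
    module G = LinearCombination G
    module H = LinearCombination H
  open AbelianGroup H

  ×-homo : ∀ n x → ⟦ f ⟧ ((+ n) G.· x) ≈ (+ n) H.· ⟦ f ⟧ x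
  ×-homo zero x = ε-homo f
  ×-homo (suc n) x = trans (homo f _ _) (∙-congˡ (×-homo n x))

  ·-homo : ∀ z x → ⟦ f ⟧ (z G.· x) ≈ z H.· ⟦ f ⟧ x
  ·-homo (+ n) x = ×-homo n x
  ·-homo -[1+ n ] x = trans (Hom.⁻¹-homo f _) (⁻¹-cong (×-homo (suc n) x))

  lc-homo : ∀ {r} (v : Fin r → ℤ) x → ⟦ f ⟧ (G.lc v x) ≈ H.lc v (⟦ f ⟧ ∘ x)
  lc-homo {zero} v x = ε-homo f
  lc-homo {suc r} v x = trans (homo f _ _) (∙-cong (·-homo (v zero) _) (lc-homo (v ∘ suc) (x ∘ suc)))

-- Submodules of ℤʳ

module ℤ-lc = LinearCombination ℤ⁺
module ℤ^-lc {I : Set} = LinearCombination (ℤ^ I)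

·≡* : ∀ z x → z ℤ-lc.· x ≡ z ℤ.* x
·≡* (+ n) x = pos n
  where
  pos : ∀ n → (+ n) ℤ-lc.· x ≡ + n ℤ.* x
  pos zero    = ≡.sym (ℤ.*-zeroˡ x)
  pos (suc n) = ≡.trans (≡.cong (ℤ._+_ x) (pos n)) (≡.sym (ℤ.suc-* (+ n) x))
·≡* -[1+ n ] x = ≡.trans (≡.cong ℤ.-_ (·≡* (+ suc n) x)) (ℤ.neg-distribˡ-* (+ suc n) x)

projʰ : ∀ {I} → I → Hom (ℤ^ I) ℤ⁺
projʰ i = mkHom (λ x → x i) (λ x≗y → x≗y i) (λ _ _ → ≡.refl)

*ʰ : ℤ → Hom ℤ⁺ ℤ⁺
*ʰ z = mkHom (ℤ._*_ z) (≡.cong (ℤ._*_ z)) (ℤ.*-distribˡ-+ z)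

ℤ^·-lookup : ∀ {I : Set} z (x : I → ℤ) i → (z ℤ^-lc.· x) i ≡ z ℤ.* x i
ℤ^·-lookup z x i = ≡.trans (·-homo (projʰ i) z x) (·≡* z (x i))

module _ (G : AbelianGroup 0ℓ 0ℓ) where
  open AbelianGroup G
  open LinearCombination G

  lc-* : ∀ {r} z (v : Fin r → ℤ) x → lc (λ i → z ℤ.* v i) x ≈ z · lc v x
  lc-* z v x = trans (sym (cong (lcʰ x) (ℤ^·-lookup z v))) (·-homo (lcʰ x) z v)

lc-δʳ : ∀ {r} (w : Fin r → ℤ) i → ℤ^-lc.lc w δ i ≡ w i
lc-δʳ {suc r} w i = ≡.trans
  (≡.cong₂ ℤ._+_ (ℤ^·-lookup (w zero) (δ zero) i) (lc-homo (projʰ i) (w ∘ suc) (δ ∘ suc))) (helper i)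
  where
  helper : ∀ i → w zero ℤ.* δ zero i ℤ.+ ℤ-lc.lc (w ∘ suc) (λ j → δ (suc j) i) ≡ w i
  helper zero = ≡.trans (≡.cong₂ ℤ._+_ (ℤ.*-identityʳ (w zero)) (ℤ-lc.lc-ε (w ∘ suc) (λ _ → ≡.refl)))
                        (ℤ.+-identityʳ _)
  helper (suc i) = ≡.trans
    (≡.cong₂ ℤ._+_ (ℤ.*-zeroʳ (w zero))
      (≡.trans (≡.sym (lc-homo (projʰ i) (w ∘ suc) δ)) (lc-δʳ (w ∘ suc) i)))
    (ℤ.+-identityˡ _)

record IsSubmodule {r} (L : (Fin r → ℤ) → Set) : Set where
  field
    resp     : ∀ {v w} → (∀ i → v i ≡ w i) → L v → L w
    +-closed : ∀ {v w} → L v → L w → L (λ i → v i ℤ.+ w i)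
    *-closed : ∀ z {v} → L v → L (λ i → z ℤ.* v i)

infixr 5 _◂_

_◂_ : ∀ {r} → ℤ → (Fin r → ℤ) → Fin (suc r) → ℤ
(z ◂ v) zero    = z
(z ◂ v) (suc i) = v i

restrict : ∀ {r} {L : (Fin (suc r) → ℤ) → Set} → IsSubmodule L → IsSubmodule (λ v → L (ℤ.0ℤ ◂ v))
restrict sub = record
  { resp     = λ v≗w → resp λ { zero → ≡.refl ; (suc i) → v≗w i }
  ; +-closed = λ p q → resp (λ { zero → ≡.refl ; (suc i) → ≡.refl }) (+-closed p q)
  ; *-closed = λ z p → resp (λ { zero → ℤ.*-zeroʳ z ; (suc i) → ≡.refl }) (*-closed z p) }
  where open IsSubmodule sub

-- There are as many vectors as coordinates because the submodules in question contain a nonzero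
-- multiple of each unit vector. Later comparisons of coefficients all rest on `unique`.
record Basis {r} (R : (Fin r → ℤ) → Set) : Set where
  field
    vectors     : Fin r → Fin r → ℤ
    member      : ∀ j → R (vectors j)
    complete    : ∀ {w} → R w → ∃[ v ] (∀ i → ℤ^-lc.lc v vectors i ≡ w i)
    independent : ∀ v → (∀ i → ℤ^-lc.lc v vectors i ≡ ℤ.0ℤ) → ∀ i → v i ≡ ℤ.0ℤ

  unique : ∀ {v w} → (∀ i → ℤ^-lc.lc v vectors i ≡ ℤ^-lc.lc w vectors i) → ∀ i → v i ≡ w i
  unique {v} {w} p i = ℤ.i-j≡0⇒i≡j (v i) (w i) (independent (λ i → v i ℤ.- w i)
    (λ i → ≡.trans (Hom.-‿homo (ℤ^-lc.lcʰ vectors) v w i) (ℤ.i≡j⇒i-j≡0 (p i))) i)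

module Classical (em : ExcludedMiddle 0ℓ) where

  least : (P : ℕ → Set) → ∀ n → P n → ∃[ m ] P m × (∀ k → k ℕ.< m → ¬ P k)
  least P = <-rec _ λ n rec Pn → case n rec Pn
    where
    case : ∀ n → (∀ {k} → k ℕ.< n → P k → ∃[ m ] P m × (∀ k → k ℕ.< m → ¬ P k)) →
           P n → ∃[ m ] P m × (∀ k → k ℕ.< m → ¬ P k)
    case n rec Pn with em {∃[ k ] k ℕ.< n × P k}
    ... | yes (k , k<n , Pk) = rec k<n Pk
    ... | no ¬p = n , Pn , λ k k<n Pk → ¬p (k , k<n , Pk)

  -- Hermite normal form: the first basis vector has the least positive first
  -- coordinate occurring in R, the others span the vectors of R starting with 0.
  basis : ∀ {r} {R : (Fin r → ℤ) → Set} → IsSubmodule R →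
          (∀ i → ∃[ n ] NonZero n × R (λ j → + n ℤ.* δ i j)) → Basis R
  basis {zero} sub _ = record
    { vectors = λ () ; member = λ () ; complete = λ _ → (λ ()) , λ () ; independent = λ _ _ () }
  basis {suc r} {R} sub mult = record
    { vectors     = vectors
    ; member      = λ { zero → R-b ; (suc j) → B.member j }
    ; complete    = complete
    ; independent = λ v p → let v₀≡0 = head≡0 v p in λ where
        zero    → v₀≡0
        (suc i) → B.independent (v ∘ suc) (λ i → ≡.trans (≡.sym (ℤ.+-identityˡ _))
          (≡.trans (≡.cong (λ z → z ℤ.* b (suc i) ℤ.+ ℤ^-lc.lc (v ∘ suc) B.vectors i) (≡.sym v₀≡0))
            (≡.trans (≡.sym (lc-suc v i)) (p (suc i))))) i }
    where
    open IsSubmodule sub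
    Leading : ℕ → Set
    Leading n = ∃[ w ] R w × w zero ≡ + suc n

    leading : ∃[ n ] Leading n
    leading with mult zero
    ... | suc n , _ , p = n , _ , p , ℤ.*-identityʳ _

    minimal = least Leading (proj₁ leading) (proj₂ leading)
    m = proj₁ minimal
    b = proj₁ (proj₁ (proj₂ minimal))
    R-b = proj₁ (proj₂ (proj₁ (proj₂ minimal)))
    b₀ : b zero ≡ + suc m
    b₀ = proj₂ (proj₂ (proj₁ (proj₂ minimal)))

    B : Basis (λ v → R (ℤ.0ℤ ◂ v))
    B = basis (restrict sub) λ i → let n , nz , p = mult (suc i) in
      n , nz , resp (λ { zero → ℤ.*-zeroʳ (+ n) ; (suc j) → ≡.refl }) p
    module B = Basis B

    vectors : Fin (suc r) → Fin (suc r) → ℤ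
    vectors zero    = b
    vectors (suc j) = ℤ.0ℤ ◂ B.vectors j

    lc-zero′ : ∀ v → ℤ^-lc.lc v vectors zero ≡ v zero ℤ.* b zero
    lc-zero′ v = ≡.trans
      (≡.cong₂ ℤ._+_ (ℤ^·-lookup (v zero) b zero)
        (≡.trans (lc-homo (projʰ zero) (v ∘ suc) (λ j → ℤ.0ℤ ◂ B.vectors j)) (ℤ-lc.lc-ε (v ∘ suc) (λ _ → ≡.refl))))
      (ℤ.+-identityʳ _)

    lc-suc : ∀ v i → ℤ^-lc.lc v vectors (suc i) ≡ v zero ℤ.* b (suc i) ℤ.+ ℤ^-lc.lc (v ∘ suc) B.vectors i
    lc-suc v i = ≡.cong₂ ℤ._+_ (ℤ^·-lookup (v zero) b (suc i))
      (≡.trans (lc-homo (projʰ (suc i)) (v ∘ suc) (λ j → ℤ.0ℤ ◂ B.vectors j))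
               (≡.sym (lc-homo (projʰ i) (v ∘ suc) B.vectors)))

    head≡0 : ∀ v → (∀ i → ℤ^-lc.lc v vectors i ≡ ℤ.0ℤ) → v zero ≡ ℤ.0ℤ
    head≡0 v p with ℤ.i*j≡0⇒i≡0∨j≡0 (v zero) (≡.trans (≡.sym (lc-zero′ v)) (p zero))
    ... | inj₁ v₀≡0 = v₀≡0
    ... | inj₂ b≡0 = contradiction (≡.trans (≡.sym b₀) b≡0) λ ()

    complete : ∀ {w} → R w → ∃[ v ] (∀ i → ℤ^-lc.lc v vectors i ≡ w i)
    complete {w} Rw = v , λ { zero → at-zero ; (suc i) → at-suc i }
      where
      q = w zero /ℕ suc m
      rem = w zero %ℕ suc m
      w₀ : w zero ≡ + rem ℤ.+ q ℤ.* + suc m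
      w₀ = a≡a%ℕn+[a/ℕn]*n (w zero) (suc m)

      u : Fin (suc r) → ℤ
      u i = w i ℤ.+ (ℤ.- q) ℤ.* b i

      Ru : R u
      Ru = +-closed Rw (*-closed (ℤ.- q) R-b)

      arith : ∀ a q d → (a ℤ.+ q ℤ.* d) ℤ.+ (ℤ.- q) ℤ.* d ≡ a
      arith = solve-∀

      u₀ : u zero ≡ + rem
      u₀ = ≡.trans (≡.cong₂ (λ x y → x ℤ.+ (ℤ.- q) ℤ.* y) w₀ b₀) (arith (+ rem) q (+ suc m))

      -- A positive remainder would be the first coordinate of the member `u` of `R`, and smaller
      -- than the least one.
      rem≡0 : ∀ k → rem ≡ k → k ≡ 0
      rem≡0 zero _ = ≡.refl
      rem≡0 (suc k) eq = ⊥-elim (proj₂ (proj₂ minimal) k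
        (ℕ.s<s⁻¹ (subst (ℕ._< suc m) eq (n%ℕd<d (w zero) (suc m))))
        (u , Ru , ≡.trans u₀ (≡.cong +_ eq)))

      w₀′ : q ℤ.* b zero ≡ w zero
      w₀′ = ≡.sym (≡.trans w₀ (≡.trans
        (≡.cong₂ (λ x y → + x ℤ.+ q ℤ.* y) (rem≡0 rem ≡.refl) (≡.sym b₀)) (ℤ.+-identityˡ _)))

      rest = B.complete (resp (λ { zero → ≡.trans u₀ (≡.cong +_ (rem≡0 rem ≡.refl)) ; (suc i) → ≡.refl }) Ru)
      v = q ◂ proj₁ rest

      at-zero : ℤ^-lc.lc v vectors zero ≡ w zero
      at-zero = ≡.trans (lc-zero′ v) w₀′

      arith′ : ∀ x y → x ℤ.+ (y ℤ.+ (ℤ.- x)) ≡ y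
      arith′ = solve-∀

      at-suc : ∀ i → ℤ^-lc.lc v vectors (suc i) ≡ w (suc i)
      at-suc i = ≡.trans (lc-suc v i) (≡.trans (≡.cong (ℤ._+_ (q ℤ.* b (suc i)))
        (≡.trans (proj₂ rest i) (≡.cong (λ t → w (suc i) ℤ.+ t) (≡.sym (ℤ.neg-distribˡ-* q (b (suc i)))))))
        (arith′ (q ℤ.* b (suc i)) (w (suc i))))

-- Linear algebra modulo l

module _ {l : ℕ} (l-prime : Prime l) where

  inverse-mod : ∀ z → ¬ + l ∣ z → ∃[ c ] + l ∣ c ℤ.* z ℤ.- ℤ.1ℤ
  inverse-mod z l∤z = signed z bézout
    where
    coprime : ∀ {d} → d ℕ∣.∣ l → d ℕ∣.∣ ∣ z ∣ → d ≡ 1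
    coprime d∣l d∣z with prime⇒irreducible l-prime d∣l
    ... | inj₁ d≡1 = d≡1
    ... | inj₂ ≡.refl = ⊥-elim (l∤z (∣ᵤ⇒∣ d∣z))

    pos : ∀ a b c d → 1 ℕ.+ a ℕ.* b ≡ c ℕ.* d → ℤ.1ℤ ℤ.+ + a ℤ.* + b ≡ + c ℤ.* + d
    pos a b c d eq = ≡.trans (≡.cong (λ x → ℤ.1ℤ ℤ.+ x) (≡.sym (ℤ.pos-* a b)))
      (≡.trans (≡.cong +_ eq) (ℤ.pos-* c d))

    arith₁ : ∀ x l a y → ℤ.1ℤ ℤ.+ y ℤ.* a ≡ x ℤ.* l → (ℤ.- y) ℤ.* a ℤ.- ℤ.1ℤ ≡ (ℤ.- x) ℤ.* l
    arith₁ x l a y eq = ≡.trans (lhs a y) (≡.trans (≡.cong ℤ.-_ eq) (ℤ.neg-distribˡ-* x l))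
      where
      lhs : ∀ a y → (ℤ.- y) ℤ.* a ℤ.- ℤ.1ℤ ≡ ℤ.- (ℤ.1ℤ ℤ.+ y ℤ.* a)
      lhs = solve-∀

    arith₂ : ∀ x l a y → ℤ.1ℤ ℤ.+ x ℤ.* l ≡ y ℤ.* a → y ℤ.* a ℤ.- ℤ.1ℤ ≡ x ℤ.* l
    arith₂ x l a y eq = ≡.trans (≡.cong (λ t → t ℤ.- ℤ.1ℤ) (≡.sym eq)) (lhs (x ℤ.* l))
      where
      lhs : ∀ t → ℤ.1ℤ ℤ.+ t ℤ.- ℤ.1ℤ ≡ t
      lhs = solve-∀

    bézout : ∃[ c ] + l ∣ c ℤ.* + ∣ z ∣ ℤ.- ℤ.1ℤ
    bézout with coprime-Bézout {l} {∣ z ∣} (λ (d∣l , d∣z) → coprime d∣l d∣z)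
    ... | Bézout.+- x y eq = ℤ.- + y , divides (ℤ.- + x) (arith₁ (+ x) (+ l) (+ ∣ z ∣) (+ y) (pos y ∣ z ∣ x l eq))
    ... | Bézout.-+ x y eq = + y , divides (+ x) (arith₂ (+ x) (+ l) (+ ∣ z ∣) (+ y) (pos x l y ∣ z ∣ eq))

    neg*neg : ∀ c a → c ℤ.* a ≡ (ℤ.- c) ℤ.* (ℤ.- a)
    neg*neg = solve-∀

    signed : ∀ z → ∃[ c ] + l ∣ c ℤ.* + ∣ z ∣ ℤ.- ℤ.1ℤ → ∃[ c ] + l ∣ c ℤ.* z ℤ.- ℤ.1ℤ
    signed (+ n) p = p
    signed -[1+ n ] (c , p) = ℤ.- c , subst (λ t → + l ∣ t ℤ.- ℤ.1ℤ) (neg*neg c (+ suc n)) p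

  l∤1 : ¬ + l ∣ ℤ.1ℤ
  l∤1 l∣1 = ℕ.nonTrivial⇒≢1 {{prime⇒nonTrivial l-prime}} (ℕ∣.∣1⇒≡1 (∣⇒∣ᵤ l∣1))

  instance
    l-nonZero : NonZero l
    l-nonZero = prime⇒nonZero l-prime

  -- A form of the orthogonality of subspaces and their annihilators over 𝔽ₗ,
  -- uniform in an increasing family of submodules containing l ℤʳ.
  everything-or-annihilated : ExcludedMiddle 0ℓ → ∀ {r} (L : ℕ → (Fin r → ℤ) → Set) →
    (∀ b → IsSubmodule (L b)) →
    (∀ {b c w} → b ℕ.≤ c → L b w → L c w) →
    (∀ b {w} → (∀ i → + l ∣ w i) → L b w) →
    (∃[ b ] ∀ w → L b w) ⊎
    (∃[ u ] (∃[ w ] ¬ + l ∣ ⟦ u ⟧ w) × (∀ b {w} → L b w → + l ∣ ⟦_⟧ {ℤ^ Fin r} {ℤ⁺} u w))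
  everything-or-annihilated em {zero} L sub mono mult = inj₁ (0 , λ w → mult 0 λ ())
  everything-or-annihilated em {suc r} L sub mono mult
    with em {∃[ b ] ∃[ x ] L b x × ¬ + l ∣ x zero}
  -- If l divides every first coordinate that occurs, the first coordinate itself is the
  -- annihilating functional.
  ... | no none = inj₂ (projʰ zero , (δ zero , l∤1) , λ b {w} Lw → divisible b w Lw)
    where
    divisible : ∀ b w → L b w → + l ∣ w zero
    divisible b w Lw with em {+ l ∣ w zero}
    ... | yes l∣w = l∣w
    ... | no l∤w = ⊥-elim (none (b , w , Lw , l∤w))
  -- `x` is a pivot. It belongs to the family only from stage `b` on, so the induction runs over the
  -- stages `b ⊔ c`; as the family increases, this changes neither alternative.
  ... | yes (b , x , Lx , l∤x₀) = conclusion (everything-or-annihilated em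
      (λ c v → L (b ⊔ c) (ℤ.0ℤ ◂ v)) (λ c → restrict (sub (b ⊔ c)))
      (λ p → mono (ℕ.⊔-monoʳ-≤ b p))
      (λ c p → mult (b ⊔ c) λ { zero → divides ℤ.0ℤ ≡.refl ; (suc i) → p i }))
    where
    c = proj₁ (inverse-mod (x zero) l∤x₀)
    cx₀≡1 = proj₂ (inverse-mod (x zero) l∤x₀)

    y : Fin (suc r) → ℤ
    y i = c ℤ.* x i

    elim-homo : ∀ z z′ w w′ y → (z ℤ.+ z′) ℤ.+ (ℤ.- (w ℤ.+ w′)) ℤ.* y ≡
                                (z ℤ.+ (ℤ.- w) ℤ.* y) ℤ.+ (z′ ℤ.+ (ℤ.- w′) ℤ.* y)
    elim-homo = solve-∀

    eliminate : Hom (ℤ^ Fin (suc r)) (ℤ^ Fin r)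
    eliminate = mkHom (λ z i → z (suc i) ℤ.+ (ℤ.- z zero) ℤ.* y (suc i))
      (λ p i → ≡.cong₂ (λ s t → s ℤ.+ (ℤ.- t) ℤ.* y (suc i)) (p (suc i)) (p zero))
      (λ z z′ i → elim-homo (z (suc i)) (z′ (suc i)) (z zero) (z′ zero) (y (suc i)))

    module _ (d : ℕ) where
      open IsSubmodule (sub (b ⊔ d))

      Ly : ∀ t → L (b ⊔ d) (λ i → t ℤ.* y i)
      Ly t = *-closed t (*-closed c (mono (ℕ.m≤m⊔n b d) Lx))

      -- The first coordinate of the pivot `y` is congruent to 1 modulo l, not equal to 1. The
      -- multiple of l left over by the elimination is removed by a member of l ℤʳ.
      correction : ∀ t → L (b ⊔ d) ((t ℤ.* (c ℤ.* x zero ℤ.- ℤ.1ℤ)) ◂ λ _ → ℤ.0ℤ)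
      correction t = mult (b ⊔ d) λ { zero → ∣n⇒∣m*n t cx₀≡1 ; (suc i) → divides ℤ.0ℤ ≡.refl }

      arith₁ : ∀ z t → (z ℤ.+ (ℤ.- z) ℤ.* t) ℤ.+ z ℤ.* (t ℤ.- ℤ.1ℤ) ≡ ℤ.0ℤ
      arith₁ = solve-∀

      arith₂ : ∀ z t → (ℤ.0ℤ ℤ.+ z ℤ.* t) ℤ.+ (ℤ.- z) ℤ.* (t ℤ.- ℤ.1ℤ) ≡ z
      arith₂ = solve-∀

      arith₃ : ∀ w z t → ((w ℤ.+ (ℤ.- z) ℤ.* t) ℤ.+ z ℤ.* t) ℤ.+ ℤ.0ℤ ≡ w
      arith₃ = solve-∀

      to-rest : ∀ {z} → L (b ⊔ d) z → L (b ⊔ d) (ℤ.0ℤ ◂ ⟦ eliminate ⟧ z)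
      to-rest {z} Lz = resp (λ { zero → arith₁ (z zero) (y zero) ; (suc i) → ℤ.+-identityʳ _ })
        (+-closed (+-closed Lz (Ly (ℤ.- z zero))) (correction (z zero)))

      from-rest : ∀ {z} → L (b ⊔ d) (ℤ.0ℤ ◂ ⟦ eliminate ⟧ z) → L (b ⊔ d) z
      from-rest {z} p = resp (λ { zero → arith₂ (z zero) (y zero) ; (suc i) → arith₃ (z (suc i)) (z zero) (y (suc i)) })
        (+-closed (+-closed p (Ly (z zero))) (correction (ℤ.- z zero)))

    conclusion : _ → _
    conclusion (inj₁ (d , all)) = inj₁ (b ⊔ d , λ w → from-rest d (all (⟦ eliminate ⟧ w)))
    conclusion (inj₂ (u , (w , l∤uw) , ann)) = inj₂ (u ∘ʰ eliminate
      , (ℤ.0ℤ ◂ w , λ l∣ → l∤uw (subst (+ l ∣_) (cong u (λ i → ℤ.+-identityʳ (w i))) l∣))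
      , λ d {w} Lw → ann d (to-rest d {w} (mono (ℕ.m≤n⊔m b d) Lw)))

-- Presentations of A and of its extensions

open _∣_ using (quotient; equality)

asHom : ∀ {G H} → ContinuousHomomorphism G H → Hom (TG.abelianGroup G) (TG.abelianGroup H)
asHom f = record { func = func ; homo = GroupMorphisms.IsGroupHomomorphism.homo isGroupHomomorphism }
  where open ContinuousHomomorphism f

module FiniteGroup (A : AbelianGroup 0ℓ 0ℓ) {N : ℕ}
                   (enum : Inverse (≡.setoid (Fin N)) (AbelianGroup.setoid A)) where

  open AbelianGroup A
  open AbelianGroupProperties A
  open Sum commutativeMonoid
  open Mult commutativeMonoid using () renaming (_×_ to _×ⁿ_)
  open LinearCombination A
  open Inverse enum using (to; from; from-cong; strictlyInverseˡ; strictlyInverseʳ)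

  -- Translation by `a` permutes the elements, so it fixes the sum of all of them; it also adds `a`
  -- to that sum N times.
  order-annihilates : ∀ a → N ×ⁿ a ≈ ε
  order-annihilates a = ∙-cancelˡ (sum to) _ _ (begin
    sum to ∙ N ×ⁿ a              ≈⟨ ∙-congˡ (sum-replicate N) ⟨
    sum to ∙ sum {N} (λ _ → a)   ≈⟨ ∑-distrib-+ to (λ _ → a) ⟨
    sum (λ i → to i ∙ a)         ≈⟨ sum-cong-≋ (λ i → strictlyInverseˡ (to i ∙ a)) ⟨
    sum (λ i → to (shift a i))   ≈⟨ sum-permute to (permutation (shift a) (shift (a ⁻¹)) shift-inverseˡ shift-inverseʳ) ⟨
    sum to                       ≈⟨ identityʳ _ ⟨
    sum to ∙ ε                   ∎)
    where
    open SetoidReasoning setoid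

    shift : Carrier → Fin N → Fin N
    shift b i = from (to i ∙ b)

    cancel : ∀ {b c} → b ∙ c ≈ ε → ∀ i → shift c (shift b i) ≡ i
    cancel {b} {c} bc≈ε i = ≡.trans (from-cong (begin
      to (from (to i ∙ b)) ∙ c   ≈⟨ ∙-congʳ (strictlyInverseˡ _) ⟩
      (to i ∙ b) ∙ c             ≈⟨ assoc _ _ _ ⟩
      to i ∙ (b ∙ c)             ≈⟨ ∙-congˡ bc≈ε ⟩
      to i ∙ ε                   ≈⟨ identityʳ _ ⟩
      to i                       ∎)) (strictlyInverseʳ i)

    shift-inverseˡ = cancel (inverseˡ a)
    shift-inverseʳ = cancel (inverseʳ a)

  Relation : (Fin N → ℤ) → Set
  Relation w = lc w to ≈ ε

  relation-isSubmodule : IsSubmodule Relation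
  relation-isSubmodule = record
    { resp     = λ v≗w p → trans (sym (cong (lcʰ to) v≗w)) p
    ; +-closed = λ {v} {w} p q → trans (homo (lcʰ to) v w) (trans (∙-cong p q) (identityˡ ε))
    ; *-closed = λ z {v} p → trans (lc-* A z v to) (trans (·-congˡ z p) (·-ε z)) }

  relation-multiple : NonZero N → ∀ i → ∃[ n ] NonZero n × Relation (λ j → + n ℤ.* δ i j)
  relation-multiple nz i = N , nz ,
    trans (lc-* A (+ N) (δ i) to) (trans (·-congˡ (+ N) (lc-δ i to)) (order-annihilates (to i)))

-- The product P of the groups ℤ/lᵏ

module _ (l : ℕ) where

  P : TopologicalAbelianGroup
  P = ∏ (λ (k : ℕ) → discrete (ℤ/ (l ^ k)))

  ∏ℤ/ : AbelianGroup 0ℓ 0ℓ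
  ∏ℤ/ = TG.abelianGroup P

  -- Both groups consist of integer sequences and differ in their equality only. The map carries
  -- identities computed in ℤ over to P.
  reductionʰ : Hom (ℤ^ ℕ) ∏ℤ/
  reductionʰ = mkHom (λ x → x) (λ x≗y k → AbelianGroup.reflexive (ℤ/ (l ^ k)) (x≗y k))
    (λ x y → AbelianGroup.refl ∏ℤ/ {λ k → x k ℤ.+ y k})

  module ∏-lc = LinearCombination ∏ℤ/

  ∏·-lookup : ∀ z x → AbelianGroup._≈_ ∏ℤ/ (z ∏-lc.· x) (λ k → z ℤ.* x k)
  ∏·-lookup z x = trans {z ∏-lc.· x} {z ℤ^-lc.· x} {λ k → z ℤ.* x k}
    (sym {z ℤ^-lc.· x} {z ∏-lc.· x} (·-homo reductionʰ z x))
    (cong reductionʰ {z ℤ^-lc.· x} {λ k → z ℤ.* x k} (ℤ^·-lookup z x))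
    where open AbelianGroup ∏ℤ/

-- Divisibility by powers of l, and linear forms with prescribed support

^-mono-∣ : ∀ l {k n} → k ≤ n → + (l ^ k) ∣ + (l ^ n)
^-mono-∣ l {k} {n} k≤n = ∣ᵤ⇒∣ (subst (λ m → l ^ k ℕ∣.∣ l ^ m) (ℕ.m+[n∸m]≡n k≤n)
  (subst (λ m → l ^ k ℕ∣.∣ m) (≡.sym (ℕ.^-distribˡ-+-* l k (n ℕ.∸ k))) (ℕ∣.m∣m*n _)))

-- `s` is the quotient of `T` by l from place n on, and 0 before. Then T - l s vanishes from n on,
-- while in the places k < n the group ℤ/lᵏ is killed by lⁿ.
divide-tail : ∀ l n (T : ℕ → ℤ) → (∀ k → n ≤ k → + l ∣ T k) →
  ∃[ s ] ∀ k → + (l ^ k) ∣ + (l ^ n) ℤ.* (T k ℤ.- + l ℤ.* s k) ℤ.- ℤ.0ℤ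
divide-tail l n T l∣T = (λ k → proj₁ (divide k)) , (λ k → proj₂ (divide k))
  where
  cancel : ∀ L q l → L ℤ.* (q ℤ.* l ℤ.- l ℤ.* q) ℤ.- ℤ.0ℤ ≡ ℤ.0ℤ
  cancel = solve-∀

  divide : ∀ k → ∃[ s ] + (l ^ k) ∣ + (l ^ n) ℤ.* (T k ℤ.- + l ℤ.* s) ℤ.- ℤ.0ℤ
  divide k with n ℕ.≤? k
  ... | yes n≤k = quotient (l∣T k n≤k) , divides ℤ.0ℤ (≡.trans
    (≡.cong (λ z → + (l ^ n) ℤ.* (z ℤ.- + l ℤ.* quotient (l∣T k n≤k)) ℤ.- ℤ.0ℤ) (equality (l∣T k n≤k)))
    (cancel (+ (l ^ n)) (quotient (l∣T k n≤k)) (+ l)))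
  ... | no n≰k = ℤ.0ℤ , subst (+ (l ^ k) ∣_) (≡.sym (ℤ.+-identityʳ _))
    (∣m⇒∣m*n _ (^-mono-∣ l (ℕ.<⇒≤ (ℕ.≰⇒> n≰k))))

-- A linear form supported on `Q`. The support is expressed by divisibility for all moduli, which is
-- how it is used: the form is well defined modulo lᵏ on P when it reads only places i ≥ k, and
-- continuous when these places are bounded.
record Combination (Q : ℕ → Set) : Set where
  field
    hom        : Hom (ℤ^ ℕ) ℤ⁺
    reads-only : ∀ m t → (∀ i → Q i → m ∣ t i) → m ∣ ⟦ hom ⟧ t

open Combination

module _ {Q : ℕ → Set} where

  0ᶜ : Combination Q
  0ᶜ = record { hom = 0ʰ ; reads-only = λ _ _ _ → divides ℤ.0ℤ ≡.refl }

  coordinate : ∀ i → Q i → Combination Q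
  coordinate i q = record { hom = projʰ i ; reads-only = λ _ _ p → p i q }

  _+ᶜ_ : Combination Q → Combination Q → Combination Q
  κ +ᶜ κ′ = record { hom = hom κ +ʰ hom κ′
                   ; reads-only = λ m t p → ∣m∣n⇒∣m+n (reads-only κ m t p) (reads-only κ′ m t p) }

  _*ᶜ_ : ℤ → Combination Q → Combination Q
  z *ᶜ κ = record { hom = *ʰ z ∘ʰ hom κ ; reads-only = λ m t p → ∣n⇒∣m*n z (reads-only κ m t p) }

weaken : ∀ {Q Q′} → (∀ {i} → Q i → Q′ i) → Combination Q → Combination Q′
weaken Q⊆Q′ κ = record { hom = hom κ ; reads-only = λ m t p → reads-only κ m t (λ i q → p i (Q⊆Q′ q)) }

module _ (l : ℕ) {r : ℕ} (M : Fin r → Fin r → ℤ) where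

  Interval : ℕ → ℕ → ℕ → Set
  Interval N b i = N ≤ i × i < b

  -- As j varies, the numbers `⟦ h ⟧ (M j)` form an integral combination of the columns of M, with
  -- coefficients h(δᵢ). It stands on the side of `w` because it becomes the coboundary of a
  -- transport.
  SpannedMod : ℕ → (Fin r → ℕ → ℤ) → (ℕ → Set) → (Fin r → ℤ) → Set
  SpannedMod K t Q w = Σ[ κ ∈ Combination Q ] Σ[ h ∈ Hom (ℤ^ Fin r) ℤ⁺ ]
    (∀ j → + (l ^ K) ∣ (w j ℤ.+ ⟦ h ⟧ (M j)) ℤ.- ⟦ hom κ ⟧ (t j))

  -- The end `b` of the window is independent of `K` and `w`, so that ℕ can be cut into blocks
  -- before it is known which differences have to be corrected.
  TailsSpan : (Fin r → ℕ → ℤ) → Set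
  TailsSpan t = ∀ N → ∃[ b ] ∀ K w → SpannedMod K t (Interval N b) w

  module _ {t : Fin r → ℕ → ℤ} {Q : ℕ → Set} where

    spanned-isSubmodule : ∀ K → IsSubmodule (SpannedMod K t Q)
    spanned-isSubmodule K = record
      { resp     = λ v≗w (κ , h , p) → κ , h , λ j →
          subst (λ x → + (l ^ K) ∣ (x ℤ.+ ⟦ h ⟧ (M j)) ℤ.- ⟦ hom κ ⟧ (t j)) (v≗w j) (p j)
      ; +-closed = λ {v} {w} (κ , h , p) (κ′ , h′ , p′) → κ +ᶜ κ′ , h +ʰ h′ , λ j →
          subst (+ (l ^ K) ∣_)
            (add (v j) (⟦ h ⟧ (M j)) (⟦ hom κ ⟧ (t j)) (w j) (⟦ h′ ⟧ (M j)) (⟦ hom κ′ ⟧ (t j)))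
            (∣m∣n⇒∣m+n (p j) (p′ j))
      ; *-closed = λ z {v} (κ , h , p) → z *ᶜ κ , *ʰ z ∘ʰ h , λ j →
          subst (+ (l ^ K) ∣_) (scale z (v j) (⟦ h ⟧ (M j)) (⟦ hom κ ⟧ (t j))) (∣n⇒∣m*n z (p j)) }
      where
      add : ∀ a b c a′ b′ c′ → (a ℤ.+ b ℤ.- c) ℤ.+ (a′ ℤ.+ b′ ℤ.- c′) ≡
                               (a ℤ.+ a′) ℤ.+ (b ℤ.+ b′) ℤ.- (c ℤ.+ c′)
      add = solve-∀
      scale : ∀ z a b c → z ℤ.* (a ℤ.+ b ℤ.- c) ≡ z ℤ.* a ℤ.+ z ℤ.* b ℤ.- z ℤ.* c
      scale = solve-∀

    spanned-multiple : ∀ K {w} → (∀ i → + (l ^ K) ∣ w i) → SpannedMod K t Q w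
    spanned-multiple K {w} p = 0ᶜ , 0ʰ , λ j → subst (+ (l ^ K) ∣_) (zeros (w j)) (p j)
      where
      zeros : ∀ a → a ≡ (a ℤ.+ ℤ.0ℤ) ℤ.- ℤ.0ℤ
      zeros = solve-∀

    -- Induction on K: the error of a representation modulo lᴷ is lᴷ times a vector, and
    -- representing this vector modulo l gives the next step. All combinations read the same `Q`.
    nakayama : (∀ w → SpannedMod 1 t Q w) → ∀ K w → SpannedMod K t Q w
    nakayama all zero w = spanned-multiple 0 {w} λ i → divides (w i) (≡.sym (ℤ.*-identityʳ _))
    nakayama all (suc K) w with nakayama all K w
    ... | κ , h , p with all (λ j → quotient (p j))
    ... | κ′ , h′ , p′ = (κ +ᶜ ((+ (l ^ K)) *ᶜ κ′)) , h +ʰ (*ʰ (+ (l ^ K)) ∘ʰ h′) , λ j →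
      divides (quotient (p′ j)) (equation (w j) (⟦ h ⟧ (M j)) (⟦ hom κ ⟧ (t j)) (quotient (p j))
        (⟦ h′ ⟧ (M j)) (⟦ hom κ′ ⟧ (t j)) (quotient (p′ j)) (equality (p j)) (equality (p′ j)))
      where
      L = + (l ^ K)
      expand : ∀ w h κ h′ κ′ L → (w ℤ.+ (h ℤ.+ L ℤ.* h′)) ℤ.- (κ ℤ.+ L ℤ.* κ′) ≡
                                 (w ℤ.+ h ℤ.- κ) ℤ.+ (h′ ℤ.- κ′) ℤ.* L
      expand = solve-∀
      regroup : ∀ q h′ κ′ L → q ℤ.* L ℤ.+ (h′ ℤ.- κ′) ℤ.* L ≡ (q ℤ.+ h′ ℤ.- κ′) ℤ.* L
      regroup = solve-∀
      equation : ∀ w h κ q h′ κ′ q′ → w ℤ.+ h ℤ.- κ ≡ q ℤ.* L → q ℤ.+ h′ ℤ.- κ′ ≡ q′ ℤ.* + (l ^ 1) →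
                (w ℤ.+ (h ℤ.+ L ℤ.* h′)) ℤ.- (κ ℤ.+ L ℤ.* κ′) ≡ q′ ℤ.* + (l ^ suc K)
      equation w h κ q h′ κ′ q′ e e′ = begin
        (w ℤ.+ (h ℤ.+ L ℤ.* h′)) ℤ.- (κ ℤ.+ L ℤ.* κ′)   ≡⟨ expand w h κ h′ κ′ L ⟩
        (w ℤ.+ h ℤ.- κ) ℤ.+ (h′ ℤ.- κ′) ℤ.* L           ≡⟨ ≡.cong (λ x → x ℤ.+ (h′ ℤ.- κ′) ℤ.* L) e ⟩
        q ℤ.* L ℤ.+ (h′ ℤ.- κ′) ℤ.* L                   ≡⟨ regroup q h′ κ′ L ⟩
        (q ℤ.+ h′ ℤ.- κ′) ℤ.* L                         ≡⟨ ≡.cong (λ x → x ℤ.* L) e′ ⟩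
        q′ ℤ.* + (l ^ 1) ℤ.* L                          ≡⟨ ℤ.*-assoc q′ (+ (l ^ 1)) L ⟩
        q′ ℤ.* (+ (l ^ 1) ℤ.* L)                        ≡⟨ ≡.cong (ℤ._*_ q′) (ℤ.pos-* (l ^ 1) (l ^ K)) ⟨
        q′ ℤ.* + (l ^ 1 ℕ.* l ^ K)                      ≡⟨ ≡.cong (λ x → q′ ℤ.* + (x ℕ.* l ^ K)) (ℕ.*-identityʳ l) ⟩
        q′ ℤ.* + (l ^ suc K)                            ∎
        where open ≡.≡-Reasoning

lc-comm : ∀ {r} (v w : Fin r → ℤ) → ℤ-lc.lc v w ≡ ℤ-lc.lc w v
lc-comm {zero} v w = ≡.refl
lc-comm {suc r} v w = ≡.cong₂ ℤ._+_
  (≡.trans (·≡* (v zero) (w zero)) (≡.trans (ℤ.*-comm (v zero) (w zero)) (≡.sym (·≡* (w zero) (v zero)))))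
  (lc-comm (v ∘ suc) (w ∘ suc))

hom-as-lc : ∀ {r} (u : Hom (ℤ^ Fin r) ℤ⁺) w → ⟦ u ⟧ w ≡ ℤ-lc.lc (λ j → ⟦ u ⟧ (δ j)) w
hom-as-lc u w = ≡.trans (cong u (λ i → ≡.sym (lc-δʳ w i))) (≡.trans (lc-homo u w δ) (lc-comm w (λ j → ⟦ u ⟧ (δ j))))

-- The family t attached to an extension

module ExtensionData {l : ℕ} (l-prime : Prime l) (A : AbelianGroup 0ℓ 0ℓ) {N : ℕ}
    (enum : Inverse (≡.setoid (Fin N)) (AbelianGroup.setoid A))
    (B : Basis (FiniteGroup.Relation A enum))
    (D : TopologicalAbelianGroup) (E : ExtensionByTorsionClosure (P l) (discrete A) D) where

  private
    module A = AbelianGroup A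
    module D = TG D
    module DP = AbelianGroupProperties D.abelianGroup
    module A-lc = LinearCombination A
    module D-lc = LinearCombination D.abelianGroup
    module B = Basis B
    module ∏ = AbelianGroup (∏ℤ/ l)
    M = B.vectors
    x = Inverse.to enum
    open ExtensionByTorsionClosure E
    module E = IsShortExact isShortExact

  ιʰ : Hom (∏ℤ/ l) D.abelianGroup
  ιʰ = asHom ι

  πʰ : Hom D.abelianGroup A
  πʰ = asHom π

  ι-injective : ∀ {y} → ⟦ ιʰ ⟧ y D.≈ D.ε → y ∏.≈ ∏.ε
  ι-injective {y} p = E.injective {y} {∏.ε} (D.trans p (D.sym (ε-homo ιʰ)))

  πι : ∀ y → ⟦ πʰ ⟧ (⟦ ιʰ ⟧ y) A.≈ A.ε
  πι y = proj₁ E.exact (y , D.refl)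

  kernel⇒image : ∀ {d} → ⟦ πʰ ⟧ d A.≈ A.ε → ∃[ y ] ⟦ ιʰ ⟧ y D.≈ d
  kernel⇒image = proj₂ E.exact

  x̂ : Fin N → D.Carrier
  x̂ i = proj₁ (E.surjective (x i))

  π-x̂ : ∀ i → ⟦ πʰ ⟧ (x̂ i) A.≈ x i
  π-x̂ i = proj₂ (E.surjective (x i)) D.refl

  ev : Hom (ℤ^ Fin N) D.abelianGroup
  ev = D-lc.lcʰ x̂

  π-ev : ∀ w → ⟦ πʰ ⟧ (⟦ ev ⟧ w) A.≈ A-lc.lc w x
  π-ev w = A.trans (lc-homo πʰ w x̂) (A-lc.lc-congʳ w π-x̂)

  private
    relation : ∀ j → ∃[ y ] ⟦ ιʰ ⟧ y D.≈ ⟦ ev ⟧ (M j)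
    relation j = kernel⇒image (A.trans (π-ev (M j)) (B.member j))

  t : Fin N → ℕ → ℤ
  t j = proj₁ (relation j)

  ι-t : ∀ j → ⟦ ιʰ ⟧ (t j) D.≈ ⟦ ev ⟧ (M j)
  ι-t j = proj₂ (relation j)

  ι-lc : ∀ v → ⟦ ιʰ ⟧ (∏-lc.lc l v t) D.≈ ⟦ ev ⟧ (ℤ^-lc.lc v M)
  ι-lc v = D.trans (lc-homo ιʰ v t)
    (D.trans (D-lc.lc-congʳ v ι-t) (D.sym (lc-homo ev v M)))

  -- Every neighbourhood of a torsion element meets the torsion subgroup in that element itself, so
  -- the element lies in the closure and hence in the image of P.
  torsion⇒kernel : ∀ {d} → torsion D d → ⟦ πʰ ⟧ d A.≈ A.ε
  torsion⇒kernel {d} tor with proj₁ torsion-closure {d} (λ _ d∈V → d , d∈V , tor)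
  ... | y , ιy≈d = A.trans (cong πʰ (D.sym ιy≈d)) (πι y)

  -- A vector u ≢ 0 mod l annihilating the tail of t and the columns of M would give, by
  -- Σ uⱼ Mⱼ = l q, an element ev q of D that is torsion modulo P, although q ∉ R.
  tails-span : ExcludedMiddle 0ℓ → TailsSpan l M t
  tails-span em n with everything-or-annihilated l-prime em (λ b → SpannedMod l M 1 t (Interval l M n b))
      (λ b → spanned-isSubmodule l M 1)
      (λ b≤c (κ , h , p) → weaken (λ (n≤i , i<b) → n≤i , ℕ.<-≤-trans i<b b≤c) κ , h , p)
      (λ b p → spanned-multiple l M 1 (λ i → subst (λ z → + z ∣ _) (≡.sym (ℕ.*-identityʳ l)) (p i)))
  ... | inj₁ (b , all) = b , nakayama l M all
  ... | inj₂ (u , (w , l∤uw) , annihilates) = ⊥-elim (l∤uw l∣uw)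
    where
    û : Fin N → ℤ
    û j = ⟦ u ⟧ (δ j)

    -- The i-th column of M is spanned by the zero combination, with h minus the i-th coordinate.
    l∣uM : ∀ i → + l ∣ ℤ^-lc.lc û M i
    l∣uM i = subst (+ l ∣_) (≡.trans (hom-as-lc u (λ j → M j i)) (≡.sym (lc-homo (projʰ i) û M)))
      (annihilates 0 (0ᶜ , -ʰ projʰ i , λ j → divides ℤ.0ℤ (cancel (M j i))))
      where
      cancel : ∀ a → (a ℤ.+ ℤ.- a) ℤ.- ℤ.0ℤ ≡ ℤ.0ℤ
      cancel = solve-∀

    T : ℕ → ℤ
    T = ℤ^-lc.lc û t

    -- The window from n to `suc k` just contains k, so the vector of the k-th coordinates of the
    -- `t j` is spanned there.
    l∣T : ∀ k → n ≤ k → + l ∣ T k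
    l∣T k n≤k = subst (+ l ∣_) (≡.trans (hom-as-lc u (λ j → t j k)) (≡.sym (lc-homo (projʰ k) û t)))
      (annihilates (suc k) (coordinate k (n≤k , ℕ.≤-refl) , 0ʰ , λ j → divides ℤ.0ℤ (cancel (t j k))))
      where
      cancel : ∀ a → (a ℤ.+ ℤ.0ℤ) ℤ.- a ≡ ℤ.0ℤ
      cancel = solve-∀

    q : Fin N → ℤ
    q i = quotient (l∣uM i)

    uM≡lq : ∀ i → ℤ^-lc.lc û M i ≡ + l ℤ.* q i
    uM≡lq i = ≡.trans (equality (l∣uM i)) (ℤ.*-comm (q i) (+ l))

    s = proj₁ (divide-tail l n T l∣T)

    -- l · ev q = ev (Σ ûⱼ Mⱼ) = ι T, so l · d = ι (T - l s), which lⁿ kills.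
    d : D.Carrier
    d = ⟦ ev ⟧ q D.- ⟦ ιʰ ⟧ s

    killed = proj₂ (divide-tail l n T l∣T)

    l·d : (+ l) D-lc.· d D.≈ ⟦ ιʰ ⟧ (λ k → T k ℤ.- + l ℤ.* s k)
    l·d = begin
      (+ l) D-lc.· d                                      ≈⟨ D-lc.·-distribˡ (+ l) _ _ ⟩
      (+ l) D-lc.· ⟦ ev ⟧ q D.∙ (+ l) D-lc.· (⟦ ιʰ ⟧ s D.⁻¹)   ≈⟨ D.∙-cong first second ⟩
      ⟦ ιʰ ⟧ T D.∙ ⟦ ιʰ ⟧ (λ k → ℤ.- (+ l ℤ.* s k))       ≈⟨ homo ιʰ T _ ⟨
      ⟦ ιʰ ⟧ (λ k → T k ℤ.- + l ℤ.* s k)                  ∎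
      where
      open SetoidReasoning D.setoid
      first : (+ l) D-lc.· ⟦ ev ⟧ q D.≈ ⟦ ιʰ ⟧ T
      first = begin
        (+ l) D-lc.· ⟦ ev ⟧ q        ≈⟨ lc-* D.abelianGroup (+ l) q x̂ ⟨
        ⟦ ev ⟧ (λ i → + l ℤ.* q i)   ≈⟨ cong ev uM≡lq ⟨
        ⟦ ev ⟧ (ℤ^-lc.lc û M)        ≈⟨ ι-lc û ⟨
        ⟦ ιʰ ⟧ (∏-lc.lc l û t)       ≈⟨ cong ιʰ (lc-homo (reductionʰ l) û t) ⟨
        ⟦ ιʰ ⟧ T                     ∎
      second : (+ l) D-lc.· (⟦ ιʰ ⟧ s D.⁻¹) D.≈ ⟦ ιʰ ⟧ (λ k → ℤ.- (+ l ℤ.* s k))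
      second = begin
        (+ l) D-lc.· (⟦ ιʰ ⟧ s D.⁻¹)                   ≈⟨ D-lc.·-congˡ (+ l) (Hom.⁻¹-homo ιʰ s) ⟨
        (+ l) D-lc.· ⟦ ιʰ ⟧ (λ k → ℤ.- s k)            ≈⟨ ·-homo ιʰ (+ l) _ ⟨
        ⟦ ιʰ ⟧ (∏-lc._·_ l (+ l) (λ k → ℤ.- s k))      ≈⟨ cong ιʰ (∏·-lookup l (+ l) (λ k → ℤ.- s k)) ⟩
        ⟦ ιʰ ⟧ (λ k → + l ℤ.* ℤ.- s k)                 ≈⟨ cong ιʰ (cong (reductionʰ l) (λ k → ℤ.neg-distribʳ-* (+ l) (s k))) ⟨
        ⟦ ιʰ ⟧ (λ k → ℤ.- (+ l ℤ.* s k))               ∎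

    open Mult D.commutativeMonoid using (×-assocˡ)

    torsion-d : torsion D d
    torsion-d = l ^ n ℕ.* l , ℕ.m*n≢0 (l ^ n) l {{ℕ.m^n≢0 l n {{l-nonZero l-prime}}}} {{l-nonZero l-prime}} ,
      (begin
        _                                             ≈⟨ ×-assocˡ d (l ^ n) l ⟨
        (+ (l ^ n)) D-lc.· (+ l) D-lc.· d             ≈⟨ D-lc.·-congˡ (+ (l ^ n)) l·d ⟩
        (+ (l ^ n)) D-lc.· ⟦ ιʰ ⟧ y                   ≈⟨ ·-homo ιʰ (+ (l ^ n)) y ⟨
        ⟦ ιʰ ⟧ (∏-lc._·_ l (+ (l ^ n)) y)             ≈⟨ cong ιʰ l^n·y≈ε ⟩
        ⟦ ιʰ ⟧ ∏.ε                                    ≈⟨ ε-homo ιʰ ⟩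
        D.ε                                           ∎)
      where
      open SetoidReasoning D.setoid
      y : ℕ → ℤ
      y k = T k ℤ.- + l ℤ.* s k
      l^n·y≈ε : ∏-lc._·_ l (+ (l ^ n)) y ∏.≈ ∏.ε
      l^n·y≈ε = ∏.trans {∏-lc._·_ l (+ (l ^ n)) y} {λ k → + (l ^ n) ℤ.* y k} {∏.ε}
        (∏·-lookup l (+ (l ^ n)) y) killed

    q∈R : A-lc.lc q x A.≈ A.ε
    q∈R = begin
      A-lc.lc q x                                     ≈⟨ π-ev q ⟨
      ⟦ πʰ ⟧ (⟦ ev ⟧ q)                               ≈⟨ cong πʰ (DP.//-rightDividesˡ (⟦ ιʰ ⟧ s) (⟦ ev ⟧ q)) ⟨
      ⟦ πʰ ⟧ (d D.∙ ⟦ ιʰ ⟧ s)                         ≈⟨ homo πʰ _ _ ⟩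
      ⟦ πʰ ⟧ d A.∙ ⟦ πʰ ⟧ (⟦ ιʰ ⟧ s)                  ≈⟨ A.∙-cong (torsion⇒kernel torsion-d) (πι s) ⟩
      A.ε A.∙ A.ε                                     ≈⟨ A.identityˡ A.ε ⟩
      A.ε                                             ∎
      where open SetoidReasoning A.setoid

    v = proj₁ (B.complete q∈R)

    -- Now that q is itself a relation, û and l v are both the coefficients of l q. Hence u vanishes
    -- modulo l, contrary to its choice.
    û≡lv : ∀ j → û j ≡ + l ℤ.* v j
    û≡lv = B.unique λ i → ≡.trans (uM≡lq i) (≡.trans
      (≡.cong (ℤ._*_ (+ l)) (≡.sym (proj₂ (B.complete q∈R) i)))
      (≡.sym (≡.trans (lc-* (ℤ^ Fin N) (+ l) v M i) (ℤ^·-lookup (+ l) (ℤ^-lc.lc v M) i))))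

    l∣uw : + l ∣ ⟦ u ⟧ w
    l∣uw = divides (ℤ-lc.lc v w) (≡.trans (hom-as-lc u w) (≡.trans
      (≡.trans (ℤ-lc.lc-cong {y = w} û≡lv (λ _ → ≡.refl)) (lc-* ℤ⁺ (+ l) v w))
      (≡.trans (·≡* (+ l) (ℤ-lc.lc v w)) (ℤ.*-comm (+ l) _))))

-- Topology of P and of pro-l groups

open Topology

module _ (G : TopologicalAbelianGroup) where
  open TG G

  -- The union of copies of the whole space indexed by the proofs of `Q`. Such sets arise as
  -- preimages under the constant component of x ↦ (a , x).
  constant-open : ∀ (Q : Set) → Open topology (λ _ → Q)
  constant-open Q = Open-resp-≐ topology ((λ (q , _) → q) , (λ q → q , _))
    (Open-⋃ topology {I = Q} (λ _ _ → _) (λ _ → Open-U topology))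

  translate-open : ∀ a {V} → Open topology V → Open topology (λ x → V (a ∙ x))
  translate-open a oV = continuous-into-initial _ _ topology
    (record { to = λ x → a , x ; cong = λ p → refl , p })
    (λ { true {V} _ → constant-open (V a) ; false oV → oV })
    (∙-continuous oV)

module _ (G H : TopologicalAbelianGroup) (f : Hom (TG.abelianGroup G) (TG.abelianGroup H)) where
  private
    module G = TG G
    module H = TG H

  -- The preimage of V is the union of the translates d · W. The neighbourhoods are taken at ε
  -- because the map to be treated is explicit near ε.
  locally-continuous⇒continuous :
    (∀ d {V} → Open H.topology V → V (⟦ f ⟧ d) →
      Σ[ W ∈ Pred G.Carrier 0ℓ ] Open G.topology W × W G.ε × (∀ {x} → W x → V (⟦ f ⟧ (d G.∙ x)))) →
    Continuous G.topology H.topology (Hom.func f)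
  locally-continuous⇒continuous local {V} oV = Open-resp-≐ G.topology (union⊆ , ⊆union)
    (Open-⋃ G.topology {I = ∃[ d ] V (⟦ f ⟧ d)} translated
      (λ (d , Vd) → translate-open G (d G.⁻¹) (proj₁ (proj₂ (local d oV Vd)))))
    where
    translated : ∃[ d ] V (⟦ f ⟧ d) → Pred G.Carrier 0ℓ
    translated (d , Vd) x = proj₁ (local d oV Vd) (d G.⁻¹ G.∙ x)

    cancel : ∀ d x → d G.∙ (d G.⁻¹ G.∙ x) G.≈ x
    cancel d x = G.trans (G.sym (G.assoc _ _ _)) (G.trans (G.∙-congʳ (G.inverseʳ d)) (G.identityˡ x))

    union⊆ : ∀ {x} → ∃[ p ] translated p x → V (⟦ f ⟧ x)
    union⊆ {x} ((d , Vd) , Wx) =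
      Open-resp-≈ H.topology oV (cong f (cancel d x)) (proj₂ (proj₂ (proj₂ (local d oV Vd))) Wx)

    ⊆union : ∀ {x} → V (⟦ f ⟧ x) → ∃[ p ] translated p x
    ⊆union {x} Vx = (x , Vx) , Open-resp-≈ G.topology (proj₁ (proj₂ (local x oV Vx)))
      (G.sym (G.inverseˡ x)) (proj₁ (proj₂ (proj₂ (local x oV Vx))))

  continuousHomomorphism : Continuous G.topology H.topology (Hom.func f) → ContinuousHomomorphism G H
  continuousHomomorphism c = record
    { func = Hom.func f ; isGroupHomomorphism = Hom.isGroupHomomorphism f ; continuous = c }

-- The topology of P in coordinates

module Cylinder (l : ℕ) where

  private
    module ℤ/l^ k = AbelianGroup (ℤ/ (l ^ k))
    module ∏ = TG (P l)

  AgreeBelow : ℕ → (ℕ → ℤ) → (ℕ → ℤ) → Set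
  AgreeBelow n s t = ∀ k → k < n → ℤ/l^._≈_ k (s k) (t k)

  agree-sym : ∀ {n} s t → AgreeBelow n s t → AgreeBelow n t s
  agree-sym s t p k k<n = ℤ/l^.sym k {s k} {t k} (p k k<n)

  agree-trans : ∀ {n} s t u → AgreeBelow n s t → AgreeBelow n t u → AgreeBelow n s u
  agree-trans s t u p q k k<n = ℤ/l^.trans k {s k} {t k} {u k} (p k k<n) (q k k<n)

  open⇒cylinder : ∀ {V s} → Open ∏.topology V → V s → ∃[ n ] ∀ t → AgreeBelow n t s → V t
  open⇒cylinder {s = s} (preimage k (lift r)) Vs =
    suc k , λ t p → r (ℤ/l^.sym k {t k} {s k} (p k ℕ.≤-refl)) Vs
  open⇒cylinder (resp-≐ (V⊆W , W⊆V) o) Vs =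
    let n , p = open⇒cylinder o (W⊆V Vs) in n , λ t q → V⊆W (p t q)
  open⇒cylinder whole _ = 0 , _
  open⇒cylinder (o ∩ₒ o′) (Vs , Ws) =
    let n , p = open⇒cylinder o Vs ; n′ , p′ = open⇒cylinder o′ Ws in n ⊔ n′ , λ t q →
      p t (λ k k<n → q k (ℕ.<-≤-trans k<n (ℕ.m≤m⊔n n n′))) ,
      p′ t (λ k k<n → q k (ℕ.<-≤-trans k<n (ℕ.m≤n⊔m n n′)))
  open⇒cylinder (⋃ₒ V o) (j , Vs) = let n , p = open⇒cylinder (o j) Vs in n , λ t q → j , p t q

  cylinder-open : ∀ n s → Open ∏.topology (λ t → AgreeBelow n t s)
  cylinder-open zero s = resp-≐ ((λ _ k ()) , _) whole
  cylinder-open (suc n) s = resp-≐ ((λ {t} → to {t}) , (λ {t} → from {t}))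
    (cylinder-open n s ∩ₒ preimage n {λ x → ℤ/l^._≈_ n x (s n)}
      (lift λ {x} {y} x≈y x≈s → ℤ/l^.trans n {y} {x} {s n} (ℤ/l^.sym n {x} {y} x≈y) x≈s))
    where
    to : ∀ {t} → AgreeBelow n t s × ℤ/l^._≈_ n (t n) (s n) → AgreeBelow (suc n) t s
    to (p , q) k k<1+n with ℕ.m<1+n⇒m<n∨m≡n k<1+n
    ... | inj₁ k<n = p k k<n
    ... | inj₂ ≡.refl = q
    from : ∀ {t} → AgreeBelow (suc n) t s → AgreeBelow n t s × ℤ/l^._≈_ n (t n) (s n)
    from p = (λ k k<n → p k (ℕ.m<n⇒m<1+n k<n)) , p n ℕ.≤-refl

  cylindrical-open : ∀ n {V : Pred ∏.Carrier 0ℓ} → (∀ {s t} → AgreeBelow n t s → V s → V t) →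
                     Open ∏.topology V
  cylindrical-open n {V} r = resp-≐ ((λ ((s , Vs) , p) → r p Vs) , (λ {s} Vs → (s , Vs) , λ k _ → ℤ/l^.refl k {s k}))
    (⋃ₒ {J = ∃[ s ] V s} (λ (s , _) t → AgreeBelow n t s) (λ (s , _) → cylinder-open n s))

  -- Serves to choose the value at place `m` where the later places are ignored, and with `c` = 0 as
  -- truncation.
  override : ℕ → (ℕ → ℤ) → ℤ → ℕ → ℤ
  override m s c k with k ℕ.<? m
  ... | yes _ = s k
  ... | no _  = c

  override-below : ∀ {m} s c {k} → k < m → override m s c k ≡ s k
  override-below {m} s c {k} k<m with k ℕ.<? m
  ... | yes _ = ≡.refl
  ... | no k≮m = ⊥-elim (k≮m k<m)

  override-above : ∀ {m} s c {k} → m ≤ k → override m s c k ≡ c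
  override-above {m} s c {k} m≤k with k ℕ.<? m
  ... | yes k<m = ⊥-elim (ℕ.<⇒≱ k<m m≤k)
  ... | no _ = ≡.refl

  override-agree : ∀ m s c → AgreeBelow m (override m s c) s
  override-agree m s c k k<m = ℤ/l^.reflexive k (override-below s c k<m)

  agree-override : ∀ {m s c t} → AgreeBelow m t s → ℤ/l^._≈_ m (t m) c → AgreeBelow (suc m) t (override m s c)
  agree-override {m} {s} {c} {t} p q k k<1+m with ℕ.m<1+n⇒m<n∨m≡n k<1+m
  ... | inj₁ k<m = subst (ℤ/l^._≈_ k (t k)) (≡.sym (override-below s c k<m)) (p k k<m)
  ... | inj₂ ≡.refl = subst (ℤ/l^._≈_ k (t k)) (≡.sym (override-above s c (ℕ.≤-refl {k}))) q

-- Compactness of P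

module Compactness (em : ExcludedMiddle 0ℓ) (l : ℕ) {{_ : NonZero l}} {Index : Set}
  (_≤ᴵ_ : Index → Index → Set)
  (≤ᴵ-trans : ∀ {i j k} → i ≤ᴵ j → j ≤ᴵ k → i ≤ᴵ k)
  (nonempty : Index)
  (directed : ∀ i j → ∃[ k ] i ≤ᴵ k × j ≤ᴵ k)
  (C : Index → (ℕ → ℤ) → Set)
  (antitone : ∀ {i j t} → i ≤ᴵ j → C j t → C i t)
  (closed : ∀ {i s} → (∀ m → ∃[ t ] C i t × Cylinder.AgreeBelow l m t s) → C i s)
  where

  open Cylinder l

  private
    upper-bound : (f : ℕ → Index) → ∀ b → ∃[ i ] ∀ c → c < b → f c ≤ᴵ i
    upper-bound f zero = nonempty , λ _ ()
    upper-bound f (suc b) =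
      let i , p = upper-bound f b
          j , i≤j , fb≤j = directed i (f b)
      in j , λ c c<1+b → case p i≤j fb≤j (ℕ.m<1+n⇒m<n∨m≡n c<1+b)
      where
      case : ∀ {i j c} → (∀ c → c < b → f c ≤ᴵ i) → i ≤ᴵ j → f b ≤ᴵ j → c < b ⊎ c ≡ b → f c ≤ᴵ j
      case p i≤j fb≤j (inj₁ c<b) = ≤ᴵ-trans (p _ c<b) i≤j
      case p i≤j fb≤j (inj₂ ≡.refl) = fb≤j

    Good : ℕ → (ℕ → ℤ) → Set
    Good m s = ∀ i → ∃[ t ] C i t × AgreeBelow m t s

    refuted : ∀ {m s} → ¬ Good m s → ∃[ i ] ∀ t → C i t → ¬ AgreeBelow m t s
    refuted {m} {s} ¬good with em {∃[ i ] ∀ t → C i t → ¬ AgreeBelow m t s}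
    ... | yes p = p
    ... | no ¬p = ⊥-elim (¬good witness)
      where
      witness : Good m s
      witness i with em {∃[ t ] C i t × AgreeBelow m t s}
      ... | yes p = p
      ... | no ¬q = ⊥-elim (¬p (i , λ t c agree → ¬q (t , c , agree)))

    -- König's lemma: the coordinate m takes only finitely many values.
    extend : ∀ m s → Good m s → ∃[ s′ ] Good (suc m) s′ × AgreeBelow m s′ s
    extend m s good with em {∃[ c ] Good (suc m) (override m s c)}
    ... | yes (c , p) = override m s c , p , override-agree m s c
    -- Otherwise each residue c modulo lᵐ is refuted by some index. For an upper bound i of these
    -- indices, `C i` still has a point near s, and the residue of its coordinate m has been
    -- refuted.
    ... | no ¬p = ⊥-elim (impossible (good i))
      where
      f : ∀ c → ∃[ i ] ∀ t → C i t → ¬ AgreeBelow (suc m) t (override m s (+ c))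
      f c = refuted (λ p → ¬p (+ c , p))
      instance
        l^m≢0 : NonZero (l ^ m)
        l^m≢0 = ℕ.m^n≢0 l m
      i = proj₁ (upper-bound (proj₁ ∘ f) (l ^ m))
      i-upper = proj₂ (upper-bound (proj₁ ∘ f) (l ^ m))
      arith : ∀ x q → (x ℤ.+ q) ℤ.- x ≡ q
      arith = solve-∀
      impossible : ¬ (∃[ t ] C i t × AgreeBelow m t s)
      impossible (t , Ct , t≈s) = proj₂ (f c) t
        (antitone (i-upper c (n%ℕd<d (t m) (l ^ m))) Ct)
        (agree-override {m} {s} {+ c} {t} t≈s (divides (t m /ℕ (l ^ m))
          (≡.trans (≡.cong (λ z → z ℤ.- + c) (a≡a%ℕn+[a/ℕn]*n (t m) (l ^ m))) (arith (+ c) _))))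
        where c = t m %ℕ (l ^ m)

  -- Compactness as the finite intersection property: every cylinder around the limit of the branch
  -- meets every `C i`, and `C i` is closed.
  common-point : (∀ i → ∃[ t ] C i t) → ∃[ t ] ∀ i → C i t
  common-point inhabited = limit , λ i → closed λ m →
    let t , Ct , t≈s = proj₂ (branch m) i in t , Ct , agree-trans t (s m) limit t≈s (s-limit m)
    where
    branch : ∀ m → ∃[ s ] Good m s
    branch zero = (λ _ → ℤ.0ℤ) , λ i → let t , Ct = inhabited i in t , Ct , λ _ ()
    branch (suc m) = let s , good , _ = extend m (proj₁ (branch m)) (proj₂ (branch m)) in s , good

    s : ℕ → ℕ → ℤ
    s m = proj₁ (branch m)

    -- Place k is chosen at stage `suc k` and kept, up to congruence, from then on.
    limit : ℕ → ℤ
    limit k = s (suc k) k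

    s-limit : ∀ m → AgreeBelow m (s m) limit
    s-limit (suc m) k k<1+m = case (ℕ.m<1+n⇒m<n∨m≡n k<1+m)
      where
      case : k < m ⊎ k ≡ m → AbelianGroup._≈_ (ℤ/ (l ^ k)) (s (suc m) k) (limit k)
      case (inj₁ k<m) = AbelianGroup.trans (ℤ/ (l ^ k)) {s (suc m) k} {s m k} {limit k}
        (proj₂ (proj₂ (extend m (s m) (proj₂ (branch m)))) k k<m) (s-limit m k k<m)
      case (inj₂ ≡.refl) = AbelianGroup.refl (ℤ/ (l ^ k)) {limit k}

-- Components of a pro-l group, and embeddings of P into it

module _ (l : ℕ) {{_ : NonZero l}} (D : TopologicalAbelianGroup) (pro : IsPro l D) where

  open Cylinder l

  private
    module D = TG D
    module ∏ = TG (P l)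
    open InverseSystem (proj₁ pro) renaming (_≤_ to _≤ᴵ_)
    module I = Poset index
    module G i = AbelianGroup (group i)
    module φ {i j} (p : i ≤ᴵ j) = GroupMorphisms.IsGroupHomomorphism (φ-homo p)
    open _≅_ (proj₂ (proj₂ pro)) using (forward; backward; inverseʳ)
    module F = ContinuousHomomorphism forward
    module B = ContinuousHomomorphism backward
    module L = TG (inverseLimit (proj₁ pro))

  component : ∀ i → Hom D.abelianGroup (group i)
  component i = mkHom (λ d → proj₁ (F.⟦_⟧ d) i) (λ p → Func.cong F.func p i)
    (λ x y → homo (asHom forward) x y i)

  component-open : ∀ i g → Open D.topology (λ d → G._≈_ i (⟦ component i ⟧ d) g)
  component-open i g = F.continuous (preimage i {λ x → G._≈_ i x g}
    (lift λ x≈y x≈g → G.trans i (G.sym i x≈y) x≈g))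

  component-mono : ∀ {i j d} → i ≤ᴵ j → G._≈_ j (⟦ component j ⟧ d) (G.ε j) → G._≈_ i (⟦ component i ⟧ d) (G.ε i)
  component-mono {i} {j} {d} i≤j p = G.trans i (G.sym i (proj₂ (F.⟦_⟧ d) i≤j))
    (G.trans i (Func.cong (φ i≤j) p) (φ.ε-homo i≤j))

  components-separate : ∀ {d} → (∀ i → G._≈_ i (⟦ component i ⟧ d) (G.ε i)) → d D.≈ D.ε
  components-separate {d} p = D.trans (D.sym (inverseʳ d)) (D.trans (Func.cong B.func {F.⟦_⟧ d} {L.ε} p) (Hom.ε-homo (asHom backward)))

  module _ (em : ExcludedMiddle 0ℓ) (ι : ContinuousHomomorphism (P l) D)
           (ι-injective : ∀ {t} → ContinuousHomomorphism.⟦_⟧ ι t D.≈ D.ε → t ∏.≈ ∏.ε) (n : ℕ) where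

    private
      module ι = ContinuousHomomorphism ι

      Small : Index → (ℕ → ℤ) → Set
      Small i t = G._≈_ i (⟦ component i ⟧ (ι.⟦_⟧ t)) (G.ε i)

    -- Otherwise every i admits some t outside the n-th cylinder around ε with ι t trivial in
    -- component i. The sets of such t shrink along the system, so compactness yields a common
    -- point; it lies in the kernel of ι and yet differs from ε.
    kernel-shrinks : ∃[ i ] ∀ t → Small i t → AgreeBelow n t ∏.ε
    kernel-shrinks with em {∃[ i ] ∀ t → Small i t → AgreeBelow n t ∏.ε}
    ... | yes p = p
    ... | no ¬p = ⊥-elim (proj₂ (proj₂ common nonempty) λ k _ →
        ι-injective {proj₁ common} (components-separate (λ i → proj₁ (proj₂ common i))) k)
      where
      C : Index → (ℕ → ℤ) → Set
      C i t = Small i t × ¬ AgreeBelow n t ∏.ε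

      inhabited : ∀ i → ∃[ t ] C i t
      inhabited i with em {∃[ t ] C i t}
      ... | yes p = p
      ... | no ¬q = ⊥-elim (¬p (i , λ t small → agree t small))
        where
        agree : ∀ t → Small i t → AgreeBelow n t ∏.ε
        agree t small with em {AgreeBelow n t ∏.ε}
        ... | yes p = p
        ... | no ¬p = ⊥-elim (¬q (t , small , ¬p))

      -- Smallness passes to limits by continuity of ι into a discrete component. Failure to agree
      -- with ε below n depends on the first n places only, so approximation at m = n settles it.
      closed : ∀ {i s} → (∀ m → ∃[ t ] C i t × AgreeBelow m t s) → C i s
      closed {i} {s} approximable =
        let m , constant = open⇒cylinder {s = s}
              (ι.continuous (component-open i (⟦ component i ⟧ (ι.⟦_⟧ s)))) (G.refl i)
            t , (small , _) , t≈s = approximable m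
            t′ , (_ , ¬agree) , t′≈s = approximable n
        in G.trans i (G.sym i (constant t t≈s)) small ,
           λ s≈ε → ¬agree (agree-trans t′ s ∏.ε t′≈s s≈ε)

      common : ∃[ t ] ∀ i → C i t
      common = Compactness.common-point em l _≤ᴵ_ I.trans nonempty directed C
        (λ i≤j (small , ¬agree) → component-mono i≤j small , ¬agree) closed inhabited

-- Automorphisms of P

combination-cong : ∀ {Q} (κ : Combination Q) m s t → (∀ i → Q i → m ∣ s i ℤ.- t i) →
                   m ∣ ⟦ hom κ ⟧ s ℤ.- ⟦ hom κ ⟧ t
combination-cong κ m s t p = subst (m ∣_) (Hom.-‿homo (hom κ) s t) (reads-only κ m (λ i → s i ℤ.- t i) p)

bound : (b : ℕ → ℕ) → ∀ n → ∃[ m ] n ≤ m × (∀ k → k < n → b k ≤ m)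
bound b zero = 0 , ℕ.z≤n , λ _ ()
bound b (suc n) =
  let m , n≤m , p = bound b n
  in suc (m ⊔ b n) , ℕ.s≤s (ℕ.≤-trans n≤m (ℕ.m≤m⊔n m (b n))) , λ k k<1+n → case p (ℕ.m<1+n⇒m<n∨m≡n k<1+n)
  where
  case : ∀ {m k} → (∀ k → k < n → b k ≤ m) → k < n ⊎ k ≡ n → b k ≤ suc (m ⊔ b n)
  case {m} p (inj₁ k<n) = ℕ.m≤n⇒m≤1+n (ℕ.≤-trans (p _ k<n) (ℕ.m≤m⊔n m (b n)))
  case {m} p (inj₂ ≡.refl) = ℕ.m≤n⇒m≤1+n (ℕ.m≤n⊔m m (b n))

module _ {G : AbelianGroup 0ℓ 0ℓ} where

  open AbelianGroup G
  open AbelianGroupProperties G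
  open SetoidReasoning setoid

  undo-transport : (α β : Hom G G) → (∀ y → ⟦ β ⟧ (⟦ α ⟧ y) ≈ y) → ∀ y y′ w →
                   ⟦ α ⟧ y ≈ y′ ∙ w → ⟦ β ⟧ y′ ≈ y - ⟦ β ⟧ w
  undo-transport α β βα y y′ w p = begin
    ⟦ β ⟧ y′                    ≈⟨ cong β (//-rightDividesʳ w y′) ⟨
    ⟦ β ⟧ ((y′ ∙ w) - w)        ≈⟨ cong β (∙-congʳ p) ⟨
    ⟦ β ⟧ (⟦ α ⟧ y - w)         ≈⟨ Hom.-‿homo β (⟦ α ⟧ y) w ⟩
    ⟦ β ⟧ (⟦ α ⟧ y) - ⟦ β ⟧ w   ≈⟨ ∙-congʳ (βα y) ⟩
    y - ⟦ β ⟧ w                 ∎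

  compose-transports : (α α′ : Hom G G) → ∀ y y′ y″ w w′ → ⟦ α ⟧ y ≈ y′ ∙ w → ⟦ α′ ⟧ y′ ≈ y″ ∙ w′ →
                       ⟦ α′ ⟧ (⟦ α ⟧ y) ≈ y″ ∙ (w′ ∙ ⟦ α′ ⟧ w)
  compose-transports α α′ y y′ y″ w w′ p p′ = begin
    ⟦ α′ ⟧ (⟦ α ⟧ y)            ≈⟨ cong α′ p ⟩
    ⟦ α′ ⟧ (y′ ∙ w)             ≈⟨ homo α′ y′ w ⟩
    ⟦ α′ ⟧ y′ ∙ ⟦ α′ ⟧ w        ≈⟨ ∙-congʳ p′ ⟩
    y″ ∙ w′ ∙ ⟦ α′ ⟧ w          ≈⟨ assoc y″ w′ (⟦ α′ ⟧ w) ⟩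
    y″ ∙ (w′ ∙ ⟦ α′ ⟧ w)        ∎

module _ (l : ℕ) where

  open Cylinder l

  private
    module ∏ = AbelianGroup (∏ℤ/ l)

  -- Continuity at ε in terms of cylinders, which for a homomorphism is continuity.
  Bounded : Hom (∏ℤ/ l) (∏ℤ/ l) → Set
  Bounded α = ∀ n → ∃[ m ] ∀ y → AgreeBelow m y ∏.ε → AgreeBelow n (⟦ α ⟧ y) ∏.ε

  -- With ρ(Mⱼ) = tⱼ and ρ′(Mⱼ) = t′ⱼ, this says that α pushes the extension of A by P
  -- classified by ρ : R → P forward to the one classified by ρ′, h being the coboundary.
  record Transport {r : ℕ} (M : Fin r → Fin r → ℤ) (t t′ : Fin r → ℕ → ℤ) : Set where
    field
      α β        : Hom (∏ℤ/ l) (∏ℤ/ l)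
      α-bounded  : Bounded α
      β-bounded  : Bounded β
      βα         : ∀ y → ⟦ β ⟧ (⟦ α ⟧ y) ∏.≈ y
      αβ         : ∀ y → ⟦ α ⟧ (⟦ β ⟧ y) ∏.≈ y
      h          : Hom (ℤ^ Fin r) (∏ℤ/ l)
      transports : ∀ j → ⟦ α ⟧ (t j) ∏.≈ t′ j ∏.∙ ⟦ h ⟧ (M j)

  module _ {r : ℕ} {M : Fin r → Fin r → ℤ} where

    open Transport

    transport-sym : ∀ {t t′} → Transport M t t′ → Transport M t′ t
    transport-sym {t} {t′} τ = record
      { α = β τ ; β = α τ ; α-bounded = β-bounded τ ; β-bounded = α-bounded τ
      ; βα = αβ τ ; αβ = βα τ
      ; h = -ʰ (β τ ∘ʰ h τ)
      ; transports = λ j → undo-transport (α τ) (β τ) (βα τ) (t j) (t′ j) (⟦ h τ ⟧ (M j)) (transports τ j) }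

    transport-trans : ∀ {t t′ t″} → Transport M t t′ → Transport M t′ t″ → Transport M t t″
    transport-trans {t} {t′} {t″} τ τ′ = record
      { α = α τ′ ∘ʰ α τ ; β = β τ ∘ʰ β τ′
      ; α-bounded = λ n → let m , p = α-bounded τ′ n ; m′ , p′ = α-bounded τ m in
          m′ , λ y q → p (⟦ α τ ⟧ y) (p′ y q)
      ; β-bounded = λ n → let m , p = β-bounded τ n ; m′ , p′ = β-bounded τ′ m in
          m′ , λ y q → p (⟦ β τ′ ⟧ y) (p′ y q)
      ; βα = λ y → ∏.trans {⟦ β τ ⟧ (⟦ β τ′ ⟧ (⟦ α τ′ ⟧ (⟦ α τ ⟧ y)))} {⟦ β τ ⟧ (⟦ α τ ⟧ y)} {y}
          (cong (β τ) {⟦ β τ′ ⟧ (⟦ α τ′ ⟧ (⟦ α τ ⟧ y))} {⟦ α τ ⟧ y} (βα τ′ (⟦ α τ ⟧ y))) (βα τ y)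
      ; αβ = λ y → ∏.trans {⟦ α τ′ ⟧ (⟦ α τ ⟧ (⟦ β τ ⟧ (⟦ β τ′ ⟧ y)))} {⟦ α τ′ ⟧ (⟦ β τ′ ⟧ y)} {y}
          (cong (α τ′) {⟦ α τ ⟧ (⟦ β τ ⟧ (⟦ β τ′ ⟧ y))} {⟦ β τ′ ⟧ y} (αβ τ (⟦ β τ′ ⟧ y))) (αβ τ′ y)
      ; h = h τ′ +ʰ (α τ′ ∘ʰ h τ)
      ; transports = λ j → compose-transports (α τ) (α τ′) (t j) (t′ j) (t″ j)
          (⟦ h τ ⟧ (M j)) (⟦ h τ′ ⟧ (M j)) (transports τ j) (transports τ′ j) }

    -- The places in `Q` are read, the others are written. Reading from places i ≥ k gives a
    -- well-defined value modulo lᵏ, the bound `b k` gives continuity, and the vanishing of `κ k`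
    -- for k in `Q` gives invertibility.
    module Shear (Q : ℕ → Set) (b : ℕ → ℕ)
                 (κ : ∀ k → Combination (λ i → Q i × Interval l M k (b k) i))
                 (κ-vanishes : ∀ {k} → Q k → ∀ y → ⟦ hom (κ k) ⟧ y ≡ ℤ.0ℤ) where

      private
        κ⟦_⟧ : ℕ → (ℕ → ℤ) → ℤ
        κ⟦ k ⟧ = ⟦ hom (κ k) ⟧

      shear : ℤ → Hom (∏ℤ/ l) (∏ℤ/ l)
      shear σ = mkHom (λ y k → y k ℤ.+ σ ℤ.* κ⟦ k ⟧ y) (λ {y} {y′} p → shear-cong y y′ p)
        (λ y y′ k → AbelianGroup.reflexive (ℤ/ (l ^ k)) (≡.trans
          (≡.cong (λ z → y k ℤ.+ y′ k ℤ.+ σ ℤ.* z) (homo (hom (κ k)) y y′))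
          (add (y k) (y′ k) σ (κ⟦ k ⟧ y) (κ⟦ k ⟧ y′))))
        where
        add : ∀ a b s c d → a ℤ.+ b ℤ.+ s ℤ.* (c ℤ.+ d) ≡ (a ℤ.+ s ℤ.* c) ℤ.+ (b ℤ.+ s ℤ.* d)
        add = solve-∀
        difference : ∀ a b s c d → (a ℤ.- b) ℤ.+ s ℤ.* (c ℤ.- d) ≡ (a ℤ.+ s ℤ.* c) ℤ.- (b ℤ.+ s ℤ.* d)
        difference = solve-∀
        shear-cong : ∀ y y′ → y ∏.≈ y′ → ∀ k →
          + (l ^ k) ∣ (y k ℤ.+ σ ℤ.* κ⟦ k ⟧ y) ℤ.- (y′ k ℤ.+ σ ℤ.* κ⟦ k ⟧ y′)
        shear-cong y y′ p k = subst (+ (l ^ k) ∣_) (difference (y k) (y′ k) σ (κ⟦ k ⟧ y) (κ⟦ k ⟧ y′))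
          (∣m∣n⇒∣m+n (p k) (∣n⇒∣m*n σ (combination-cong (κ k) (+ (l ^ k)) y y′
            (λ i (_ , k≤i , _) → ∣-trans (^-mono-∣ l k≤i) (p i)))))

      shear-bounded : ∀ σ → Bounded (shear σ)
      shear-bounded σ n = m , λ y p k k<n → subst (+ (l ^ k) ∣_) (≡.sym (ℤ.+-identityʳ _))
        (∣m∣n⇒∣m+n (divisible y p k (ℕ.<-≤-trans k<n n≤m))
          (∣n⇒∣m*n σ (reads-only (κ k) (+ (l ^ k)) y λ i (_ , k≤i , i<b) →
            ∣-trans (^-mono-∣ l k≤i) (divisible y p i (ℕ.<-≤-trans i<b (b≤m k k<n))))))
        where
        m = proj₁ (bound b n)
        n≤m = proj₁ (proj₂ (bound b n))
        b≤m = proj₂ (proj₂ (bound b n))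
        divisible : ∀ y → AgreeBelow m y ∏.ε → ∀ i → i < m → + (l ^ i) ∣ y i
        divisible y p i i<m = subst (+ (l ^ i) ∣_) (ℤ.+-identityʳ (y i)) (p i i<m)

      -- The shear applied first leaves the places in `Q` alone, so the second one reads there what
      -- the first one read.
      shear-inverse : ∀ σ τ → τ ℤ.+ σ ≡ ℤ.0ℤ → ∀ y → ⟦ shear σ ⟧ (⟦ shear τ ⟧ y) ∏.≈ y
      shear-inverse σ τ τ+σ≡0 y k = subst (+ (l ^ k) ∣_)
        (≡.trans (≡.cong (λ s → s ℤ.* κ⟦ k ⟧ y ℤ.+ σ ℤ.* (κ⟦ k ⟧ z ℤ.- κ⟦ k ⟧ y)) (≡.sym τ+σ≡0))
          (regroup (y k) τ σ (κ⟦ k ⟧ y) (κ⟦ k ⟧ z)))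
        (∣m∣n⇒∣m+n (divides ℤ.0ℤ ≡.refl) (∣n⇒∣m*n σ (combination-cong (κ k) (+ (l ^ k)) z y
          λ i (q , _) → divides ℤ.0ℤ (≡.trans (≡.cong (λ x → y i ℤ.+ τ ℤ.* x ℤ.- y i) (κ-vanishes q y))
            (unchanged (y i) τ)))))
        where
        z = ⟦ shear τ ⟧ y
        unchanged : ∀ a s → a ℤ.+ s ℤ.* ℤ.0ℤ ℤ.- a ≡ ℤ.0ℤ
        unchanged = solve-∀
        regroup : ∀ a τ σ c d → (τ ℤ.+ σ) ℤ.* c ℤ.+ σ ℤ.* (d ℤ.- c) ≡ ((a ℤ.+ τ ℤ.* c) ℤ.+ σ ℤ.* d) ℤ.- a
        regroup = solve-∀

    -- The shear adds to place k of every `t j` the combination of its places in `Q` that represents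
    -- the required difference modulo lᵏ. One form `κ k` has to serve all j at once, which is why
    -- whole vectors over j must be spanned; the columns of M are absorbed by h.
    transport-step : ExcludedMiddle 0ℓ → (Q : ℕ → Set) → ∀ {t t′} →
      (∀ j {k} → Q k → t j k ≡ t′ j k) →
      (∀ k → ¬ Q k → ∃[ b ] SpannedMod l M k t (λ i → Q i × Interval l M k b i) (λ j → t′ j k ℤ.- t j k)) →
      Transport M t t′
    transport-step em Q {t} {t′} same spanned = record
      { α = shear ℤ.1ℤ ; β = shear ℤ.-1ℤ
      ; α-bounded = shear-bounded ℤ.1ℤ ; β-bounded = shear-bounded ℤ.-1ℤ
      ; βα = shear-inverse ℤ.-1ℤ ℤ.1ℤ ≡.refl ; αβ = shear-inverse ℤ.1ℤ ℤ.-1ℤ ≡.refl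
      ; h = mkHom (λ w k → ⟦ η k ⟧ w) (λ p k → AbelianGroup.reflexive (ℤ/ (l ^ k)) (cong (η k) p))
                  (λ w w′ k → AbelianGroup.reflexive (ℤ/ (l ^ k)) (homo (η k) w w′))
      ; transports = λ j k → subst (+ (l ^ k) ∣_)
          (rearrange (t j k) (t′ j k) (⟦ η k ⟧ (M j)) (⟦ hom (κ k) ⟧ (t j)))
          (∣m⇒∣-m (proj₂ (proj₂ (proj₁ (proj₂ (step k)))) j)) }
      where
      rearrange : ∀ t t′ h κ → ℤ.- ((t′ ℤ.- t) ℤ.+ h ℤ.- κ) ≡ (t ℤ.+ ℤ.1ℤ ℤ.* κ) ℤ.- (t′ ℤ.+ h)
      rearrange = solve-∀

      step : ∀ k → ∃[ b ] Σ[ s ∈ SpannedMod l M k t (λ i → Q i × Interval l M k b i) (λ j → t′ j k ℤ.- t j k) ]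
                   (Q k → ∀ y → ⟦ hom (proj₁ s) ⟧ y ≡ ℤ.0ℤ)
      step k with em {Q k}
      -- Nothing has to be corrected on `Q`, and the combination supplied by `spanned-multiple` is
      -- zero by definition, as the shear demands.
      ... | yes q = 0 ,
        (spanned-multiple l M k {λ j → t′ j k ℤ.- t j k} λ j → divides ℤ.0ℤ (ℤ.i≡j⇒i-j≡0 (≡.sym (same j q)))) ,
        λ _ _ → ≡.refl
      ... | no ¬q = let b , s = spanned k ¬q in b , s , λ q → ⊥-elim (¬q q)

      κ : ∀ k → Combination (λ i → Q i × Interval l M k (proj₁ (step k)) i)
      κ k = proj₁ (proj₁ (proj₂ (step k)))
      η : ∀ k → Hom (ℤ^ Fin r) ℤ⁺
      η k = proj₁ (proj₂ (proj₁ (proj₂ (step k))))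

      open Shear Q (proj₁ ∘ step) κ (λ {k} → proj₂ (proj₂ (step k)))

-- Alternating blocks

parity : ℕ → Bool
parity zero    = true
parity (suc n) = not (parity n)

parity-cofinal : ∀ p k → ∃[ n ] k ≤ n × parity n ≡ p
parity-cofinal p k with parity k in eq
parity-cofinal true  k | true  = k , ℕ.≤-refl , eq
parity-cofinal false k | false = k , ℕ.≤-refl , eq
parity-cofinal false k | true  = suc k , ℕ.n≤1+n k , ≡.cong not eq
parity-cofinal true  k | false = suc k , ℕ.n≤1+n k , ≡.cong not eq

module _ (em : ExcludedMiddle 0ℓ) (l : ℕ) {r : ℕ} {M : Fin r → Fin r → ℤ} {t t′ : Fin r → ℕ → ℤ}
         (t-spans : TailsSpan l M t) (t′-spans : TailsSpan l M t′) where

  private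
    -- `suc n` makes the starting points of the blocks tend to infinity even if the ends of the
    -- windows do not.
    next : ℕ → ℕ
    next n = suc n ⊔ (proj₁ (t-spans n) ⊔ proj₁ (t′-spans n))

    e : ℕ → ℕ
    e zero    = 0
    e (suc n) = next (e n)

    e-step : ∀ n → e n < e (suc n)
    e-step n = ℕ.m≤m⊔n (suc (e n)) (proj₁ (t-spans (e n)) ⊔ proj₁ (t′-spans (e n)))

    e-mono : ∀ {m n} → m ≤ n → e m ≤ e n
    e-mono {m} m≤n = go (ℕ.≤⇒≤′ m≤n)
      where
      go : ∀ {n} → m ℕ.≤′ n → e m ≤ e n
      go (ℕ.≤′-reflexive ≡.refl) = ℕ.≤-refl
      go (ℕ.≤′-step {n} p) = ℕ.≤-trans (go p) (ℕ.<⇒≤ (e-step n))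

    n≤e : ∀ n → n ≤ e n
    n≤e zero = ℕ.z≤n
    n≤e (suc n) = ℕ.≤-trans (ℕ.s≤s (n≤e n)) (e-step n)

    Block : Bool → ℕ → Set
    Block p i = ∃[ n ] parity n ≡ p × Interval l M (e n) (e (suc n)) i

    block-index-≤ : ∀ {m n i} → Interval l M (e m) (e (suc m)) i → Interval l M (e n) (e (suc n)) i → m ≤ n
    block-index-≤ (em≤i , _) (_ , i<e) = ℕ.≮⇒≥ λ n<m →
      ℕ.<-irrefl ≡.refl (ℕ.<-≤-trans i<e (ℕ.≤-trans (e-mono n<m) em≤i))

    blocks-disjoint : ∀ {i} → Block true i → Block false i → ⊥
    blocks-disjoint (m , m-even , p) (n , n-odd , q)
      with ℕ.≤-antisym (block-index-≤ {m} {n} p q) (block-index-≤ {n} {m} q p)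
    ... | ≡.refl = contradiction (≡.trans (≡.sym m-even) n-odd) λ ()

    -- Blocks of either parity occur beyond every k, and each contains the window of `s` at its
    -- start. As e n ≥ n ≥ k, only places from k on are read.
    spans-along : ∀ (s : Fin r → ℕ → ℤ) (spans : TailsSpan l M s) → (∀ n → proj₁ (spans n) ≤ next n) →
      ∀ p k w → ∃[ b ] SpannedMod l M k s (λ i → Block p i × Interval l M k b i) w
    spans-along s spans bounded p k w =
      let n , k≤n , n-parity = parity-cofinal p k
          κ , h , eq = proj₂ (spans (e n)) k w
      in e (suc n) , weaken (λ (en≤i , i<b) →
           let i<e = ℕ.<-≤-trans i<b (bounded (e n)) in
           (n , n-parity , en≤i , i<e) , ℕ.≤-trans k≤n (ℕ.≤-trans (n≤e n) en≤i) , i<e) κ , h , eq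

    mixed : ∀ k → ∃[ f ] (Block true k → ∀ j → f j ≡ t j k) × (¬ Block true k → ∀ j → f j ≡ t′ j k)
    mixed k with em {Block true k}
    ... | yes p = (λ j → t j k) , (λ _ _ → ≡.refl) , λ ¬p → ⊥-elim (¬p p)
    ... | no ¬p = (λ j → t′ j k) , (λ p → ⊥-elim (¬p p)) , λ _ _ → ≡.refl

    t₁ : Fin r → ℕ → ℤ
    t₁ j k = proj₁ (mixed k) j

    t₁≡t : ∀ j {k} → Block true k → t₁ j k ≡ t j k
    t₁≡t j {k} p = proj₁ (proj₂ (mixed k)) p j

    t₁≡t′ : ∀ j {k} → ¬ Block true k → t₁ j k ≡ t′ j k
    t₁≡t′ j {k} ¬p = proj₂ (proj₂ (mixed k)) ¬p j

  tails-span⇒transport : Transport l M t t′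
  tails-span⇒transport = transport-trans l
    (transport-step l em (Block true) (λ j p → ≡.sym (t₁≡t j p))
      (λ k _ → spans-along t t-spans (λ n → ℕ.≤-trans (ℕ.m≤m⊔n _ _) (ℕ.m≤n⊔m (suc n) _)) true k
        (λ j → t₁ j k ℤ.- t j k)))
    (transport-step l em (λ k → ¬ Block true k) t₁≡t′ (λ k _ → odd-step k (λ j → t′ j k ℤ.- t₁ j k)))
    where
    -- The combinations come from t′ on the odd blocks. These are disjoint from the even ones, so t₁
    -- coincides with t′ there and can replace it.
    odd-step : ∀ k w → ∃[ b ] SpannedMod l M k t₁ (λ i → (¬ Block true i) × Interval l M k b i) w
    odd-step k w =
      let b , κ , h , eq = spans-along t′ t′-spans
            (λ n → ℕ.≤-trans (ℕ.m≤n⊔m (proj₁ (t-spans n)) _) (ℕ.m≤n⊔m (suc n) _)) false k w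
      in b , weaken (λ (q , i) → (λ p → blocks-disjoint p q) , i) κ , h , λ j →
        subst (+ (l ^ k) ∣_) (telescope (w j ℤ.+ ⟦ h ⟧ (M j)) (⟦ hom κ ⟧ (t′ j)) (⟦ hom κ ⟧ (t₁ j)))
          (∣m∣n⇒∣m+n (eq j) (combination-cong κ (+ (l ^ k)) (t′ j) (t₁ j) (λ i (q , _) →
            divides ℤ.0ℤ (ℤ.i≡j⇒i-j≡0 (≡.sym (t₁≡t′ j (λ p → blocks-disjoint p q)))))))
      where
      telescope : ∀ a b c → (a ℤ.- b) ℤ.+ (b ℤ.- c) ≡ a ℤ.- c
      telescope = solve-∀

-- Uniqueness

module _ {G D D′ : AbelianGroup 0ℓ 0ℓ} (c : Hom G D) (f : Hom G D′) where
  private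
    module G = AbelianGroup G
    module D = AbelianGroup D
    module D′ = AbelianGroup D′
    module DP = AbelianGroupProperties D
    module D′P = AbelianGroupProperties D′

  -- The homomorphism theorem for a quotient map `c` with chosen preimages. The choice is hidden,
  -- since only `factor-commutes` matters.
  module Factor (section : ∀ d → ∃[ g ] ⟦ c ⟧ g D.≈ d)
                (kernel⊆ : ∀ g → ⟦ c ⟧ g D.≈ D.ε → ⟦ f ⟧ g D′.≈ D′.ε) where

    well-defined : ∀ {g g′} → ⟦ c ⟧ g D.≈ ⟦ c ⟧ g′ → ⟦ f ⟧ g D′.≈ ⟦ f ⟧ g′
    well-defined {g} {g′} p = D′P.x∙y⁻¹≈ε⇒x≈y _ _ (D′.trans (D′.sym (Hom.-‿homo f g g′))
      (kernel⊆ (g G.- g′) (D.trans (Hom.-‿homo c g g′) (DP.x≈y⇒x∙y⁻¹≈ε p))))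

    abstract
      factor : Hom D D′
      factor = mkHom (λ d → ⟦ f ⟧ (proj₁ (section d)))
        (λ p → well-defined (D.trans (proj₂ (section _)) (D.trans p (D.sym (proj₂ (section _))))))
        (λ d d′ → D′.trans
          (well-defined (D.trans (proj₂ (section _)) (D.trans
            (D.sym (D.∙-cong (proj₂ (section d)) (proj₂ (section d′)))) (D.sym (homo c _ _)))))
          (homo f _ _))

      factor-commutes : ∀ g → ⟦ factor ⟧ (⟦ c ⟧ g) D′.≈ ⟦ f ⟧ g
      factor-commutes g = well-defined (proj₂ (section _))

module _ {G H : AbelianGroup 0ℓ 0ℓ} where

  fstʰ : Hom (DirectProduct.abelianGroup G H) G
  fstʰ = mkHom proj₁ proj₁ (λ _ _ → AbelianGroup.refl G)

  sndʰ : Hom (DirectProduct.abelianGroup G H) H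
  sndʰ = mkHom proj₂ proj₂ (λ _ _ → AbelianGroup.refl H)

module _ {G : AbelianGroup 0ℓ 0ℓ} (α β : Hom G G) where

  open AbelianGroup G
  open AbelianGroupProperties G
  open SetoidReasoning setoid

  -- With w = h z, this identity and the next say that transports with coboundaries h and - β h undo
  -- each other on the T-part of a presentation.
  βα∙-cancel : (∀ y → ⟦ β ⟧ (⟦ α ⟧ y) ≈ y) → ∀ y w → ⟦ β ⟧ (⟦ α ⟧ y ∙ w) - ⟦ β ⟧ w ≈ y
  βα∙-cancel βα y w = begin
    ⟦ β ⟧ (⟦ α ⟧ y ∙ w) - ⟦ β ⟧ w           ≈⟨ ∙-congʳ (homo β (⟦ α ⟧ y) w) ⟩
    ⟦ β ⟧ (⟦ α ⟧ y) ∙ ⟦ β ⟧ w - ⟦ β ⟧ w     ≈⟨ //-rightDividesʳ (⟦ β ⟧ w) (⟦ β ⟧ (⟦ α ⟧ y)) ⟩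
    ⟦ β ⟧ (⟦ α ⟧ y)                         ≈⟨ βα y ⟩
    y                                       ∎

  αβ∙-cancel : (∀ y → ⟦ α ⟧ (⟦ β ⟧ y) ≈ y) → ∀ y w → ⟦ α ⟧ (⟦ β ⟧ y - ⟦ β ⟧ w) ∙ w ≈ y
  αβ∙-cancel αβ y w = begin
    ⟦ α ⟧ (⟦ β ⟧ y - ⟦ β ⟧ w) ∙ w           ≈⟨ ∙-congʳ (cong α (Hom.-‿homo β y w)) ⟨
    ⟦ α ⟧ (⟦ β ⟧ (y - w)) ∙ w               ≈⟨ ∙-congʳ (αβ (y - w)) ⟩
    (y - w) ∙ w                             ≈⟨ //-rightDividesˡ w y ⟩
    y                                       ∎

-- D as the quotient of T × ℤᴺ by the elements (- Σ vⱼ tⱼ , Σ vⱼ Mⱼ).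
record Presented (T : AbelianGroup 0ℓ 0ℓ) {N : ℕ} (M : Fin N → Fin N → ℤ) (D : AbelianGroup 0ℓ 0ℓ) : Set where
  private
    module T = AbelianGroup T
    module D = AbelianGroup D
  field
    ι       : Hom T D
    ev      : Hom (ℤ^ Fin N) D
    t       : Fin N → T.Carrier
    ι-t     : ∀ j → ⟦ ι ⟧ (t j) D.≈ ⟦ ev ⟧ (M j)
    section : ∀ d → ∃[ g ] ⟦ ι ⟧ (proj₁ g) D.∙ ⟦ ev ⟧ (proj₂ g) D.≈ d
    kernel  : ∀ y z → ⟦ ι ⟧ y D.∙ ⟦ ev ⟧ z D.≈ D.ε →
              ∃[ v ] (∀ i → ℤ^-lc.lc v M i ≡ z i) × y T.∙ LinearCombination.lc T v t T.≈ T.ε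

  present : Hom (DirectProduct.abelianGroup T (ℤ^ Fin N)) D
  present = (ι ∘ʰ fstʰ) +ʰ (ev ∘ʰ sndʰ)

  ι-lc : ∀ v → ⟦ ι ⟧ (LinearCombination.lc T v t) D.≈ ⟦ ev ⟧ (ℤ^-lc.lc v M)
  ι-lc v = D.trans (lc-homo ι v t)
    (D.trans (LinearCombination.lc-congʳ D v ι-t) (D.sym (lc-homo ev v M)))

module Pushforward {T : AbelianGroup 0ℓ 0ℓ} {N : ℕ} {M : Fin N → Fin N → ℤ} {D D′ : AbelianGroup 0ℓ 0ℓ}
  (X : Presented T M D) (X′ : Presented T M D′) (α : Hom T T) (h : Hom (ℤ^ Fin N) T)
  (transports : ∀ j → AbelianGroup._≈_ T (⟦ α ⟧ (Presented.t X j))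
                        (AbelianGroup._∙_ T (Presented.t X′ j) (⟦ h ⟧ (M j)))) where

  private
    module T = AbelianGroup T
    module D = AbelianGroup D
    module D′ = AbelianGroup D′
    module X = Presented X
    module X′ = Presented X′
    open LinearCombination T

    value : Hom (DirectProduct.abelianGroup T (ℤ^ Fin N)) D′
    value = (X′.ι ∘ʰ ((α ∘ʰ fstʰ) +ʰ (h ∘ʰ sndʰ))) +ʰ (X′.ev ∘ʰ sndʰ)

    -- A relation (- tⱼ , Mⱼ) acquires the T-part - α tⱼ + h(Mⱼ) = - t′ⱼ, and (- t′ⱼ , Mⱼ) is a
    -- relation of D′.
    kernel⊆ : ∀ g → ⟦ X.present ⟧ g D.≈ D.ε → ⟦ value ⟧ g D′.≈ D′.ε
    kernel⊆ (y , z) p = begin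
      ⟦ X′.ι ⟧ (⟦ α ⟧ y T.∙ ⟦ h ⟧ z) D′.∙ ⟦ X′.ev ⟧ z           ≈⟨ D′.∙-congˡ (D′.trans (X′.ι-lc v) (cong X′.ev v≗z)) ⟨
      ⟦ X′.ι ⟧ (⟦ α ⟧ y T.∙ ⟦ h ⟧ z) D′.∙ ⟦ X′.ι ⟧ (lc v X′.t)  ≈⟨ homo X′.ι _ _ ⟨
      ⟦ X′.ι ⟧ (⟦ α ⟧ y T.∙ ⟦ h ⟧ z T.∙ lc v X′.t)              ≈⟨ cong X′.ι total ⟩
      ⟦ X′.ι ⟧ T.ε                                              ≈⟨ ε-homo X′.ι ⟩
      D′.ε                                                      ∎
      where
      open SetoidReasoning D′.setoid
      v = proj₁ (X.kernel y z p)
      v≗z = proj₁ (proj₂ (X.kernel y z p))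
      module S = SetoidReasoning T.setoid

      α-lc : ⟦ α ⟧ (lc v X.t) T.≈ lc v X′.t T.∙ ⟦ h ⟧ z
      α-lc = S.begin
        ⟦ α ⟧ (lc v X.t)                              S.≈⟨ lc-homo α v X.t ⟩
        lc v (⟦ α ⟧ ∘ X.t)                            S.≈⟨ lc-congʳ v transports ⟩
        lc v (λ j → X′.t j T.∙ ⟦ h ⟧ (M j))           S.≈⟨ lc-distribˡ v X′.t (⟦ h ⟧ ∘ M) ⟩
        lc v X′.t T.∙ lc v (⟦ h ⟧ ∘ M)                S.≈⟨ T.∙-congˡ (lc-homo h v M) ⟨
        lc v X′.t T.∙ ⟦ h ⟧ (ℤ^-lc.lc v M)            S.≈⟨ T.∙-congˡ (cong h v≗z) ⟩
        lc v X′.t T.∙ ⟦ h ⟧ z                         S.∎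

      total : ⟦ α ⟧ y T.∙ ⟦ h ⟧ z T.∙ lc v X′.t T.≈ T.ε
      total = S.begin
        ⟦ α ⟧ y T.∙ ⟦ h ⟧ z T.∙ lc v X′.t             S.≈⟨ T.assoc _ _ _ ⟩
        ⟦ α ⟧ y T.∙ (⟦ h ⟧ z T.∙ lc v X′.t)           S.≈⟨ T.∙-congˡ (T.trans (T.comm _ _) (T.sym α-lc)) ⟩
        ⟦ α ⟧ y T.∙ ⟦ α ⟧ (lc v X.t)                  S.≈⟨ homo α _ _ ⟨
        ⟦ α ⟧ (y T.∙ lc v X.t)                        S.≈⟨ cong α (proj₂ (proj₂ (X.kernel y z p))) ⟩
        ⟦ α ⟧ T.ε                                     S.≈⟨ ε-homo α ⟩
        T.ε                                           S.∎

    module F = Factor X.present value X.section kernel⊆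

  abstract
    θ : Hom D D′
    θ = F.factor

    θ-present : ∀ y z → ⟦ θ ⟧ (⟦ X.ι ⟧ y D.∙ ⟦ X.ev ⟧ z) D′.≈ ⟦ X′.ι ⟧ (⟦ α ⟧ y T.∙ ⟦ h ⟧ z) D′.∙ ⟦ X′.ev ⟧ z
    θ-present y z = F.factor-commutes (y , z)

  θ-ι : ∀ y → ⟦ θ ⟧ (⟦ X.ι ⟧ y) D′.≈ ⟦ X′.ι ⟧ (⟦ α ⟧ y)
  θ-ι y = begin
    ⟦ θ ⟧ (⟦ X.ι ⟧ y)                                                  ≈⟨ cong θ (D.trans (D.∙-congˡ (ε-homo X.ev)) (D.identityʳ _)) ⟨
    ⟦ θ ⟧ (⟦ X.ι ⟧ y D.∙ ⟦ X.ev ⟧ (λ _ → ℤ.0ℤ))                        ≈⟨ θ-present y _ ⟩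
    ⟦ X′.ι ⟧ (⟦ α ⟧ y T.∙ ⟦ h ⟧ (λ _ → ℤ.0ℤ)) D′.∙ ⟦ X′.ev ⟧ (λ _ → ℤ.0ℤ)
      ≈⟨ D′.∙-cong (cong X′.ι (T.trans (T.∙-congˡ (ε-homo h)) (T.identityʳ _))) (ε-homo X′.ev) ⟩
    ⟦ X′.ι ⟧ (⟦ α ⟧ y) D′.∙ D′.ε                                       ≈⟨ D′.identityʳ _ ⟩
    ⟦ X′.ι ⟧ (⟦ α ⟧ y)                                                 ∎
    where open SetoidReasoning D′.setoid

module _ {T : AbelianGroup 0ℓ 0ℓ} {N : ℕ} {M : Fin N → Fin N → ℤ} {D D′ : AbelianGroup 0ℓ 0ℓ}
  (X : Presented T M D) (X′ : Presented T M D′) (α β : Hom T T) (h h′ : Hom (ℤ^ Fin N) T)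
  (transports : ∀ j → AbelianGroup._≈_ T (⟦ α ⟧ (Presented.t X j))
                        (AbelianGroup._∙_ T (Presented.t X′ j) (⟦ h ⟧ (M j))))
  (transports′ : ∀ j → AbelianGroup._≈_ T (⟦ β ⟧ (Presented.t X′ j))
                         (AbelianGroup._∙_ T (Presented.t X j) (⟦ h′ ⟧ (M j)))) where

  private
    module T = AbelianGroup T
    module D = AbelianGroup D
    module D′ = AbelianGroup D′
    module X = Presented X
    module X′ = Presented X′
    module Θ = Pushforward X X′ α h transports
    module Θ′ = Pushforward X′ X β h′ transports′

  -- Both maps preserve the ℤᴺ-part z, so the composite is the identity as soon as it is so on the
  -- T-part.
  pushforward-inverse : (∀ y z → ⟦ β ⟧ (⟦ α ⟧ y T.∙ ⟦ h ⟧ z) T.∙ ⟦ h′ ⟧ z T.≈ y) →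
                        ∀ d → ⟦ Θ′.θ ⟧ (⟦ Θ.θ ⟧ d) D.≈ d
  pushforward-inverse inverse d = let (y , z) , p = X.section d in begin
    ⟦ Θ′.θ ⟧ (⟦ Θ.θ ⟧ d)                                              ≈⟨ cong Θ′.θ (cong Θ.θ p) ⟨
    ⟦ Θ′.θ ⟧ (⟦ Θ.θ ⟧ (⟦ X.ι ⟧ y D.∙ ⟦ X.ev ⟧ z))                     ≈⟨ cong Θ′.θ (Θ.θ-present y z) ⟩
    ⟦ Θ′.θ ⟧ (⟦ X′.ι ⟧ (⟦ α ⟧ y T.∙ ⟦ h ⟧ z) D′.∙ ⟦ X′.ev ⟧ z)        ≈⟨ Θ′.θ-present _ z ⟩
    ⟦ X.ι ⟧ (⟦ β ⟧ (⟦ α ⟧ y T.∙ ⟦ h ⟧ z) T.∙ ⟦ h′ ⟧ z) D.∙ ⟦ X.ev ⟧ z ≈⟨ D.∙-congʳ (cong X.ι (inverse y z)) ⟩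
    ⟦ X.ι ⟧ y D.∙ ⟦ X.ev ⟧ z                                          ≈⟨ p ⟩
    d                                                                 ∎
    where open SetoidReasoning D.setoid

-- Isomorphism of any two extensions of A by P

module _ {l : ℕ} (l-prime : Prime l) (A : AbelianGroup 0ℓ 0ℓ) {N : ℕ}
    (enum : Inverse (≡.setoid (Fin N)) (AbelianGroup.setoid A))
    (B : Basis (FiniteGroup.Relation A enum)) where

  private
    module A = AbelianGroup A
    module A-lc = LinearCombination A
    module B = Basis B
    module AP = AbelianGroupProperties A
    module ∏ = AbelianGroup (∏ℤ/ l)
    M = B.vectors
    x = Inverse.to enum
    module Data = ExtensionData l-prime A enum B
    instance
      l≢0 : NonZero l
      l≢0 = l-nonZero l-prime

  module Presentation (D : TopologicalAbelianGroup) (E : ExtensionByTorsionClosure (P l) (discrete A) D) where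

    private
      module D = TG D
      module DP = AbelianGroupProperties D.abelianGroup
    open Data D E public

    -- Every element of A is a generator, so some lift `x̂ i` has the same image in A as d, and a
    -- unit vector suffices.
    section : ∀ d → ∃[ g ] ⟦ ιʰ ⟧ (proj₁ g) D.∙ ⟦ ev ⟧ (proj₂ g) D.≈ d
    section d = (proj₁ ι-preimage , δ i) , (begin
      ⟦ ιʰ ⟧ (proj₁ ι-preimage) D.∙ ⟦ ev ⟧ (δ i)   ≈⟨ D.∙-cong (proj₂ ι-preimage) ev-δ ⟩
      (d D.- x̂ i) D.∙ x̂ i                          ≈⟨ DP.//-rightDividesˡ (x̂ i) d ⟩
      d                                            ∎)
      where
      open SetoidReasoning D.setoid
      i = Inverse.from enum (⟦ πʰ ⟧ d)
      ev-δ : ⟦ ev ⟧ (δ i) D.≈ x̂ i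
      ev-δ = LinearCombination.lc-δ D.abelianGroup i x̂
      ι-preimage : ∃[ y ] ⟦ ιʰ ⟧ y D.≈ d D.- x̂ i
      ι-preimage = kernel⇒image (A.trans (Hom.-‿homo πʰ d (x̂ i))
        (AP.x≈y⇒x∙y⁻¹≈ε (A.sym (A.trans (π-x̂ i) (Inverse.strictlyInverseˡ enum _)))))

    kernel : ∀ y z → ⟦ ιʰ ⟧ y D.∙ ⟦ ev ⟧ z D.≈ D.ε →
      ∃[ v ] (∀ i → ℤ^-lc.lc v M i ≡ z i) × (y ∏.∙ ∏-lc.lc l v t) ∏.≈ ∏.ε
    kernel y z p = v , v≗z , ι-injective {y ∏.∙ ∏-lc.lc l v t} (begin
      ⟦ ιʰ ⟧ (y ∏.∙ ∏-lc.lc l v t)                   ≈⟨ homo ιʰ y (∏-lc.lc l v t) ⟩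
      ⟦ ιʰ ⟧ y D.∙ ⟦ ιʰ ⟧ (∏-lc.lc l v t)            ≈⟨ D.∙-congˡ (D.trans (ι-lc v) (cong ev v≗z)) ⟩
      ⟦ ιʰ ⟧ y D.∙ ⟦ ev ⟧ z                          ≈⟨ p ⟩
      D.ε                                            ∎)
      where
      open SetoidReasoning D.setoid
      z∈R : A-lc.lc z x A.≈ A.ε
      z∈R = A.trans (A.sym (A.trans (homo πʰ _ _) (A.trans (A.∙-cong (πι y) (π-ev z)) (A.identityˡ _))))
        (A.trans (cong πʰ p) (ε-homo πʰ))
      v = proj₁ (B.complete z∈R)
      v≗z = proj₂ (B.complete z∈R)

    presented : Presented (∏ℤ/ l) M D.abelianGroup
    presented = record { ι = ιʰ ; ev = ev ; t = t ; ι-t = ι-t ; section = section ; kernel = kernel }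

  module _ (em : ExcludedMiddle 0ℓ) {D D′ : TopologicalAbelianGroup} (pro : IsPro l D)
           (E : ExtensionByTorsionClosure (P l) (discrete A) D)
           (E′ : ExtensionByTorsionClosure (P l) (discrete A) D′) where

    private
      module D = TG D
      module D′ = TG D′
      module E = ExtensionByTorsionClosure E
      module E′ = ExtensionByTorsionClosure E′
      module R = Presentation D E
      module R′ = Presentation D′ E′

    module FromTransport (τ : Transport l M R.t R′.t) where

      open Transport τ

      open Pushforward R.presented R′.presented α h transports public using (θ; θ-ι)

      -- An element w of the open kernel of π is some ι y, and θ w = ι′ (α y). If also component i
      -- of w is trivial, then y is small by `kernel-shrinks`, α y is small since α is bounded, and
      -- ι′ is continuous.
      θ-continuous : Continuous D.topology D′.topology (Hom.func θ)
      θ-continuous = locally-continuous⇒continuous D D′ θ λ d {V} oV Vθd →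
        let n , V-below = Cylinder.open⇒cylinder l {s = ∏.ε}
              (ContinuousHomomorphism.continuous E′.ι (translate-open D′ (⟦ θ ⟧ d) oV))
              (Open-resp-≈ D′.topology oV (D′.sym (D′.trans (D′.∙-congˡ (ε-homo R′.ιʰ)) (D′.identityʳ _))) Vθd)
            m , α-below = α-bounded n
            i , ι-below = kernel-shrinks l D pro em E.ι R.ι-injective m
            module Gᵢ = AbelianGroup (InverseSystem.group (proj₁ pro) i)
            c = component l D pro i
        in (λ w → (⟦ c ⟧ w Gᵢ.≈ Gᵢ.ε) × (⟦ R.πʰ ⟧ w A.≈ A.ε)) ,
           Open-∩ D.topology (component-open l D pro i Gᵢ.ε)
             (ContinuousHomomorphism.continuous E.π {λ a → a A.≈ A.ε} (lift λ p q → A.trans (A.sym p) q)) ,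
           (ε-homo c , ε-homo R.πʰ) ,
           λ {w} (cw≈ε , πw≈ε) →
             let y , ιy≈w = R.kernel⇒image πw≈ε
             in Open-resp-≈ D′.topology oV
                  (D′.sym (D′.trans (homo θ d w) (D′.∙-congˡ (D′.trans (cong θ (D.sym ιy≈w)) (θ-ι y)))))
                  (V-below (⟦ α ⟧ y) (α-below y (ι-below y (Gᵢ.trans (cong c ιy≈w) cw≈ε))))

      forward : ContinuousHomomorphism D D′
      forward = continuousHomomorphism D D′ θ θ-continuous

  module _ (em : ExcludedMiddle 0ℓ) {D D′ : TopologicalAbelianGroup} (pro : IsPro l D) (pro′ : IsPro l D′)
           (E : ExtensionByTorsionClosure (P l) (discrete A) D)
           (E′ : ExtensionByTorsionClosure (P l) (discrete A) D′) where

    private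
      module R = Presentation D E
      module R′ = Presentation D′ E′

    module AlongTransport (τ : Transport l M R.t R′.t) where

      private
        τ′ = transport-sym l τ
        module τ = Transport τ
        module τ′ = Transport τ′
        module Θ = FromTransport em pro E E′ τ
        module Θ′ = FromTransport em pro′ E′ E τ′

      isomorphism : D ≅ D′
      isomorphism = record
        { forward  = Θ.forward
        ; backward = Θ′.forward
        ; inverseˡ = pushforward-inverse R′.presented R.presented τ.β τ.α τ′.h τ.h τ′.transports τ.transports
            (λ y z → αβ∙-cancel τ.α τ.β τ.αβ y (⟦ τ.h ⟧ z))
        ; inverseʳ = pushforward-inverse R.presented R′.presented τ.α τ.β τ.h τ′.h τ.transports τ′.transports
            (λ y z → βα∙-cancel τ.α τ.β τ.βα y (⟦ τ.h ⟧ z)) }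

    extensions-isomorphic : D ≅ D′
    extensions-isomorphic = AlongTransport.isomorphism
      (tails-span⇒transport em l (R.tails-span em) (R′.tails-span em))

-- Existence

module Quotient (G : AbelianGroup 0ℓ 0ℓ) (K : Pred (AbelianGroup.Carrier G) 0ℓ)
  (resp : ∀ {x y} → AbelianGroup._≈_ G x y → K x → K y)
  (K-ε : K (AbelianGroup.ε G))
  (K-∙ : ∀ {x y} → K x → K y → K (AbelianGroup._∙_ G x y))
  (K-⁻¹ : ∀ {x} → K x → K (AbelianGroup._⁻¹ G x)) where

  open AbelianGroup G
  open AbelianGroupProperties G
  open CommutativeSemigroupProperties commutativeSemigroup using (interchange)

  private
    ≈⇒K : ∀ {x y} → x ≈ y → K (x - y)
    ≈⇒K x≈y = resp (sym (x≈y⇒x∙y⁻¹≈ε x≈y)) K-ε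

    telescope : ∀ x y z → (x - y) ∙ (y - z) ≈ x - z
    telescope x y z = trans (sym (assoc _ _ _)) (∙-congʳ (//-rightDividesˡ y x))

  quotientGroup : AbelianGroup 0ℓ 0ℓ
  quotientGroup = record
    { Carrier = Carrier
    ; _≈_     = λ x y → K (x - y)
    ; _∙_     = _∙_
    ; ε       = ε
    ; _⁻¹     = _⁻¹
    ; isAbelianGroup = record
      { isGroup = record
        { isMonoid = record
          { isSemigroup = record
            { isMagma = record
              { isEquivalence = record
                { refl  = ≈⇒K refl
                ; sym   = λ {x} {y} p → resp (⁻¹-anti-homo‿- x y) (K-⁻¹ p)
                ; trans = λ {x} {y} {z} p q → resp (telescope x y z) (K-∙ p q) }
              ; ∙-cong = λ {x} {y} {u} {v} p q →
                  resp (trans (interchange _ _ _ _) (∙-congˡ (⁻¹-∙-comm y v))) (K-∙ p q) }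
            ; assoc = λ x y z → ≈⇒K (assoc x y z) }
          ; identity = (λ x → ≈⇒K (identityˡ x)) , (λ x → ≈⇒K (identityʳ x)) }
        ; inverse = (λ x → ≈⇒K (inverseˡ x)) , (λ x → ≈⇒K (inverseʳ x))
        ; ⁻¹-cong = λ {x} {y} p → resp (sym (⁻¹-∙-comm x (y ⁻¹))) (K-⁻¹ p) }
      ; comm = λ x y → ≈⇒K (comm x y) } }

-- Residues and powers of l

residue-≤ : ∀ {m} c c′ → c < m → + m ∣ + c ℤ.- + c′ → c ≤ c′
residue-≤ {m} c c′ c<m p with ℕ.≤-total c c′
... | inj₁ c≤c′ = c≤c′
... | inj₂ c′≤c = ℕ.m∸n≡0⇒m≤n (zero-multiple (c ℕ.∸ c′) (ℕ.≤-<-trans (ℕ.m∸n≤m c c′) c<m)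
  (∣⇒∣ᵤ (subst (+ m ∣_) (≡.trans (ℤ.m-n≡m⊖n c c′) (ℤ.⊖-≥ c′≤c)) p)))
  where
  zero-multiple : ∀ d → d < m → m ℕ∣.∣ d → d ≡ 0
  zero-multiple zero _ _ = ≡.refl
  zero-multiple d@(suc _) d<m m∣d = ⊥-elim (ℕ∣.>⇒∤ d<m m∣d)

residue-unique : ∀ {m c c′} → c < m → c′ < m → + m ∣ + c ℤ.- + c′ → c ≡ c′
residue-unique {m} {c} {c′} c<m c′<m p = ℕ.≤-antisym (residue-≤ c c′ c<m p)
  (residue-≤ c′ c c′<m (subst (+ m ∣_) (flip (+ c) (+ c′)) (∣m⇒∣-m p)))
  where
  flip : ∀ a b → ℤ.- (a ℤ.- b) ≡ b ℤ.- a
  flip = solve-∀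

residue : ∀ m .{{_ : NonZero m}} z → ∃[ c ] + m ∣ + toℕ {m} c ℤ.- z
residue m z = fromℕ< (n%ℕd<d z m) , divides (ℤ.- (z /ℕ m))
  (≡.trans (≡.cong₂ (λ a b → + a ℤ.- b) (Fin.toℕ-fromℕ< (n%ℕd<d z m)) (a≡a%ℕn+[a/ℕn]*n z m))
    (arith (+ (z %ℕ m)) (z /ℕ m) (+ m)))
  where
  arith : ∀ a q d → a ℤ.- (a ℤ.+ q ℤ.* d) ≡ (ℤ.- q) ℤ.* d
  arith = solve-∀

cyclic-cofinal : ∀ n .{{_ : NonZero n}} (j : Fin n) m → ∃[ k ] m ≤ k × k mod n ≡ j
cyclic-cofinal n j m = toℕ j ℕ.+ m ℕ.* n , ℕ.≤-trans (ℕ.m≤m*n m n) (ℕ.m≤n+m (m ℕ.* n) (toℕ j)) ,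
  Fin.toℕ-injective (≡.trans (Fin.toℕ-fromℕ< (m%n<n (toℕ j ℕ.+ m ℕ.* n) n))
    (≡.trans ([m+kn]%n≡m%n (toℕ j) m n) (m<n⇒m%n≡m (Fin.toℕ<n j))))

module _ {l : ℕ} (l-prime : Prime l) where

  private
    instance
      l≢0 : NonZero l
      l≢0 = l-nonZero l-prime

  k<l^k : ∀ k → k < l ^ k
  k<l^k zero = ℕ.z<s
  k<l^k (suc k) = ℕ.≤-<-trans (k<l^k k)
    (ℕ.^-monoʳ-< l (ℕ.nonTrivial⇒n>1 l {{prime⇒nonTrivial l-prime}}) (ℕ.n<1+n k))

  -- One factor l at a time: by Euclid's lemma it divides m, and it is then cancelled from both
  -- sides.
  coprime-cancel : ∀ {x} → ¬ + l ∣ x → ∀ k m → + (l ^ k) ∣ m ℤ.* x → + (l ^ k) ∣ m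
  coprime-cancel l∤x zero m _ = divides m (≡.sym (ℤ.*-identityʳ m))
  coprime-cancel {x} l∤x (suc k) m p
    with euclidsLemma ∣ m ∣ ∣ x ∣ l-prime
           (subst (λ a → l ℕ∣.∣ a) (ℤ.abs-* m x) (ℕ∣.∣-trans (ℕ∣.m∣m*n (l ^ k)) (∣⇒∣ᵤ p)))
  ... | inj₂ l∣x = ⊥-elim (l∤x (∣ᵤ⇒∣ l∣x))
  ... | inj₁ l∣m with ∣ᵤ⇒∣ {+ l} {m} l∣m
  ... | divides q ≡.refl = ≡.subst₂ _∣_ (≡.sym (ℤ.pos-* l (l ^ k))) (ℤ.*-comm (+ l) q)
      (*-monoʳ-∣ (+ l) (coprime-cancel l∤x k q
        (*-cancelˡ-∣ (+ l) (≡.subst₂ _∣_ (ℤ.pos-* l (l ^ k)) (regroup q (+ l) x) p))))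
    where
    regroup : ∀ q l x → q ℤ.* l ℤ.* x ≡ l ℤ.* (q ℤ.* x)
    regroup = solve-∀

-- The extension as an inverse limit of finite groups

module Existence {l : ℕ} (l-prime : Prime l) (A : AbelianGroup 0ℓ 0ℓ) {e : ℕ}
    (enum : Inverse (≡.setoid (Fin (l ^ e))) (AbelianGroup.setoid A))
    (B : Basis (FiniteGroup.Relation A enum)) where

  private
    N = l ^ e
    instance
      l≢0 : NonZero l
      l≢0 = l-nonZero l-prime
      N≢0 : NonZero N
      N≢0 = ℕ.m^n≢0 l e
    module A = AbelianGroup A
    module B = Basis B
    M = B.vectors
    x = Inverse.to enum

    idx : ℕ → Fin N
    idx k = k mod N

    G : AbelianGroup 0ℓ 0ℓ
    G = DirectProduct.abelianGroup (ℤ^ ℕ) (ℤ^ Fin N)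
    module G = AbelianGroup G

    evA : Hom (ℤ^ Fin N) A
    evA = LinearCombination.lcʰ A x

    evM : Hom (ℤ^ Fin N) (ℤ^ Fin N)
    evM = ℤ^-lc.lcʰ M

    -- The relations (- Σ vⱼ tⱼ , Σ vⱼ Mⱼ), where tⱼ(k) is 1 if j = `idx k` and 0 otherwise, so that
    -- Σ vⱼ tⱼ(k) = `v (idx k)`. Only places k < n count: `level n` is an extension of A by the
    -- product of the ℤ/lᵏ with k < n, and all transition maps are the identity on representatives.
    K : ℕ → G.Carrier → Set
    K n (s , z) = ∃[ v ] (∀ i → ⟦ evM ⟧ v i ≡ z i) × (∀ k → k < n → + (l ^ k) ∣ s k ℤ.+ v (idx k))

    K-resp : ∀ n {g g′} → g G.≈ g′ → K n g → K n g′
    K-resp n (s≗s′ , z≗z′) (v , p , q) = v , (λ i → ≡.trans (p i) (z≗z′ i)) , λ k k<n →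
      subst (λ a → + (l ^ k) ∣ a ℤ.+ v (idx k)) (s≗s′ k) (q k k<n)

    K-ε : ∀ n → K n G.ε
    K-ε n = (λ _ → ℤ.0ℤ) , ε-homo evM , λ k _ → divides ℤ.0ℤ ≡.refl

    K-∙ : ∀ n {g g′} → K n g → K n g′ → K n (g G.∙ g′)
    K-∙ n {s , _} {s′ , _} (v , p , q) (v′ , p′ , q′) = (λ j → v j ℤ.+ v′ j) ,
      (λ i → ≡.trans (homo evM v v′ i) (≡.cong₂ ℤ._+_ (p i) (p′ i))) , λ k k<n →
      subst (+ (l ^ k) ∣_) (interchange (s k) (v (idx k)) (s′ k) (v′ (idx k))) (∣m∣n⇒∣m+n (q k k<n) (q′ k k<n))
      where
      interchange : ∀ a b c d → (a ℤ.+ b) ℤ.+ (c ℤ.+ d) ≡ (a ℤ.+ c) ℤ.+ (b ℤ.+ d)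
      interchange = solve-∀

    K-⁻¹ : ∀ n {g} → K n g → K n (g G.⁻¹)
    K-⁻¹ n {s , _} (v , p , q) = (λ j → ℤ.- v j) ,
      (λ i → ≡.trans (Hom.⁻¹-homo evM v i) (≡.cong ℤ.-_ (p i))) , λ k k<n →
      subst (+ (l ^ k) ∣_) (ℤ.neg-distrib-+ (s k) (v (idx k))) (∣m⇒∣-m (q k k<n))

    K-antitone : ∀ {m n g} → m ≤ n → K n g → K m g
    K-antitone m≤n (v , p , q) = v , p , λ k k<m → q k (ℕ.<-≤-trans k<m m≤n)

    evA-evM : ∀ v → ⟦ evA ⟧ (⟦ evM ⟧ v) A.≈ A.ε
    evA-evM v = A.trans (lc-homo evA v M) (LinearCombination.lc-ε A v B.member)

    K⇒≈ : ∀ {n} g g′ → K n (g G.- g′) → ⟦ evA ⟧ (proj₂ g) A.≈ ⟦ evA ⟧ (proj₂ g′)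
    K⇒≈ g g′ (v , p , _) = AbelianGroupProperties.x∙y⁻¹≈ε⇒x≈y A _ _
      (A.trans (A.sym (Hom.-‿homo evA (proj₂ g) (proj₂ g′)))
        (A.trans (cong evA (λ i → ≡.sym (p i))) (evA-evM v)))

    ≈⇒K₀ : ∀ g g′ → ⟦ evA ⟧ (proj₂ g) A.≈ ⟦ evA ⟧ (proj₂ g′) → K 0 (g G.- g′)
    ≈⇒K₀ g g′ p = let v , q = B.complete (A.trans (Hom.-‿homo evA (proj₂ g) (proj₂ g′))
                                          (AbelianGroupProperties.x≈y⇒x∙y⁻¹≈ε A p))
                  in v , q , λ _ ()

    K-divides : ∀ {n} g → (∀ i → proj₂ g i ≡ ℤ.0ℤ) → K n g → ∀ k → k < n → + (l ^ k) ∣ proj₁ g k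
    K-divides (s , z) z≡0 (v , p , q) k k<n = subst (+ (l ^ k) ∣_)
      (≡.trans (≡.cong (ℤ._+_ (s k)) (B.independent v (λ i → ≡.trans (p i) (z≡0 i)) (idx k))) (ℤ.+-identityʳ (s k)))
      (q k k<n)

    divides⇒K : ∀ {n} s → (∀ k → k < n → + (l ^ k) ∣ s k) → K n (s , λ _ → ℤ.0ℤ)
    divides⇒K s p = (λ _ → ℤ.0ℤ) , ε-homo evM , λ k k<n →
      subst (+ (l ^ k) ∣_) (≡.sym (ℤ.+-identityʳ (s k))) (p k k<n)

    level : ℕ → AbelianGroup 0ℓ 0ℓ
    level n = Quotient.quotientGroup G (K n) (K-resp n) (K-ε n) (λ {g} {g′} → K-∙ n {g} {g′}) (λ {g} → K-⁻¹ n {g})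
    module level n = AbelianGroup (level n)

    -- No place is below 0, so `K 0` only asks that z be a relation, and level 0 is A.
    level-zero-finite : Inverse (≡.setoid (Fin N)) (level.setoid 0)
    level-zero-finite = Bijection⇒Inverse (record
      { to        = to
      ; cong      = λ { {i} ≡.refl → level.refl 0 {to i} }
      ; bijective = (λ {i} {j} p → injective i j p) ,
          λ g → index g , λ {i} i≡ → subst (λ i → K 0 (to i G.- g)) (≡.sym i≡) (≈⇒K₀ (to (index g)) g
            (A.trans (LinearCombination.lc-δ A (index g) x) (Inverse.strictlyInverseˡ enum _))) })
      where
      to : Fin N → G.Carrier
      to i = (λ _ → ℤ.0ℤ) , δ i

      index : G.Carrier → Fin N
      index (_ , z) = Inverse.from enum (⟦ evA ⟧ z)

      injective : ∀ i j → K 0 (to i G.- to j) → i ≡ j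
      injective i j p = ≡.trans (≡.sym (Inverse.strictlyInverseʳ enum i)) (≡.trans
        (Inverse.from-cong enum (A.trans (A.sym (LinearCombination.lc-δ A i x))
          (A.trans (K⇒≈ {0} (to i) (to j) p) (LinearCombination.lc-δ A j x))))
        (Inverse.strictlyInverseʳ enum j))

    module NextLevel (n : ℕ) {a : ℕ} (previous : Inverse (≡.setoid (Fin a)) (level.setoid n)) where

      instance
        l^n≢0 : NonZero (l ^ n)
        l^n≢0 = ℕ.m^n≢0 l n

      open Cylinder l using (override; override-below; override-above)
      module previous = Inverse previous

      0s : ℕ → ℤ
      0s _ = ℤ.0ℤ

      -- The constant `c` is added at all places from n on, of which `K (suc n)` sees place n alone.
      extend : Fin (l ^ n) → G.Carrier → G.Carrier
      extend c (s , z) = (λ k → s k ℤ.+ override n 0s (+ toℕ c) k) , z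

      extend-injective : ∀ c j c′ j′ → K (suc n) (extend c (previous.to j) G.- extend c′ (previous.to j′)) →
                         (c , j) ≡ (c′ , j′)
      extend-injective c j c′ j′ p = finish c′ j≡j′ p
        where
        forget : K (suc n) (extend c (previous.to j) G.- extend c′ (previous.to j′)) →
                 K n (previous.to j G.- previous.to j′)
        forget (v , q , r) = v , q , λ k k<n → subst (λ b → + (l ^ k) ∣ b ℤ.+ v (idx k))
          (≡.cong₂ (λ b b′ → b ℤ.- b′) (unchanged c (proj₁ (previous.to j) k) k<n)
            (unchanged c′ (proj₁ (previous.to j′) k) k<n))
          (r k (ℕ.m<n⇒m<1+n k<n))
          where
          unchanged : ∀ c s {k} → k < n → s ℤ.+ override n 0s (+ toℕ c) k ≡ s
          unchanged c s k<n = ≡.trans (≡.cong (ℤ._+_ s) (override-below 0s (+ toℕ c) k<n)) (ℤ.+-identityʳ s)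

        j≡j′ : j ≡ j′
        j≡j′ = ≡.trans (≡.sym (previous.strictlyInverseʳ j))
          (≡.trans (previous.from-cong (forget p)) (previous.strictlyInverseʳ j′))

        cancel : ∀ s c c′ → (s ℤ.+ c) ℤ.- (s ℤ.+ c′) ≡ c ℤ.- c′
        cancel = solve-∀

        -- Once j = j′ the ℤᴺ-part of the difference is 0. Independence makes its coefficients 0,
        -- and place n compares c with c′.
        finish : ∀ c′ {j′} → j ≡ j′ → K (suc n) (extend c (previous.to j) G.- extend c′ (previous.to j′)) →
                 (c , j) ≡ (c′ , j′)
        finish c′ ≡.refl p = ≡.cong (_, j) (Fin.toℕ-injective (residue-unique (Fin.toℕ<n c) (Fin.toℕ<n c′)
          (subst (+ (l ^ n) ∣_)
            (≡.trans (cancel (proj₁ (previous.to j) n) (override n 0s (+ toℕ c) n) (override n 0s (+ toℕ c′) n))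
              (≡.cong₂ (λ b b′ → b ℤ.- b′) (override-above 0s (+ toℕ c) (ℕ.≤-refl {n}))
                (override-above 0s (+ toℕ c′) (ℕ.≤-refl {n}))))
            (K-divides (extend c (previous.to j) G.- extend c′ (previous.to j))
              (λ i → ℤ.+-inverseʳ (proj₂ (previous.to j) i)) p n ℕ.≤-refl))))

      extend-surjective : ∀ g → ∃[ c ] ∃[ j ] K (suc n) (extend c (previous.to j) G.- g)
      extend-surjective g@(s , z) = c , j , v , p , q′
        where
        j = previous.from g
        u = proj₁ (previous.to j)
        v = proj₁ (previous.strictlyInverseˡ g)
        p = proj₁ (proj₂ (previous.strictlyInverseˡ g))
        q = proj₂ (proj₂ (previous.strictlyInverseˡ g))
        -- The value at place n that fulfils the new condition with the coefficients v found at
        -- level n.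
        target = ℤ.- ((u n ℤ.- s n) ℤ.+ v (idx n))
        c = proj₁ (residue (l ^ n) target)

        arith : ∀ c u s v → c ℤ.- (ℤ.- ((u ℤ.- s) ℤ.+ v)) ≡ ((u ℤ.+ c) ℤ.- s) ℤ.+ v
        arith = solve-∀
        arith₀ : ∀ u s v → (u ℤ.- s) ℤ.+ v ≡ ((u ℤ.+ ℤ.0ℤ) ℤ.- s) ℤ.+ v
        arith₀ = solve-∀

        q′ : ∀ k → k < suc n → + (l ^ k) ∣ ((u k ℤ.+ override n 0s (+ toℕ c) k) ℤ.- s k) ℤ.+ v (idx k)
        q′ k k<1+n with ℕ.m<1+n⇒m<n∨m≡n k<1+n
        ... | inj₁ k<n = subst (+ (l ^ k) ∣_)
          (≡.trans (arith₀ (u k) (s k) (v (idx k)))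
            (≡.cong (λ b → ((u k ℤ.+ b) ℤ.- s k) ℤ.+ v (idx k)) (≡.sym (override-below 0s (+ toℕ c) k<n))))
          (q k k<n)
        ... | inj₂ ≡.refl = subst (+ (l ^ n) ∣_)
          (≡.trans (arith (+ toℕ c) (u n) (s n) (v (idx n)))
            (≡.cong (λ b → ((u n ℤ.+ b) ℤ.- s n) ℤ.+ v (idx n)) (≡.sym (override-above 0s (+ toℕ c) (ℕ.≤-refl {n})))))
          (proj₂ (residue (l ^ n) target))

      enumeration : Inverse (≡.setoid (Fin (l ^ n ℕ.* a))) (level.setoid (suc n))
      enumeration = Bijection⇒Inverse (record
        { to        = to
        ; cong      = λ { {i} ≡.refl → level.refl (suc n) {to i} }
        ; bijective = (λ {i} {i′} p → injective i i′ p) , λ g → let c , j , p = extend-surjective g in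
            combine c j , λ { ≡.refl →
              subst (λ (c , j) → K (suc n) (extend c (previous.to j) G.- g)) (≡.sym (Fin.remQuot-combine c j)) p } })
        where
        to : Fin (l ^ n ℕ.* a) → G.Carrier
        to i = let c , j = remQuot {l ^ n} a i in extend c (previous.to j)

        injective : ∀ i i′ → K (suc n) (to i G.- to i′) → i ≡ i′
        injective i i′ p = ≡.trans (≡.sym (Fin.combine-remQuot {l ^ n} a i)) (≡.trans
          (≡.cong (uncurry combine) (extend-injective (proj₁ (remQuot {l ^ n} a i)) (proj₂ (remQuot {l ^ n} a i))
            (proj₁ (remQuot {l ^ n} a i′)) (proj₂ (remQuot {l ^ n} a i′)) p))
          (Fin.combine-remQuot {l ^ n} a i′))

    level-finite : ∀ n → IsFiniteGroupOfPowerOrder l (level n)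
    level-finite zero = e , level-zero-finite
    level-finite (suc n) = let a , previous = level-finite n in n ℕ.+ a ,
      subst (λ m → Inverse (≡.setoid (Fin m)) (level.setoid (suc n))) (≡.sym (ℕ.^-distribˡ-+-* l n a))
        (NextLevel.enumeration n previous)

    system : InverseSystem
    system = record
      { index    = ℕ.≤-poset
      ; nonempty = 0
      ; directed = λ i j → i ⊔ j , ℕ.m≤m⊔n i j , ℕ.m≤n⊔m i j
      ; group    = level
      ; φ        = λ i≤j → Hom.func (transition i≤j)
      ; φ-homo   = λ i≤j → Hom.isGroupHomomorphism (transition i≤j)
      ; φ-id     = λ {i} _ g → level.refl i {g}
      ; φ-∘      = λ {i} _ _ _ g → level.refl i {g} }
      where
      transition : ∀ {i j} → i ≤ j → Hom (level j) (level i)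
      transition {i} i≤j = mkHom (λ g → g) (λ {g} {g′} → K-antitone {g = g G.- g′} i≤j)
        (λ g g′ → level.refl i {g G.∙ g′})

  D : TopologicalAbelianGroup
  D = inverseLimit system

  isPro : IsPro l D
  isPro = system , level-finite , record
    { forward = identity ; backward = identity
    ; inverseˡ = λ d → TG.refl D {d} ; inverseʳ = λ d → TG.refl D {d} }
    where
    identity : ContinuousHomomorphism D D
    identity = continuousHomomorphism D D (idʰ {TG.abelianGroup D}) (λ o → o)

  private
    module D = TG D
    module ∏ = AbelianGroup (∏ℤ/ l)
    module A-lc = LinearCombination A
    module A′ = AbelianGroupProperties A

    ιʰ : Hom (∏ℤ/ l) D.abelianGroup
    ιʰ = mkHom (λ y → (λ n → y , λ _ → ℤ.0ℤ) , λ {i} _ → level.refl i {y , λ _ → ℤ.0ℤ})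
      (λ {y} {y′} p n → divides⇒K (λ k → y k ℤ.- y′ k) (λ k _ → p k))
      (λ y y′ n → level.refl n {(λ k → y k ℤ.+ y′ k) , λ _ → ℤ.0ℤ})

    πʰ : Hom D.abelianGroup A
    πʰ = mkHom (λ (g , _) → ⟦ evA ⟧ (proj₂ (g 0)))
      (λ {(g , _)} {(g′ , _)} p → K⇒≈ {0} (g 0) (g′ 0) (p 0))
      (λ (g , _) (g′ , _) → homo evA (proj₂ (g 0)) (proj₂ (g′ 0)))

    component-z : ∀ ((g , _) : D.Carrier) n → ⟦ evA ⟧ (proj₂ (g n)) A.≈ ⟦ evA ⟧ (proj₂ (g 0))
    component-z (g , compatible) n = K⇒≈ {0} (g n) (g 0) (compatible {0} {n} ℕ.z≤n)

  ι : ContinuousHomomorphism (P l) D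
  ι = continuousHomomorphism (P l) D ιʰ (continuous-into-initial _ _ (TG.topology (P l)) (Hom.func ιʰ)
    λ n (lift r) → cylindrical-open n λ {s} {t} t≈s → r (divides⇒K (λ k → s k ℤ.- t k) (agree-sym t s t≈s)))
    where open Cylinder l

  π : ContinuousHomomorphism D (discrete A)
  π = continuousHomomorphism D (discrete A) πʰ λ {V} (lift r) →
    preimage 0 {λ (_ , z) → V (⟦ evA ⟧ z)} (lift λ {g} {g′} p → r (K⇒≈ {0} g g′ p))

  private
    module πᶜ = ContinuousHomomorphism π

    ι-injective : ∀ {y y′} → ⟦ ιʰ ⟧ y D.≈ ⟦ ιʰ ⟧ y′ → y ∏.≈ y′
    ι-injective {y} {y′} p k = K-divides ((λ k → y k ℤ.- y′ k) , λ _ → ℤ.0ℤ) (λ _ → ≡.refl) (p (suc k)) k ℕ.≤-refl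

    kernel⇒image : ∀ d → ⟦ πʰ ⟧ d A.≈ A.ε → ∃[ y ] ⟦ ιʰ ⟧ y D.≈ d
    kernel⇒image d@(g , compatible) πd≈ε = y , λ n → (λ j → ℤ.- v n j) ,
      (λ i → ≡.trans (Hom.⁻¹-homo evM (v n) i) (≡.trans (≡.cong ℤ.-_ (evM-v n i)) (≡.sym (ℤ.+-identityˡ _)))) ,
      λ k k<n → subst (+ (l ^ k) ∣_)
        (≡.trans (≡.cong (λ w → ℤ.- (s n k ℤ.- s (suc k) k ℤ.+ w)) (w≡ n k k<n))
          (arith (s n k) (s (suc k) k) (v n (idx k)) (v (suc k) (idx k))))
        (∣m⇒∣-m (proj₂ (proj₂ (difference n k k<n)) k ℕ.≤-refl))
      where
      s : ℕ → ℕ → ℤ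
      s n = proj₁ (g n)

      relation : ∀ n → ⟦ evA ⟧ (proj₂ (g n)) A.≈ A.ε
      relation n = A.trans (component-z d n) πd≈ε

      v : ℕ → Fin N → ℤ
      v n = proj₁ (B.complete (relation n))

      evM-v : ∀ n i → ⟦ evM ⟧ (v n) i ≡ proj₂ (g n) i
      evM-v n = proj₂ (B.complete (relation n))

      -- Level `suc k` is the first that sees place k. Subtracting from its representative the
      -- relation with coefficients v clears the ℤᴺ-part and adds `v (idx k)` to place k.
      y : ℕ → ℤ
      y k = s (suc k) k ℤ.+ v (suc k) (idx k)

      difference : ∀ n k → k < n → K (suc k) (g n G.- g (suc k))
      difference n k k<n = compatible {suc k} {n} k<n

      w≡ : ∀ n k (k<n : k < n) → proj₁ (difference n k k<n) (idx k) ≡ v n (idx k) ℤ.- v (suc k) (idx k)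
      w≡ n k k<n = B.unique {v = proj₁ (difference n k k<n)} {w = λ j → v n j ℤ.- v (suc k) j}
        (λ i → ≡.trans (proj₁ (proj₂ (difference n k k<n)) i)
        (≡.sym (≡.trans (Hom.-‿homo evM (v n) (v (suc k)) i)
          (≡.cong₂ (λ a b → a ℤ.- b) (evM-v n i) (evM-v (suc k) i))))) (idx k)

      arith : ∀ s s′ v v′ → ℤ.- (s ℤ.- s′ ℤ.+ (v ℤ.- v′)) ≡ (s′ ℤ.+ v′) ℤ.- s ℤ.+ ℤ.- v
      arith = solve-∀

    πι : ∀ y → ⟦ πʰ ⟧ (⟦ ιʰ ⟧ y) A.≈ A.ε
    πι y = ε-homo evA

    image⇒kernel : ∀ {d} → ∃[ y ] ⟦ ιʰ ⟧ y D.≈ d → ⟦ πʰ ⟧ d A.≈ A.ε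
    image⇒kernel {d} (y , ιy≈d) = A.trans (A.sym (cong πʰ {⟦ ιʰ ⟧ y} {d} ιy≈d)) (πι y)

    isShortExact : IsShortExact ι π
    isShortExact = record
      { injective  = λ {y} {y′} → ι-injective {y} {y′}
      ; exact      = (λ {d} → image⇒kernel {d}) , (λ {d} → kernel⇒image d)
      ; surjective = λ a → generator (Inverse.from enum a) , λ {d} p →
          A.trans (cong πʰ {d} {generator (Inverse.from enum a)} p)
            (A.trans (A-lc.lc-δ (Inverse.from enum a) x) (Inverse.strictlyInverseˡ enum a)) }
      where
      generator : Fin N → D.Carrier
      generator i = (λ _ → (λ _ → ℤ.0ℤ) , δ i) , λ {n} _ → level.refl n {(λ _ → ℤ.0ℤ) , δ i}

    -- Torsion of D and its closure

    module D-lc = LinearCombination D.abelianGroup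

    projectionʰ : ∀ n → Hom D.abelianGroup (level n)
    projectionʰ n = mkHom (λ (g , _) → g n) (λ p → p n) (λ (g , _) (g′ , _) → level.refl n {g n G.∙ g′ n})

    quotientʰ : ∀ n → Hom G (level n)
    quotientʰ n = mkHom (λ g → g)
      (λ {g} {g′} p → K-resp n (G.sym {g G.- g′} {G.ε} (AbelianGroupProperties.x≈y⇒x∙y⁻¹≈ε G {g} {g′} p)) (K-ε n))
      (λ g g′ → level.refl n {g G.∙ g′})

    scale : ℤ → G.Carrier → G.Carrier
    scale m (s , z) = (λ k → m ℤ.* s k) , λ i → m ℤ.* z i

    level-· : ∀ n m g → level._≈_ n (LinearCombination._·_ (level n) m g) (scale m g)
    level-· n m g = level.trans n {LinearCombination._·_ (level n) m g} {LinearCombination._·_ G m g} {scale m g}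
      (level.sym n {LinearCombination._·_ G m g} {LinearCombination._·_ (level n) m g} (·-homo (quotientʰ n) m g))
      (cong (quotientʰ n) {LinearCombination._·_ G m g} {scale m g}
        ( (λ k → ≡.trans (·-homo (fst-k k) m g) (·≡* m (proj₁ g k)))
        , (λ i → ≡.trans (·-homo (snd-i i) m g) (·≡* m (proj₂ g i)))))
      where
      fst-k : ∀ k → Hom G ℤ⁺
      fst-k k = mkHom (λ g → proj₁ g k) (λ p → proj₁ p k) (λ _ _ → ≡.refl)
      snd-i : ∀ i → Hom G ℤ⁺
      snd-i i = mkHom (λ g → proj₂ g i) (λ p → proj₂ p i) (λ _ _ → ≡.refl)

    multiple-killed : ∀ m (d : D.Carrier) → (+ m) D-lc.· d D.≈ D.ε → ∀ n → K n (scale (+ m) (proj₁ d n))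
    multiple-killed m d@(g , _) p n = K-resp n (G.identityʳ (scale (+ m) (g n))) (level.trans n
      {scale (+ m) (g n)} {proj₁ ((+ m) D-lc.· d) n} {G.ε}
      (level.trans n {scale (+ m) (g n)} {LinearCombination._·_ (level n) (+ m) (g n)} {proj₁ ((+ m) D-lc.· d) n}
        (level.sym n {LinearCombination._·_ (level n) (+ m) (g n)} {scale (+ m) (g n)} (level-· n (+ m) (g n)))
        (level.sym n {proj₁ ((+ m) D-lc.· d) n} {LinearCombination._·_ (level n) (+ m) (g n)} (·-homo (projectionʰ n) (+ m) d)))
      (p n))

    evM-* : ∀ a w i → ⟦ evM ⟧ (λ j → a ℤ.* w j) i ≡ a ℤ.* ⟦ evM ⟧ w i
    evM-* a w i = ≡.trans (lc-* (ℤ^ Fin N) a w M i) (ℤ^·-lookup a (⟦ evM ⟧ w) i)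

    -- If l z⁰ = Σ vⱼ Mⱼ with l ∤ vⱼ, then at the infinitely many levels k with index j the
    -- element l d has a unit as its k-th coordinate, so its order is at least lᵏ.
    torsion-socle : ∀ m .{{_ : NonZero m}} d → (+ m) D-lc.· d D.≈ D.ε →
                    (+ l) A-lc.· ⟦ πʰ ⟧ d A.≈ A.ε → ⟦ πʰ ⟧ d A.≈ A.ε
    torsion-socle m d@(g , _) md≈ε lπd≈ε = A.trans (cong evA (λ i → ≡.sym (evM-q i))) (evA-evM q)
      where
      z : ℕ → Fin N → ℤ
      z n = proj₂ (g n)

      lz₀ = B.complete (A.trans (lc-* A (+ l) (z 0) x) lπd≈ε)
      v = proj₁ lz₀

      module _ (j : Fin N) (l∤vⱼ : ¬ + l ∣ v j) (k : ℕ) (m≤k : m ≤ k) (idx-k : idx k ≡ j) where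

        killed = multiple-killed m d md≈ε (suc k)
        u = proj₁ killed
        shift = B.complete (A.trans (Hom.-‿homo evA (z (suc k)) (z 0)) (A′.x≈y⇒x∙y⁻¹≈ε (component-z d (suc k))))
        w = proj₁ shift
        sₖ = proj₁ (g (suc k)) k

        arith₁ : ∀ l m z z₀ → l ℤ.* (m ℤ.* z) ≡ m ℤ.* (l ℤ.* z₀) ℤ.+ (l ℤ.* m) ℤ.* (z ℤ.- z₀)
        arith₁ = solve-∀

        -- Writing M u for Σ uⱼ Mⱼ, one has M u = m z(k+1), M v = l z(0) and M w = z(k+1) - z(0).
        -- Both sides are therefore the coefficients of l m z(k+1).
        lu≡ : ∀ i → + l ℤ.* u i ≡ + m ℤ.* v i ℤ.+ (+ l ℤ.* + m) ℤ.* w i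
        lu≡ = B.unique λ i → begin
          ⟦ evM ⟧ (λ j → + l ℤ.* u j) i                          ≡⟨ evM-* (+ l) u i ⟩
          + l ℤ.* ⟦ evM ⟧ u i                                    ≡⟨ ≡.cong (ℤ._*_ (+ l)) (proj₁ (proj₂ killed) i) ⟩
          + l ℤ.* (+ m ℤ.* z (suc k) i)                          ≡⟨ arith₁ (+ l) (+ m) (z (suc k) i) (z 0 i) ⟩
          + m ℤ.* (+ l ℤ.* z 0 i) ℤ.+ (+ l ℤ.* + m) ℤ.* (z (suc k) i ℤ.- z 0 i)
            ≡⟨ ≡.cong₂ (λ a b → + m ℤ.* a ℤ.+ (+ l ℤ.* + m) ℤ.* b) (proj₂ lz₀ i) (proj₂ shift i) ⟨
          + m ℤ.* ⟦ evM ⟧ v i ℤ.+ (+ l ℤ.* + m) ℤ.* ⟦ evM ⟧ w i  ≡⟨ ≡.cong₂ ℤ._+_ (evM-* (+ m) v i) (evM-* (+ l ℤ.* + m) w i) ⟨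
          ⟦ evM ⟧ (λ j → + m ℤ.* v j) i ℤ.+ ⟦ evM ⟧ (λ j → (+ l ℤ.* + m) ℤ.* w j) i
            ≡⟨ homo evM (λ j → + m ℤ.* v j) (λ j → (+ l ℤ.* + m) ℤ.* w j) i ⟨
          ⟦ evM ⟧ (λ j → + m ℤ.* v j ℤ.+ (+ l ℤ.* + m) ℤ.* w j) i ∎
          where open ≡.≡-Reasoning

        -- By `lu≡`, l times the number m sₖ + u j, which lᵏ divides, is m times `unit`; and `unit`
        -- is v j modulo l.
        unit = v j ℤ.+ + l ℤ.* (sₖ ℤ.+ w j)

        l∤unit : ¬ + l ∣ unit
        l∤unit p = l∤vⱼ (∣m+n∣n⇒∣m p (∣m⇒∣m*n (sₖ ℤ.+ w j) ∣-refl))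

        arith₂ : ∀ l m s u → l ℤ.* (m ℤ.* s ℤ.+ u) ≡ l ℤ.* m ℤ.* s ℤ.+ l ℤ.* u
        arith₂ = solve-∀
        arith₃ : ∀ l m s v w → l ℤ.* m ℤ.* s ℤ.+ (m ℤ.* v ℤ.+ (l ℤ.* m) ℤ.* w) ≡ m ℤ.* (v ℤ.+ l ℤ.* (s ℤ.+ w))
        arith₃ = solve-∀

        lᵏ∣m·unit : + (l ^ k) ∣ + m ℤ.* unit
        lᵏ∣m·unit = subst (+ (l ^ k) ∣_)
          (≡.trans (arith₂ (+ l) (+ m) sₖ (u j)) (≡.trans (≡.cong (ℤ._+_ (+ l ℤ.* + m ℤ.* sₖ)) (lu≡ j))
            (arith₃ (+ l) (+ m) sₖ (v j) (w j))))
          (∣n⇒∣m*n (+ l) (subst (λ i → + (l ^ k) ∣ + m ℤ.* sₖ ℤ.+ u i) idx-k (proj₂ (proj₂ killed) k ℕ.≤-refl)))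

        absurd : ⊥
        absurd = ℕ.<⇒≱ (ℕ.≤-<-trans m≤k (k<l^k l-prime k))
          (ℕ∣.∣⇒≤ (∣⇒∣ᵤ (coprime-cancel l-prime l∤unit k (+ m) lᵏ∣m·unit)))

      l∣v : ∀ j → + l ∣ v j
      l∣v j with + l ∣? v j
      ... | yes p = p
      ... | no l∤vⱼ = let k , m≤k , idx-k = cyclic-cofinal N j m in ⊥-elim (absurd j l∤vⱼ k m≤k idx-k)

      q : Fin N → ℤ
      q j = quotient (l∣v j)

      evM-q : ∀ i → ⟦ evM ⟧ q i ≡ z 0 i
      evM-q i = ℤ.*-cancelˡ-≡ (+ l) _ _ (≡.trans (≡.sym (evM-* (+ l) q i)) (≡.trans
        (cong evM (λ j → ≡.trans (ℤ.*-comm (+ l) (q j)) (≡.sym (equality (l∣v j)))) i) (proj₂ lz₀ i)))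

    -- Induction on the exponent a: l d is torsion and lᵃ⁻¹ kills its image, so π (l d) is trivial
    -- and `torsion-socle` applies to d.
    torsion⇒kernel : ∀ a m .{{_ : NonZero m}} d → (+ m) D-lc.· d D.≈ D.ε →
                     (+ (l ^ a)) A-lc.· ⟦ πʰ ⟧ d A.≈ A.ε → ⟦ πʰ ⟧ d A.≈ A.ε
    torsion⇒kernel zero m d _ p = A.trans (A.sym (A.identityʳ _)) p
    torsion⇒kernel (suc a) m d md≈ε p = torsion-socle m d md≈ε (A.trans (A.sym (·-homo πʰ (+ l) d))
      (torsion⇒kernel a m ((+ l) D-lc.· d)
        (λ n → D.trans {(+ m) D-lc.· (+ l) D-lc.· d} {(+ l) D-lc.· (+ m) D-lc.· d} {D.ε}
          (D.trans {(+ m) D-lc.· (+ l) D-lc.· d} {(+ (m ℕ.* l)) D-lc.· d} {(+ l) D-lc.· (+ m) D-lc.· d}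
            (×D.×-assocˡ d m l)
            (D.trans {(+ (m ℕ.* l)) D-lc.· d} {(+ (l ℕ.* m)) D-lc.· d} {(+ l) D-lc.· (+ m) D-lc.· d}
              (D.reflexive (≡.cong (λ b → (+ b) D-lc.· d) (ℕ.*-comm m l)))
              (D.sym {(+ l) D-lc.· (+ m) D-lc.· d} {(+ (l ℕ.* m)) D-lc.· d} (×D.×-assocˡ d l m))))
          (D.trans {(+ l) D-lc.· (+ m) D-lc.· d} {(+ l) D-lc.· D.ε} {D.ε}
            (D-lc.·-congˡ (+ l) {(+ m) D-lc.· d} {D.ε} md≈ε) (D-lc.·-ε (+ l))) n)
        (A.trans (A-lc.·-congˡ (+ (l ^ a)) (·-homo πʰ (+ l) d))
          (A.trans (×A.×-assocˡ (⟦ πʰ ⟧ d) (l ^ a) l)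
            (A.trans (A.reflexive (≡.cong (λ b → (+ b) A-lc.· ⟦ πʰ ⟧ d) (ℕ.*-comm (l ^ a) l))) p)))))
      where
      module ×D = Mult D.commutativeMonoid
      module ×A = Mult A.commutativeMonoid

    torsion⊆kernel : ∀ {d} → torsion D d → ⟦ πʰ ⟧ d A.≈ A.ε
    torsion⊆kernel {d} (m , nz , md≈ε) =
      torsion⇒kernel e m {{nz}} d md≈ε (FiniteGroup.order-annihilates A enum (⟦ πʰ ⟧ d))

    truncation-torsion : ∀ n y → torsion D (⟦ ιʰ ⟧ (Cylinder.override l n y ℤ.0ℤ))
    truncation-torsion n y = l ^ n , ℕ.m^n≢0 l n ,
      D.trans {(+ (l ^ n)) D-lc.· ⟦ ιʰ ⟧ y′} {⟦ ιʰ ⟧ (∏-lc._·_ l (+ (l ^ n)) y′)} {D.ε}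
        (D.sym {⟦ ιʰ ⟧ (∏-lc._·_ l (+ (l ^ n)) y′)} {(+ (l ^ n)) D-lc.· ⟦ ιʰ ⟧ y′} (·-homo ιʰ (+ (l ^ n)) y′))
        (cong ιʰ {∏-lc._·_ l (+ (l ^ n)) y′} {∏.ε}
          (∏.trans {∏-lc._·_ l (+ (l ^ n)) y′} {λ k → + (l ^ n) ℤ.* y′ k} {∏.ε} (∏·-lookup l (+ (l ^ n)) y′) killed))
      where
      open Cylinder l
      y′ = override n y ℤ.0ℤ
      killed : ∀ k → + (l ^ k) ∣ + (l ^ n) ℤ.* y′ k ℤ.- ℤ.0ℤ
      killed k = subst (+ (l ^ k) ∣_) (≡.sym (ℤ.+-identityʳ _)) (case (ℕ.<-≤-connex k n))
        where
        case : k < n ⊎ n ≤ k → + (l ^ k) ∣ + (l ^ n) ℤ.* y′ k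
        case (inj₁ k<n) = ∣m⇒∣m*n (y′ k) (^-mono-∣ l (ℕ.<⇒≤ k<n))
        case (inj₂ n≤k) = divides ℤ.0ℤ (≡.trans (≡.cong (ℤ._*_ (+ (l ^ n))) (override-above y ℤ.0ℤ n≤k))
                                               (ℤ.*-zeroʳ (+ (l ^ n))))

    -- The fibre of π through d is open, A being discrete, so it contains a torsion element, and
    -- those lie in the kernel of π.
    closure⊆image : ∀ {d} → closure D.topology (torsion D) d → ∃[ y ] ⟦ ιʰ ⟧ y D.≈ d
    closure⊆image {d} d∈closure = kernel⇒image d (A.trans (A.sym (proj₁ (proj₂ near))) (torsion⊆kernel (proj₂ (proj₂ near))))
      where
      near = d∈closure {λ d′ → ⟦ πʰ ⟧ d′ A.≈ ⟦ πʰ ⟧ d}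
        (πᶜ.continuous {λ a → a A.≈ ⟦ πʰ ⟧ d} (lift λ p q → A.trans (A.sym p) q)) A.refl

    -- An element of P is the limit of its truncations, which are torsion: lⁿ kills the places below
    -- n, and the others are 0.
    image⊆closure : ∀ {d} → ∃[ y ] ⟦ ιʰ ⟧ y D.≈ d → closure D.topology (torsion D) d
    image⊆closure {d} (y , ιy≈d) {V} oV Vd =
      let n , V-near = open⇒cylinder {s = y} (ContinuousHomomorphism.continuous ι oV)
                         (Open-resp-≈ D.topology oV (D.sym {⟦ ιʰ ⟧ y} {d} ιy≈d) Vd)
      in ⟦ ιʰ ⟧ (override n y ℤ.0ℤ) , V-near (override n y ℤ.0ℤ) (override-agree n y ℤ.0ℤ) , truncation-torsion n y
      where open Cylinder l

  extension : ExtensionByTorsionClosure (P l) (discrete A) D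
  extension = record
    { ι = ι ; π = π ; isShortExact = isShortExact
    ; torsion-closure = (λ {d} → closure⊆image {d}) , (λ {d} → image⊆closure {d}) }

-- Replacing P by an isomorphic group, and the theorem

infixr 9 _∘ᶜ_

_∘ᶜ_ : ∀ {G H K} → ContinuousHomomorphism H K → ContinuousHomomorphism G H → ContinuousHomomorphism G K
_∘ᶜ_ {G} {_} {K} g f = continuousHomomorphism G K (asHom g ∘ʰ asHom f)
  λ o → ContinuousHomomorphism.continuous f (ContinuousHomomorphism.continuous g o)

≅-sym : ∀ {G H} → G ≅ H → H ≅ G
≅-sym iso = record { forward = backward ; backward = forward ; inverseˡ = inverseʳ ; inverseʳ = inverseˡ }
  where open _≅_ iso

-- Composing ι with an isomorphism preserves injectivity and the image, and exactness and the
-- closure condition involve ι through its image only.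
change-kernel : ∀ {T T′ A D} → T ≅ T′ → ExtensionByTorsionClosure T A D → ExtensionByTorsionClosure T′ A D
change-kernel {T} {T′} {A} {D} iso E = record
  { ι = ι ∘ᶜ backward
  ; π = π
  ; isShortExact = record
    { injective  = λ p → T′.trans (T′.sym (inverseˡ _)) (T′.trans (cong (asHom forward) (injective p)) (inverseˡ _))
    ; exact      = (λ p → proj₁ exact (to-old p)) , (λ p → to-new (proj₂ exact p))
    ; surjective = surjective }
  ; torsion-closure = (λ p → to-new (proj₁ torsion-closure p)) , (λ p → proj₂ torsion-closure (to-old p)) }
  where
  open ExtensionByTorsionClosure E
  open IsShortExact isShortExact
  open _≅_ iso
  module T′ = TG T′
  module D = TG D

  to-old : ∀ {d} → d ∈ ContinuousHomomorphism.image (ι ∘ᶜ backward) → d ∈ ContinuousHomomorphism.image ι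
  to-old (t , p) = ⟦ asHom backward ⟧ t , p

  to-new : ∀ {d} → d ∈ ContinuousHomomorphism.image ι → d ∈ ContinuousHomomorphism.image (ι ∘ᶜ backward)
  to-new (t , p) = ⟦ asHom forward ⟧ t , D.trans (cong (asHom ι) (inverseʳ t)) p

theorem4 : (em : ∀ {ℓ} → ExcludedMiddle ℓ) →
    (l : ℕ) → Prime l →
    (T : TopologicalAbelianGroup) → T ≅ ∏ (λ (k : ℕ) → discrete (ℤ/ (l ^ k))) →
    (A : AbelianGroup 0ℓ 0ℓ) → IsFiniteGroupOfPowerOrder l A →
    ∃! _≅_ (λ D → IsPro l D × ExtensionByTorsionClosure T (discrete A) D)
theorem4 em l l-prime T T≅P A (n , enum) =
  D , (isPro , change-kernel (≅-sym T≅P) extension) , λ (pro , E) →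
    extensions-isomorphic l-prime A enum relations em isPro pro extension (change-kernel T≅P E)
  where
  open FiniteGroup A enum using (Relation; relation-isSubmodule; relation-multiple)
  relations : Basis Relation
  relations = Classical.basis em relation-isSubmodule
    (relation-multiple (ℕ.m^n≢0 l n {{l-nonZero l-prime}}))
  open Existence l-prime A {n} enum relations
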